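{- Let $G=(V,E,w)$ be a finite undirected loopless graph with $n$ vertices and nonnegative edge weights $w_e\ge 0$ ($e\in E$). Let $t\ge 0$ and $-1\le\vartheta\le 1$ be real numbers. For $0\le k\le n$ let $A_k$ and $D_k$ be the weighted adjacency and degree matrices of the $k$-token graph $F_k(G)$, put $H_k^{(\vartheta)}=A_k+\vartheta D_k$, and set $$a_k^{(\vartheta)}(t)=\mathbf{1}_k^{*}\,e^{tH_k^{(\vartheta)}}\,\mathbf{1}_k ,$$ where $\mathbf 1_k$ is the all-ones vector indexed by the $k$-subsets of $V$. Then, for $1\le k\le n-1$, $$\left(\frac{a_k^{(\vartheta)}(t)}{\binom nk}\right)^2\ \ge\ \frac{a_{k-1}^{(\vartheta)}(t)}{\binom n{k-1}}\cdot\frac{a_{k+1}^{(\vartheta)}(t)}{\binom n{k+1}}.$$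
   Context: Edges of $G$ are two-element subsets $\{i,j\}$ of $V$. No connectedness is assumed, and zero weights are allowed. For $0\le k\le n$, the weighted $k$-token graph $F_k(G)$ has vertex set $\binom{V}{k}=\{S\subseteq V:|S|=k\}$. Its weighted adjacency matrix $A_k$, indexed by $\binom Vk$, has entries $(A_k)_{S,T}=w_{\{i,j\}}$ if the symmetric difference $S\triangle T=\{i,j\}$ is an edge in $E$, and $(A_k)_{S,T}=0$ otherwise. Its weighted degree matrix is $D_k=\operatorname{diag}(d_k(S):S\in\binom Vk)$ with $d_k(S)=\sum_{e\in E,\ |S\cap e|=1}w_e$. For $k=0$ and $k=n$ these are the $1\times1$ zero matrices. $e^{M}$ is the matrix exponential and $^*$ denotes transpose. -}

module Defs where

open import Data.Bool using (Bool; if_then_else_; _∧_; T)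
open import Data.Fin using (Fin; zero; suc)
import Data.Fin as Fin
open import Data.Fin.Subset using (Subset; inside; outside; _∪_; _∩_; _─_)
  renaming (∣_∣ to ∣_∣ˢ)
open import Data.Integer using (+_; +≤+; -[1+_])
import Data.Integer as ℤ
import Data.Integer.Properties as ℤP
open import Data.List using (List; []; _∷_; _++_; map; foldr; filter; filterᵇ; length; lookup)
open import Data.List.Membership.Propositional using (_∈_)
open import Data.List.Membership.Propositional.Properties
  using (∈-++⁺ˡ; ∈-++⁺ʳ; ∈-map⁺; ∈-map⁻; ∈-filter⁺)
open import Data.List.Relation.Unary.All using ([])
open import Data.List.Relation.Unary.AllPairs using ([]; _∷_)
open import Data.List.Relation.Unary.Any using (here)
open import Data.List.Relation.Unary.Unique.Propositional using (Unique)
import Data.List.Relation.Unary.Unique.Propositional.Properties as Unique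
open import Data.Nat using (ℕ; zero; suc; _!; _≡ᵇ_)
import Data.Nat as ℕ
open import Data.Nat.Combinatorics using (_C_; nCk+nC[k+1]≡[n+1]C[k+1])
import Data.Nat.Properties as ℕP
open import Data.Empty using (⊥)
open import Data.Product using (∃; _×_; _,_; proj₁; proj₂)
open import Data.Rational
  using (ℚ; mkℚ; 0ℚ; 1ℚ; ½; _+_; _*_; _-_; -_; ∣_∣; _⊔_; _≤_; _<_; _/_; 1/_;
         Positive; NonNegative; NonZero; positive; nonNegative; toℚᵘ)
open import Data.Rational.Properties
open import Data.Rational.Solver using (module +-*-Solver)
import Data.Rational.Unnormalised as ℚᵘ
import Data.Rational.Unnormalised.Properties as ℚᵘP
open import Data.Sum using (_⊎_; inj₁; inj₂)
open import Data.Vec using ([]; _∷_)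
import Data.Vec.Functional as Vector
open import Data.Vec.Properties using (∷-injectiveˡ; ∷-injectiveʳ)
open import Relation.Binary.PropositionalEquality
  using (_≡_; refl; sym; trans; cong; cong₂; subst; subst₂; module ≡-Reasoning)
open import Relation.Nullary using (does; yes; no)

open +-*-Solver using (solve; _:=_; _:+_; _:*_; _:-_; :-_; con)

fromℕ : ℕ → ℚ
fromℕ n = + n / 1

fromℕ-suc : ∀ n → fromℕ (suc n) ≡ 1ℚ + fromℕ n
fromℕ-suc n = toℚᵘ-injective (begin
  toℚᵘ (fromℕ (suc n))         ≈⟨ toℚᵘ-fromℚᵘ (ℚᵘ.mkℚᵘ (+ suc n) 0) ⟩
  ℚᵘ.mkℚᵘ (+ suc n) 0          ≈⟨ ℚᵘ.*≡* (cong (ℤ._* + 1) (cong (ℤ._+_ (+ 1)) (sym (ℤP.*-identityʳ (+ n))))) ⟩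
  ℚᵘ.1ℚᵘ ℚᵘ.+ ℚᵘ.mkℚᵘ (+ n) 0  ≈⟨ ℚᵘP.+-congʳ ℚᵘ.1ℚᵘ (toℚᵘ-fromℚᵘ (ℚᵘ.mkℚᵘ (+ n) 0)) ⟨
  toℚᵘ 1ℚ ℚᵘ.+ toℚᵘ (fromℕ n)  ≈⟨ toℚᵘ-homo-+ 1ℚ (fromℕ n) ⟨
  toℚᵘ (1ℚ + fromℕ n)          ∎)
  where open ℚᵘP.≃-Reasoning

fromℕ-*-unit : ∀ m d → fromℕ (suc m) * (+ 1 / (suc m ℕ.* suc d)) ≡ + 1 / suc d
fromℕ-*-unit m d = toℚᵘ-injective (begin
  toℚᵘ (fromℕ (suc m) * (+ 1 / (suc m ℕ.* suc d)))
    ≈⟨ toℚᵘ-homo-* (fromℕ (suc m)) (+ 1 / (suc m ℕ.* suc d)) ⟩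
  toℚᵘ (fromℕ (suc m)) ℚᵘ.* toℚᵘ (+ 1 / (suc m ℕ.* suc d))
    ≈⟨ ℚᵘP.*-cong (toℚᵘ-fromℚᵘ (ℚᵘ.mkℚᵘ (+ suc m) 0)) (toℚᵘ-fromℚᵘ (ℚᵘ.mkℚᵘ (+ 1) (d ℕ.+ m ℕ.* suc d))) ⟩
  ℚᵘ.mkℚᵘ (+ suc m) 0 ℚᵘ.* ℚᵘ.mkℚᵘ (+ 1) (d ℕ.+ m ℕ.* suc d)
    ≈⟨ ℚᵘ.*≡* (cong +_ (eq m d)) ⟩
  ℚᵘ.mkℚᵘ (+ 1) d
    ≈⟨ toℚᵘ-fromℚᵘ (ℚᵘ.mkℚᵘ (+ 1) d) ⟨
  toℚᵘ (+ 1 / suc d) ∎)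
  where
  open ℚᵘP.≃-Reasoning
  eq : ∀ m d → suc m ℕ.* 1 ℕ.* suc d ≡ 1 ℕ.* (1 ℕ.* (suc m ℕ.* suc d))
  eq m d = trans (cong (ℕ._* suc d) (ℕP.*-identityʳ (suc m)))
    (sym (trans (ℕP.*-identityˡ _) (ℕP.*-identityˡ _)))

1/! : ℕ → ℚ
1/! m = (+ 1 / (m !)) {{m ℕP.!≢0}}

fromℕ-*-1/! : ∀ m → fromℕ (suc m) * 1/! (suc m) ≡ 1/! m
fromℕ-*-1/! m = helper (m !) {{m ℕP.!≢0}} {{suc m ℕP.!≢0}}
  where
  helper : ∀ k .{{_ : ℕ.NonZero k}} .{{_ : ℕ.NonZero (suc m ℕ.* k)}} →
           fromℕ (suc m) * (+ 1 / (suc m ℕ.* k)) ≡ + 1 / k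
  helper (suc d) = fromℕ-*-unit m d

unit-nonNeg : ∀ d .{{_ : ℕ.NonZero d}} → 0ℚ ≤ + 1 / d
unit-nonNeg d = nonNegative⁻¹ (+ 1 / d) {{normalize-nonNeg 1 d}}

fromℕ-nonNeg : ∀ n → 0ℚ ≤ fromℕ n
fromℕ-nonNeg n = nonNegative⁻¹ (fromℕ n) {{normalize-nonNeg n 1}}

p≤1+p : ∀ p → p ≤ 1ℚ + p
p≤1+p p = subst (_≤ 1ℚ + p) (+-identityˡ p) (+-monoˡ-≤ p (nonNegative⁻¹ 1ℚ))

fromℕ-mono : ∀ {m n} → m ℕ.≤ n → fromℕ m ≤ fromℕ n
fromℕ-mono {n = n} ℕ.z≤n = fromℕ-nonNeg n
fromℕ-mono {suc m} {suc n} (ℕ.s≤s m≤n) =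
  subst₂ _≤_ (sym (fromℕ-suc m)) (sym (fromℕ-suc n)) (+-monoʳ-≤ 1ℚ (fromℕ-mono m≤n))

fromℕ-pos : ∀ n → 0ℚ < fromℕ (suc n)
fromℕ-pos n = <-≤-trans (positive⁻¹ 1ℚ)
  (subst (1ℚ ≤_) (sym (fromℕ-suc n))
    (subst (_≤ 1ℚ + fromℕ n) (+-identityʳ 1ℚ) (+-monoʳ-≤ 1ℚ (fromℕ-nonNeg n))))

archimedean : ∀ q → ∃ λ n → q ≤ fromℕ n
archimedean q@(mkℚ (+ n) d c) = n , toℚᵘ-cancel-≤ (begin
  ℚᵘ.mkℚᵘ (+ n) d ≤⟨ ℚᵘ.*≤* (subst₂ ℤ._≤_ (ℤP.pos-* n 1) (ℤP.pos-* n (suc d))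
                        (+≤+ (ℕP.*-monoʳ-≤ n (ℕ.s≤s ℕ.z≤n)))) ⟩
  ℚᵘ.mkℚᵘ (+ n) 0 ≃⟨ toℚᵘ-fromℚᵘ (ℚᵘ.mkℚᵘ (+ n) 0) ⟨
  toℚᵘ (fromℕ n)  ∎)
  where open ℚᵘP.≤-Reasoning
archimedean q@(mkℚ -[1+ n ] d c) = 0 , <⇒≤ (negative⁻¹ q)

*-mono-≤-nonNeg : ∀ {p q r s} → 0ℚ ≤ p → 0ℚ ≤ s → p ≤ q → r ≤ s → p * r ≤ q * s
*-mono-≤-nonNeg {p} {q} {r} {s} 0≤p 0≤s p≤q r≤s = ≤-trans
  (*-monoˡ-≤-nonNeg p {{nonNegative 0≤p}} r≤s)
  (*-monoʳ-≤-nonNeg s {{nonNegative 0≤s}} p≤q)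

*-nonNeg : ∀ {p q} → 0ℚ ≤ p → 0ℚ ≤ q → 0ℚ ≤ p * q
*-nonNeg {p} {q} 0≤p 0≤q =
  subst (_≤ p * q) (*-zeroʳ p) (*-monoˡ-≤-nonNeg p {{nonNegative 0≤p}} 0≤q)

*-pos : ∀ {p q} → 0ℚ < p → 0ℚ < q → 0ℚ < p * q
*-pos {p} {q} 0<p 0<q =
  subst (_< p * q) (*-zeroʳ p) (*-monoʳ-<-pos p {{positive 0<p}} 0<q)

½-pos : ∀ {ε} → 0ℚ < ε → 0ℚ < ½ * ε
½-pos = *-pos (positive⁻¹ ½)

halves : ∀ ε → ½ * ε + ½ * ε ≡ ε
halves = solve 1 (λ e → con ½ :* e :+ con ½ :* e := e) refl

archimedean-* : ∀ q {ε} → 0ℚ < ε → ∃ λ n → q ≤ ε * fromℕ n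
archimedean-* q {ε} 0<ε = n , (begin
  q                ≡⟨ *-identityˡ q ⟨
  1ℚ * q           ≡⟨ cong (_* q) (*-inverseʳ ε) ⟨
  ε * 1/ ε * q     ≡⟨ *-assoc ε (1/ ε) q ⟩
  ε * (1/ ε * q)   ≤⟨ *-monoˡ-≤-nonNeg ε {{nonNegative (<⇒≤ 0<ε)}} (proj₂ (archimedean (1/ ε * q))) ⟩
  ε * fromℕ n      ∎)
  where
  open ≤-Reasoning
  instance
    _ : NonZero ε
    _ = pos⇒nonZero ε {{positive 0<ε}}
  n : ℕ
  n = proj₁ (archimedean (1/ ε * q))

unit-small : ∀ {ε} → 0ℚ < ε → ∃ λ N → ∀ n → N ℕ.≤ n → + 1 / suc n ≤ ε
unit-small {ε} 0<ε = N , λ n N≤n →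
  *-cancelˡ-≤-pos (fromℕ (suc n)) {{positive (fromℕ-pos n)}} (begin
    fromℕ (suc n) * (+ 1 / suc n)  ≡⟨ unit n ⟩
    1ℚ                             ≤⟨ proj₂ (archimedean-* 1ℚ 0<ε) ⟩
    ε * fromℕ N                    ≤⟨ *-monoˡ-≤-nonNeg ε {{nonNegative (<⇒≤ 0<ε)}}
                                        (fromℕ-mono (ℕP.m≤n⇒m≤1+n N≤n)) ⟩
    ε * fromℕ (suc n)              ≡⟨ *-comm ε (fromℕ (suc n)) ⟩
    fromℕ (suc n) * ε              ∎)
  where
  open ≤-Reasoning
  N : ℕ
  N = proj₁ (archimedean-* 1ℚ 0<ε)
  unit : ∀ n → fromℕ (suc n) * (+ 1 / suc n) ≡ 1ℚ
  unit n = trans (cong (fromℕ (suc n) *_) (/-cong {+ 1} refl (sym (ℕP.*-identityʳ (suc n)))))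
                 (fromℕ-*-unit n 0)

∣p-q∣≡∣q-p∣ : ∀ p q → ∣ p - q ∣ ≡ ∣ q - p ∣
∣p-q∣≡∣q-p∣ p q = trans (cong ∣_∣ (solve 2 (λ p q → p :- q := :- (q :- p)) refl p q))
                        (∣-p∣≡∣p∣ (q - p))

p-p≡0 : ∀ p → p - p ≡ 0ℚ
p-p≡0 = +-inverseʳ

triangle : ∀ p q r → ∣ p - r ∣ ≤ ∣ p - q ∣ + ∣ q - r ∣
triangle p q r = subst (λ s → ∣ s ∣ ≤ ∣ p - q ∣ + ∣ q - r ∣)
  (solve 3 (λ p q r → (p :- q) :+ (q :- r) := p :- r) refl p q r)
  (∣p+q∣≤∣p∣+∣q∣ (p - q) (q - r))

IsCauchy : (ℕ → ℚ) → Set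
IsCauchy x = ∀ ε → 0ℚ < ε → ∃ λ N → ∀ m n → N ℕ.≤ m → N ℕ.≤ n → ∣ x m - x n ∣ ≤ ε

record ℝ : Set where
  constructor mkℝ
  field
    seq    : ℕ → ℚ
    cauchy : IsCauchy seq

open ℝ public

infix 4 _≤ᴿ_ _≥ᴿ_
infixl 6 _+ᴿ_ _-ᴿ_
infixl 7 _*ᴿ_ _/ᴿ_
infix 8 -ᴿ_ _²

-- Comparison of limits, not of terms.
_≤ᴿ_ : ℝ → ℝ → Set
x ≤ᴿ y = ∀ ε → 0ℚ < ε → ∃ λ N → ∀ n → N ℕ.≤ n → seq x n ≤ seq y n + ε

_≥ᴿ_ : ℝ → ℝ → Set
x ≥ᴿ y = y ≤ᴿ x

fromℚ : ℚ → ℝ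
fromℚ q = mkℝ (λ _ → q) λ ε 0<ε → 0 , λ _ _ _ _ →
  subst (λ p → ∣ p ∣ ≤ ε) (sym (p-p≡0 q)) (<⇒≤ 0<ε)

0ᴿ 1ᴿ : ℝ
0ᴿ = fromℚ 0ℚ
1ᴿ = fromℚ 1ℚ

_+ᴿ_ : ℝ → ℝ → ℝ
x +ᴿ y = mkℝ (λ n → seq x n + seq y n) λ ε 0<ε →
  let Nx , hx = cauchy x (½ * ε) (½-pos 0<ε)
      Ny , hy = cauchy y (½ * ε) (½-pos 0<ε)
  in Nx ℕ.⊔ Ny , λ m n N≤m N≤n → begin
    ∣ (seq x m + seq y m) - (seq x n + seq y n) ∣
      ≡⟨ cong ∣_∣ (rearrange (seq x m) (seq y m) (seq x n) (seq y n)) ⟩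
    ∣ (seq x m - seq x n) + (seq y m - seq y n) ∣
      ≤⟨ ∣p+q∣≤∣p∣+∣q∣ (seq x m - seq x n) (seq y m - seq y n) ⟩
    ∣ seq x m - seq x n ∣ + ∣ seq y m - seq y n ∣
      ≤⟨ +-mono-≤ (hx m n (ℕP.m⊔n≤o⇒m≤o Nx Ny N≤m) (ℕP.m⊔n≤o⇒m≤o Nx Ny N≤n))
                  (hy m n (ℕP.m⊔n≤o⇒n≤o Nx Ny N≤m) (ℕP.m⊔n≤o⇒n≤o Nx Ny N≤n)) ⟩
    ½ * ε + ½ * ε
      ≡⟨ halves ε ⟩
    ε ∎
  where
  open ≤-Reasoning
  rearrange : ∀ a b c d → (a + b) - (c + d) ≡ (a - c) + (b - d)
  rearrange = solve 4 (λ a b c d → (a :+ b) :- (c :+ d) := (a :- c) :+ (b :- d)) refl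

-ᴿ_ : ℝ → ℝ
-ᴿ x = mkℝ (λ n → - seq x n) λ ε 0<ε →
  let N , h = cauchy x ε 0<ε
  in N , λ m n N≤m N≤n → subst (_≤ ε)
    (trans (sym (∣-p∣≡∣p∣ (seq x m - seq x n)))
           (cong ∣_∣ (solve 2 (λ a b → :- (a :- b) := :- a :- :- b) refl (seq x m) (seq x n))))
    (h m n N≤m N≤n)

_-ᴿ_ : ℝ → ℝ → ℝ
x -ᴿ y = x +ᴿ (-ᴿ y)

∣_∣ᴿ : ℝ → ℝ
∣ x ∣ᴿ = mkℝ (λ n → ∣ seq x n ∣) λ ε 0<ε →
  let N , h = cauchy x ε 0<ε
  in N , λ m n N≤m N≤n → ≤-trans (reverse-triangle (seq x m) (seq x n)) (h m n N≤m N≤n)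
  where
  one-sided : ∀ p q → ∣ p ∣ - ∣ q ∣ ≤ ∣ p - q ∣
  one-sided p q = subst₂ _≤_ refl
    (solve 2 (λ a b → a :+ b :- b := a) refl ∣ p - q ∣ ∣ q ∣)
    (+-monoˡ-≤ (- ∣ q ∣) (subst (λ s → ∣ s ∣ ≤ ∣ p - q ∣ + ∣ q ∣)
      (solve 2 (λ p q → (p :- q) :+ q := p) refl p q)
      (∣p+q∣≤∣p∣+∣q∣ (p - q) q)))
  reverse-triangle : ∀ p q → ∣ ∣ p ∣ - ∣ q ∣ ∣ ≤ ∣ p - q ∣
  reverse-triangle p q with ∣p∣≡p∨∣p∣≡-p (∣ p ∣ - ∣ q ∣)
  ... | inj₁ eq = subst (_≤ ∣ p - q ∣) (sym eq) (one-sided p q)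
  ... | inj₂ eq = subst₂ _≤_
    (trans (solve 2 (λ a b → b :- a := :- (a :- b)) refl ∣ p ∣ ∣ q ∣) (sym eq))
    (∣p-q∣≡∣q-p∣ q p) (one-sided q p)

Bounded : ℚ → ℝ → Set
Bounded B x = ∀ n → ∣ seq x n ∣ ≤ B

bound : ∀ x → ∃ λ B → Bounded B x
bound x = 1ℚ + maxima N , λ n → near n (ℕP.≤-total N n)
  where
  N = proj₁ (cauchy x 1ℚ (positive⁻¹ 1ℚ))
  h = proj₂ (cauchy x 1ℚ (positive⁻¹ 1ℚ))
  maxima : ℕ → ℚ
  maxima zero    = ∣ seq x 0 ∣
  maxima (suc n) = ∣ seq x (suc n) ∣ ⊔ maxima n
  ≤maxima : ∀ {m n} → m ℕ.≤′ n → ∣ seq x m ∣ ≤ maxima n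
  ≤maxima {zero}  ℕ.≤′-refl = ≤-refl
  ≤maxima {suc m} ℕ.≤′-refl = p≤p⊔q ∣ seq x (suc m) ∣ (maxima m)
  ≤maxima {n = suc n} (ℕ.≤′-step m≤n) = ≤-trans (≤maxima m≤n) (p≤q⊔p ∣ seq x (suc n) ∣ (maxima n))
  near : ∀ n → _ → ∣ seq x n ∣ ≤ 1ℚ + maxima N
  near n (inj₂ n≤N) = ≤-trans (≤maxima (ℕP.≤⇒≤′ n≤N)) (p≤1+p (maxima N))
  near n (inj₁ N≤n) = begin
    ∣ seq x n ∣                          ≡⟨ cong ∣_∣ (solve 2 (λ a b → a := (a :- b) :+ b) refl (seq x n) (seq x N)) ⟩
    ∣ (seq x n - seq x N) + seq x N ∣    ≤⟨ ∣p+q∣≤∣p∣+∣q∣ (seq x n - seq x N) (seq x N) ⟩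
    ∣ seq x n - seq x N ∣ + ∣ seq x N ∣  ≤⟨ +-mono-≤ (h n N N≤n ℕP.≤-refl) (≤maxima ℕ.≤′-refl) ⟩
    1ℚ + maxima N                        ∎
    where open ≤-Reasoning

bound-nonNeg : ∀ {B} x → Bounded B x → 0ℚ ≤ B
bound-nonNeg x h = ≤-trans (0≤∣p∣ (seq x 0)) (h 0)

_*ᴿ_ : ℝ → ℝ → ℝ
x *ᴿ y = mkℝ (λ n → seq x n * seq y n) is-cauchy
  where
  open ≤-Reasoning
  A = proj₁ (bound x)
  hA = proj₂ (bound x)
  B = proj₁ (bound y)
  hB = proj₂ (bound y)
  K = 1ℚ + (A + B)
  A+B≥0 : 0ℚ ≤ A + B
  A+B≥0 = +-mono-≤ (bound-nonNeg x hA) (bound-nonNeg y hB)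
  0<K : 0ℚ < K
  0<K = <-≤-trans (positive⁻¹ 1ℚ) (+-monoʳ-≤ 1ℚ A+B≥0)
  instance
    _ : NonZero K
    _ = pos⇒nonZero K {{positive 0<K}}
  is-cauchy : IsCauchy (λ n → seq x n * seq y n)
  is-cauchy ε 0<ε =
    let δ = 1/ K * ε
        0<δ = *-pos (positive⁻¹ (1/ K) {{1/pos⇒pos K {{positive 0<K}}}}) 0<ε
        0≤δ = <⇒≤ 0<δ
        Nx , hx = cauchy x δ 0<δ
        Ny , hy = cauchy y δ 0<δ
    in Nx ℕ.⊔ Ny , λ m n N≤m N≤n → begin
      ∣ seq x m * seq y m - seq x n * seq y n ∣
        ≡⟨ cong ∣_∣ (rearrange (seq x m) (seq y m) (seq x n) (seq y n)) ⟩
      ∣ seq x m * (seq y m - seq y n) + (seq x m - seq x n) * seq y n ∣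
        ≤⟨ ∣p+q∣≤∣p∣+∣q∣ (seq x m * (seq y m - seq y n)) ((seq x m - seq x n) * seq y n) ⟩
      ∣ seq x m * (seq y m - seq y n) ∣ + ∣ (seq x m - seq x n) * seq y n ∣
        ≡⟨ cong₂ _+_ (∣p*q∣≡∣p∣*∣q∣ (seq x m) _) (∣p*q∣≡∣p∣*∣q∣ (seq x m - seq x n) _) ⟩
      ∣ seq x m ∣ * ∣ seq y m - seq y n ∣ + ∣ seq x m - seq x n ∣ * ∣ seq y n ∣
        ≤⟨ +-mono-≤
             (*-mono-≤-nonNeg (0≤∣p∣ (seq x m)) 0≤δ (hA m)
               (hy m n (ℕP.m⊔n≤o⇒n≤o Nx Ny N≤m) (ℕP.m⊔n≤o⇒n≤o Nx Ny N≤n)))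
             (*-mono-≤-nonNeg (0≤∣p∣ (seq x m - seq x n)) (bound-nonNeg y hB)
               (hx m n (ℕP.m⊔n≤o⇒m≤o Nx Ny N≤m) (ℕP.m⊔n≤o⇒m≤o Nx Ny N≤n)) (hB n)) ⟩
      A * δ + δ * B
        ≡⟨ solve 3 (λ a b d → a :* d :+ d :* b := (a :+ b) :* d) refl A B δ ⟩
      (A + B) * δ
        ≤⟨ *-monoʳ-≤-nonNeg δ {{nonNegative 0≤δ}} (p≤1+p (A + B)) ⟩
      K * δ
        ≡⟨ *-assoc K (1/ K) ε ⟨
      K * 1/ K * ε
        ≡⟨ cong (_* ε) (*-inverseʳ K) ⟩
      1ℚ * ε
        ≡⟨ *-identityˡ ε ⟩
      ε ∎
    where
    rearrange : ∀ a b c d → a * b - c * d ≡ a * (b - d) + (a - c) * d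
    rearrange = solve 4 (λ a b c d → a :* b :- c :* d := a :* (b :- d) :+ (a :- c) :* d) refl

_/ᴿ_ : ℝ → (d : ℕ) → .{{_ : ℕ.NonZero d}} → ℝ
x /ᴿ d = x *ᴿ fromℚ (+ 1 / d)

_² : ℝ → ℝ
x ² = x *ᴿ x

IsCauchyᴿ : (ℕ → ℝ) → Set
IsCauchyᴿ x = ∀ ε → 0ℚ < ε → ∃ λ N → ∀ m n → N ℕ.≤ m → N ℕ.≤ n → ∣ x m -ᴿ x n ∣ᴿ ≤ᴿ fromℚ ε

_⟶_ : (ℕ → ℝ) → ℝ → Set
x ⟶ y = ∀ ε → 0ℚ < ε → ∃ λ N → ∀ n → N ℕ.≤ n → ∣ x n -ᴿ y ∣ᴿ ≤ᴿ fromℚ ε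

module _ (x : ℕ → ℝ) (x-cauchy : IsCauchyᴿ x) where

  private
    index : ℕ → ℕ
    index n = proj₁ (cauchy (x n) (+ 1 / suc n) unit-pos)
      where
      unit-pos : 0ℚ < + 1 / suc n
      unit-pos = positive⁻¹ (+ 1 / suc n) {{normalize-pos 1 (suc n)}}

    diagonal : ℕ → ℚ
    diagonal n = seq (x n) (index n)

    diagonal-close : ∀ {n j} → index n ℕ.≤ j → ∣ diagonal n - seq (x n) j ∣ ≤ + 1 / suc n
    diagonal-close {n} {j} i≤j = proj₂ (cauchy (x n) (+ 1 / suc n) _) (index n) j ℕP.≤-refl i≤j

    quarters : ∀ ε → (½ * (½ * ε) + (½ * (½ * ε) + ½ * (½ * ε))) + ½ * (½ * ε) ≡ ε
    quarters = solve 1 (λ e → let q = con ½ :* (con ½ :* e) in (q :+ (q :+ q)) :+ q := e) refl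

    diagonal-cauchy : IsCauchy diagonal
    diagonal-cauchy ε 0<ε =
      let δ = ½ * (½ * ε)
          0<δ = ½-pos (½-pos 0<ε)
          N , h = x-cauchy δ 0<δ
          U , small = unit-small 0<δ
      in N ℕ.⊔ U , λ m n N≤m N≤n →
        let K , close = h m n (ℕP.m⊔n≤o⇒m≤o N U N≤m) (ℕP.m⊔n≤o⇒m≤o N U N≤n) δ 0<δ
            j = K ℕ.⊔ (index m ℕ.⊔ index n)
            K≤j = ℕP.m≤m⊔n K (index m ℕ.⊔ index n)
            im≤j = ℕP.≤-trans (ℕP.m≤m⊔n (index m) (index n)) (ℕP.m≤n⊔m K (index m ℕ.⊔ index n))
            in≤j = ℕP.≤-trans (ℕP.m≤n⊔m (index m) (index n)) (ℕP.m≤n⊔m K (index m ℕ.⊔ index n))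
        in begin
          ∣ diagonal m - diagonal n ∣
            ≤⟨ triangle (diagonal m) (seq (x n) j) (diagonal n) ⟩
          ∣ diagonal m - seq (x n) j ∣ + ∣ seq (x n) j - diagonal n ∣
            ≤⟨ +-monoˡ-≤ _ (triangle (diagonal m) (seq (x m) j) (seq (x n) j)) ⟩
          (∣ diagonal m - seq (x m) j ∣ + ∣ seq (x m) j - seq (x n) j ∣) + ∣ seq (x n) j - diagonal n ∣
            ≤⟨ +-mono-≤
                 (+-mono-≤ (≤-trans (diagonal-close im≤j) (small m (ℕP.m⊔n≤o⇒n≤o N U N≤m)))
                           (close j K≤j))
                 (≤-trans (≤-reflexive (∣p-q∣≡∣q-p∣ (seq (x n) j) (diagonal n)))
                   (≤-trans (diagonal-close in≤j) (small n (ℕP.m⊔n≤o⇒n≤o N U N≤n)))) ⟩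
          (δ + (δ + δ)) + δ
            ≡⟨ quarters ε ⟩
          ε ∎
      where open ≤-Reasoning

  lim : ℝ
  lim = mkℝ diagonal diagonal-cauchy

  lim-converges : x ⟶ lim
  lim-converges ε 0<ε =
    let N , h = x-cauchy (½ * ε) (½-pos 0<ε)
    in N , λ n N≤n η 0<η →
      let U , small = unit-small (½-pos 0<ε)
          P , x-n-close = cauchy (x n) (½ * η) (½-pos 0<η)
      in N ℕ.⊔ U ℕ.⊔ P , λ m M≤m →
        let N⊔U≤m = ℕP.m⊔n≤o⇒m≤o (N ℕ.⊔ U) P M≤m
            K , close = h n m N≤n (ℕP.m⊔n≤o⇒m≤o N U N⊔U≤m) (½ * η) (½-pos 0<η)
            j = K ℕ.⊔ (index m ℕ.⊔ m)
            K≤j = ℕP.m≤m⊔n K (index m ℕ.⊔ m)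
            i≤j = ℕP.≤-trans (ℕP.m≤m⊔n (index m) m) (ℕP.m≤n⊔m K (index m ℕ.⊔ m))
            m≤j = ℕP.≤-trans (ℕP.m≤n⊔m (index m) m) (ℕP.m≤n⊔m K (index m ℕ.⊔ m))
            P≤m = ℕP.m⊔n≤o⇒n≤o (N ℕ.⊔ U) P M≤m
        in begin
          ∣ seq (x n) m - diagonal m ∣
            ≤⟨ triangle (seq (x n) m) (seq (x m) j) (diagonal m) ⟩
          ∣ seq (x n) m - seq (x m) j ∣ + ∣ seq (x m) j - diagonal m ∣
            ≤⟨ +-monoˡ-≤ _ (triangle (seq (x n) m) (seq (x n) j) (seq (x m) j)) ⟩
          (∣ seq (x n) m - seq (x n) j ∣ + ∣ seq (x n) j - seq (x m) j ∣) + ∣ seq (x m) j - diagonal m ∣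
            ≤⟨ +-mono-≤
                 (+-mono-≤ (x-n-close m j P≤m (ℕP.≤-trans P≤m m≤j)) (close j K≤j))
                 (≤-trans (≤-reflexive (∣p-q∣≡∣q-p∣ (seq (x m) j) (diagonal m)))
                   (≤-trans (diagonal-close i≤j) (small m (ℕP.m⊔n≤o⇒n≤o N U N⊔U≤m)))) ⟩
          (½ * η + (½ * ε + ½ * η)) + ½ * ε
            ≡⟨ solve 2 (λ e h → (con ½ :* h :+ (con ½ :* e :+ con ½ :* h)) :+ con ½ :* e := e :+ h)
                 refl ε η ⟩
          ε + η ∎
    where open ≤-Reasoning

Matrix : ℕ → Set
Matrix d = Fin d → Fin d → ℝ

∑ : ∀ {d} → (Fin d → ℝ) → ℝ
∑ = Vector.foldr _+ᴿ_ 0ᴿ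

infixl 6 _+ᴹ_
infixl 7 _*ᴹ_ _•_
infixl 8 _^ᴹ_

_+ᴹ_ : ∀ {d} → Matrix d → Matrix d → Matrix d
(M +ᴹ N) i j = M i j +ᴿ N i j

_•_ : ∀ {d} → ℝ → Matrix d → Matrix d
(r • M) i j = r *ᴿ M i j

_*ᴹ_ : ∀ {d} → Matrix d → Matrix d → Matrix d
(M *ᴹ N) i j = ∑ λ k → M i k *ᴿ N k j

diag : ∀ {d} → (Fin d → ℝ) → Matrix d
diag v i j = if does (i Fin.≟ j) then v i else 0ᴿ

0ᴹ 1ᴹ : ∀ {d} → Matrix d
0ᴹ _ _ = 0ᴿ
1ᴹ = diag λ _ → 1ᴿ

_^ᴹ_ : ∀ {d} → Matrix d → ℕ → Matrix d
M ^ᴹ zero  = 1ᴹ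
M ^ᴹ suc m = M *ᴹ (M ^ᴹ m)

expSum : ∀ {d} → Matrix d → ℕ → Matrix d
expSum M zero    = 0ᴹ
expSum M (suc N) = expSum M N +ᴹ (fromℚ (1/! N) • M ^ᴹ N)

-- Rational exponential series dominating the matrix one entrywise.
module Majorant (c : ℚ) (0≤c : 0ℚ ≤ c) where

  power : ℕ → ℚ
  power zero    = 1ℚ
  power (suc m) = c * power m

  u : ℕ → ℚ
  u m = 1/! m * power m

  U : ℕ → ℚ
  U zero    = 0ℚ
  U (suc N) = U N + u N

  power-nonNeg : ∀ m → 0ℚ ≤ power m
  power-nonNeg zero    = nonNegative⁻¹ 1ℚ
  power-nonNeg (suc m) = *-nonNeg 0≤c (power-nonNeg m)

  1/!-nonNeg : ∀ m → 0ℚ ≤ 1/! m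
  1/!-nonNeg m = unit-nonNeg (m !) {{m ℕP.!≢0}}

  u-nonNeg : ∀ m → 0ℚ ≤ u m
  u-nonNeg m = *-nonNeg (1/!-nonNeg m) (power-nonNeg m)

  u-step : ∀ m → fromℕ (suc m) * (u (suc m) + u (suc m)) ≡ (c + c) * u m
  u-step m = begin
    f * (s * (c * p) + s * (c * p))  ≡⟨ solve 4 (λ f s c p → f :* (s :* (c :* p) :+ s :* (c :* p))
                                         := (c :+ c) :* ((f :* s) :* p)) refl f s c p ⟩
    (c + c) * ((f * s) * p)          ≡⟨ cong (λ r → (c + c) * (r * p)) (fromℕ-*-1/! m) ⟩
    (c + c) * u m                    ∎
    where
    open ≡-Reasoning
    f = fromℕ (suc m)
    s = 1/! (suc m)
    p = power m

  M₀ : ℕ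
  M₀ = proj₁ (archimedean (c + c))

  u-halves : ∀ {m} → M₀ ℕ.≤ m → u (suc m) + u (suc m) ≤ u m
  u-halves {m} M₀≤m = *-cancelˡ-≤-pos (fromℕ (suc m)) {{positive (fromℕ-pos m)}} (begin
    fromℕ (suc m) * (u (suc m) + u (suc m))  ≡⟨ u-step m ⟩
    (c + c) * u m                            ≤⟨ *-monoʳ-≤-nonNeg (u m) {{nonNegative (u-nonNeg m)}}
                                                 (≤-trans (proj₂ (archimedean (c + c)))
                                                   (fromℕ-mono (ℕP.m≤n⇒m≤1+n M₀≤m))) ⟩
    fromℕ (suc m) * u m                      ∎)
    where open ≤-Reasoning

  u≤u+u : ∀ m → u m ≤ u m + u m
  u≤u+u m = subst (_≤ u m + u m) (+-identityˡ (u m)) (+-monoˡ-≤ (u m) (u-nonNeg m))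

  u-decreasing : ∀ {m} → M₀ ℕ.≤′ m → u m ≤ u M₀
  u-decreasing ℕ.≤′-refl = ≤-refl
  u-decreasing {suc m} (ℕ.≤′-step M₀≤m) =
    ≤-trans (u≤u+u (suc m)) (≤-trans (u-halves (ℕP.≤′⇒≤ M₀≤m)) (u-decreasing M₀≤m))

  U+2u-decreasing : ∀ {p q} → M₀ ℕ.≤ p → p ℕ.≤′ q → U q + (u q + u q) ≤ U p + (u p + u p)
  U+2u-decreasing M₀≤p ℕ.≤′-refl = ≤-refl
  U+2u-decreasing {p} {suc q} M₀≤p (ℕ.≤′-step p≤q) = begin
    (U q + u q) + (u (suc q) + u (suc q))  ≤⟨ +-monoʳ-≤ (U q + u q)
                                                (u-halves (ℕP.≤-trans M₀≤p (ℕP.≤′⇒≤ p≤q))) ⟩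
    (U q + u q) + u q                      ≡⟨ +-assoc (U q) (u q) (u q) ⟩
    U q + (u q + u q)                      ≤⟨ U+2u-decreasing M₀≤p p≤q ⟩
    U p + (u p + u p)                      ∎
    where open ≤-Reasoning

  U-tail : ∀ {p q} → M₀ ℕ.≤ p → p ℕ.≤ q → U q - U p ≤ u p + u p
  U-tail {p} {q} M₀≤p p≤q = begin
    U q - U p                      ≤⟨ +-monoˡ-≤ (- U p) (≤-trans U≤U+2u (U+2u-decreasing M₀≤p (ℕP.≤⇒≤′ p≤q))) ⟩
    (U p + (u p + u p)) - U p      ≡⟨ solve 2 (λ a b → (a :+ b) :- a := b) refl (U p) (u p + u p) ⟩
    u p + u p                      ∎
    where
    open ≤-Reasoning
    U≤U+2u : U q ≤ U q + (u q + u q)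
    U≤U+2u = subst (_≤ U q + (u q + u q)) (+-identityʳ (U q))
      (+-monoʳ-≤ (U q) (≤-trans (u-nonNeg q) (u≤u+u q)))

  U-cauchy : ∀ {ε} → 0ℚ < ε → ∃ λ N → ∀ {p q} → N ℕ.≤ p → p ℕ.≤ q → U q - U p ≤ ε
  U-cauchy {ε} 0<ε = suc (M₀ ℕ.⊔ N) , tail
    where
    open ≤-Reasoning
    large : ∃ λ n → (c + c) * u M₀ ≤ ε * fromℕ n
    large = archimedean-* ((c + c) * u M₀) 0<ε
    N : ℕ
    N = proj₁ large
    tail : ∀ {p q} → suc (M₀ ℕ.⊔ N) ℕ.≤ p → p ℕ.≤ q → U q - U p ≤ ε
    tail {suc p} {q} (ℕ.s≤s M≤p) p<q =
      ≤-trans (U-tail (ℕP.m≤n⇒m≤1+n (ℕP.m⊔n≤o⇒m≤o M₀ N M≤p)) p<q)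
        (*-cancelˡ-≤-pos (fromℕ (suc p)) {{positive (fromℕ-pos p)}} (begin
          fromℕ (suc p) * (u (suc p) + u (suc p))  ≡⟨ u-step p ⟩
          (c + c) * u p                            ≤⟨ *-monoˡ-≤-nonNeg (c + c) {{nonNegative (+-mono-≤ 0≤c 0≤c)}}
                                                        (u-decreasing (ℕP.≤⇒≤′ (ℕP.m⊔n≤o⇒m≤o M₀ N M≤p))) ⟩
          (c + c) * u M₀                           ≤⟨ proj₂ large ⟩
          ε * fromℕ N                              ≤⟨ *-monoˡ-≤-nonNeg ε {{nonNegative (<⇒≤ 0<ε)}}
                                                        (fromℕ-mono (ℕP.m≤n⇒m≤1+n (ℕP.m⊔n≤o⇒n≤o M₀ N M≤p))) ⟩
          ε * fromℕ (suc p)                        ≡⟨ *-comm ε (fromℕ (suc p)) ⟩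
          fromℕ (suc p) * ε                        ∎))

bounded-* : ∀ {A B} x y → Bounded A x → Bounded B y → Bounded (A * B) (x *ᴿ y)
bounded-* {A} {B} x y hx hy n = subst (_≤ A * B) (sym (∣p*q∣≡∣p∣*∣q∣ (seq x n) (seq y n)))
  (*-mono-≤-nonNeg (0≤∣p∣ (seq x n)) (bound-nonNeg y hy) (hx n) (hy n))

bounded-∑ : ∀ {B d} (f : Fin d → ℝ) → (∀ i → Bounded B (f i)) → Bounded (fromℕ d * B) (∑ f)
bounded-∑ {B} {zero}  f h n = ≤-reflexive (sym (*-zeroˡ B))
bounded-∑ {B} {suc d} f h n = begin
  ∣ seq (f zero) n + seq (∑ λ i → f (suc i)) n ∣
    ≤⟨ ∣p+q∣≤∣p∣+∣q∣ (seq (f zero) n) (seq (∑ λ i → f (suc i)) n) ⟩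
  ∣ seq (f zero) n ∣ + ∣ seq (∑ λ i → f (suc i)) n ∣
    ≤⟨ +-mono-≤ (h zero n) (bounded-∑ (λ i → f (suc i)) (λ i → h (suc i)) n) ⟩
  B + fromℕ d * B
    ≡⟨ solve 2 (λ b d → b :+ d :* b := (con 1ℚ :+ d) :* b) refl B (fromℕ d) ⟩
  (1ℚ + fromℕ d) * B
    ≡⟨ cong (_* B) (fromℕ-suc d) ⟨
  fromℕ (suc d) * B ∎
  where open ≤-Reasoning

upper : ∀ {d} (b : Fin d → ℚ) → ∃ λ B → ∀ i → b i ≤ B
upper {zero}  b = 0ℚ , λ ()
upper {suc d} b =
  let B , h = upper (λ i → b (suc i))
  in b zero ⊔ B , λ where
    zero    → p≤p⊔q (b zero) B
    (suc i) → ≤-trans (h i) (p≤q⊔p (b zero) B)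

bound-matrix : ∀ {d} (M : Matrix d) → ∃ λ B → ∀ i j → Bounded B (M i j)
bound-matrix M =
  let row i = upper (λ j → proj₁ (bound (M i j)))
      B , h = upper (λ i → proj₁ (row i))
  in B , λ i j n → ≤-trans (proj₂ (bound (M i j)) n) (≤-trans (proj₂ (row i) j) (h i))

module _ {d : ℕ} (M : Matrix d) (i j : Fin d) where

  private
    B : ℚ
    B = proj₁ (bound-matrix M)

    0≤B : 0ℚ ≤ B
    0≤B = bound-nonNeg (M i j) (proj₂ (bound-matrix M) i j)

    open Majorant (fromℕ d * B) (*-nonNeg (fromℕ-nonNeg d) 0≤B)

    bounded-power : ∀ m k l → Bounded (power m) ((M ^ᴹ m) k l)
    bounded-power zero k l n with k Fin.≟ l
    ... | yes _ = ≤-refl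
    ... | no  _ = nonNegative⁻¹ 1ℚ
    bounded-power (suc m) k l n = subst (∣ seq ((M ^ᴹ suc m) k l) n ∣ ≤_)
      (sym (*-assoc (fromℕ d) B (power m)))
      (bounded-∑ (λ o → M k o *ᴿ (M ^ᴹ m) o l)
        (λ o → bounded-* (M k o) ((M ^ᴹ m) o l) (proj₂ (bound-matrix M) k o) (bounded-power m o l)) n)

    bounded-term : ∀ m → Bounded (u m) (fromℚ (1/! m) *ᴿ (M ^ᴹ m) i j)
    bounded-term m = bounded-* (fromℚ (1/! m)) ((M ^ᴹ m) i j)
      (λ _ → ≤-reflexive (0≤p⇒∣p∣≡p (1/!-nonNeg m))) (bounded-power m i j)

    bounded-diff : ∀ {p q} → p ℕ.≤′ q →
                   Bounded (U q - U p) (expSum M q i j -ᴿ expSum M p i j)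
    bounded-diff {p} ℕ.≤′-refl n = ≤-reflexive
      (trans (cong ∣_∣ (p-p≡0 (seq (expSum M p i j) n))) (sym (p-p≡0 (U p))))
    bounded-diff {p} {suc q} (ℕ.≤′-step p≤q) n = begin
      ∣ (S q + t) - S p ∣        ≡⟨ cong ∣_∣ (swap (S q) t (S p)) ⟩
      ∣ (S q - S p) + t ∣        ≤⟨ ∣p+q∣≤∣p∣+∣q∣ (S q - S p) t ⟩
      ∣ S q - S p ∣ + ∣ t ∣      ≤⟨ +-mono-≤ (bounded-diff p≤q n) (bounded-term q n) ⟩
      (U q - U p) + u q          ≡⟨ swap (U q) (u q) (U p) ⟨
      (U q + u q) - U p          ∎
      where
      open ≤-Reasoning
      S : ℕ → ℚ
      S r = seq (expSum M r i j) n
      t : ℚ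
      t = seq (fromℚ (1/! q) *ᴿ (M ^ᴹ q) i j) n
      swap : ∀ a b c → (a + b) - c ≡ (a - c) + b
      swap = solve 3 (λ a b c → (a :+ b) :- c := (a :- c) :+ b) refl

    close : ∀ {ε N} → (∀ {p q} → N ℕ.≤ p → p ℕ.≤ q → U q - U p ≤ ε) →
            ∀ p q → N ℕ.≤ p → N ℕ.≤ q → p ℕ.≤ q ⊎ q ℕ.≤ p →
            Bounded ε (expSum M p i j -ᴿ expSum M q i j)
    close     tail p q N≤p N≤q (inj₂ q≤p) n = ≤-trans (bounded-diff (ℕP.≤⇒≤′ q≤p) n) (tail N≤q q≤p)
    close {ε} tail p q N≤p N≤q (inj₁ p≤q) n = subst (_≤ ε)
      (∣p-q∣≡∣q-p∣ (seq (expSum M q i j) n) (seq (expSum M p i j) n))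
      (≤-trans (bounded-diff (ℕP.≤⇒≤′ p≤q) n) (tail N≤p p≤q))

  expSum-cauchy : IsCauchyᴿ (λ N → expSum M N i j)
  expSum-cauchy ε 0<ε =
    let N , tail = U-cauchy 0<ε
    in N , λ p q N≤p N≤q η 0<η → 0 , λ n _ →
      ≤-trans (close tail p q N≤p N≤q (ℕP.≤-total p q) n)
        (subst (_≤ ε + η) (+-identityʳ ε) (+-monoʳ-≤ ε (<⇒≤ 0<η)))

expᴹ : ∀ {d} → Matrix d → Matrix d
expᴹ M i j = lim (λ N → expSum M N i j) (expSum-cauchy M i j)

expᴹ-converges : ∀ {d} (M : Matrix d) i j → (λ N → expSum M N i j) ⟶ expᴹ M i j
expᴹ-converges M i j = lim-converges (λ N → expSum M N i j) (expSum-cauchy M i j)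

infixl 5 _△_

_△_ : ∀ {n} → Subset n → Subset n → Subset n
S △ T = (S ─ T) ∪ (T ─ S)

subsets : ∀ n → List (Subset n)
subsets zero    = [] ∷ []
subsets (suc n) = map (outside ∷_) (subsets n) ++ map (inside ∷_) (subsets n)

subsets-complete : ∀ {n} (S : Subset n) → S ∈ subsets n
subsets-complete []            = here refl
subsets-complete (outside ∷ S) = ∈-++⁺ˡ (∈-map⁺ (outside ∷_) (subsets-complete S))
subsets-complete (inside  ∷ S) = ∈-++⁺ʳ (map (outside ∷_) (subsets _)) (∈-map⁺ (inside ∷_) (subsets-complete S))

subsets-unique : ∀ n → Unique (subsets n)
subsets-unique zero    = [] ∷ []
subsets-unique (suc n) = Unique.++⁺
  (Unique.map⁺ ∷-injectiveʳ (subsets-unique n))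
  (Unique.map⁺ ∷-injectiveʳ (subsets-unique n))
  λ (S∈out , S∈in) → clash (∈-map⁻ (outside ∷_) S∈out) (∈-map⁻ (inside ∷_) S∈in)
  where
  clash : ∀ {S} → (∃ λ T → T ∈ subsets n × S ≡ outside ∷ T) →
          (∃ λ T → T ∈ subsets n × S ≡ inside ∷ T) → ⊥
  clash (_ , _ , refl) (_ , _ , ())

kSubsets : ∀ n → ℕ → List (Subset n)
kSubsets n k = filter (λ S → ∣ S ∣ˢ ℕ.≟ k) (subsets n)

kSubsets-complete : ∀ {n} (S : Subset n) → S ∈ kSubsets n ∣ S ∣ˢ
kSubsets-complete S = ∈-filter⁺ (λ T → ∣ T ∣ˢ ℕ.≟ ∣ S ∣ˢ) (subsets-complete S) refl

kSubsets-unique : ∀ n k → Unique (kSubsets n k)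
kSubsets-unique n k = Unique.filter⁺ (λ S → ∣ S ∣ˢ ℕ.≟ k) (subsets-unique n)

-- The vertex set is Fin n. Values of weight outside the edge set are
-- never used.
record WeightedGraph (n : ℕ) : Set where
  field
    isEdge        : Subset n → Bool
    weight        : Subset n → ℝ
    edge-size     : ∀ e → T (isEdge e) → ∣ e ∣ˢ ≡ 2
    weight-nonNeg : ∀ e → T (isEdge e) → 0ᴿ ≤ᴿ weight e

-- Matrices indexed by the k-subsets of Fin n are indexed by positions
-- in the duplicate-free list kSubsets n k.
module Token {n : ℕ} (G : WeightedGraph n) (k : ℕ) where

  open WeightedGraph G

  order : ℕ
  order = length (kSubsets n k)

  vertex : Fin order → Subset n
  vertex = lookup (kSubsets n k)

  adjacency : Matrix order
  adjacency s t =
    if isEdge (vertex s △ vertex t) then weight (vertex s △ vertex t) else 0ᴿ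

  degree : Subset n → ℝ
  degree S = foldr (λ e r → weight e +ᴿ r) 0ᴿ
    (filterᵇ (λ e → isEdge e ∧ (∣ S ∩ e ∣ˢ ≡ᵇ 1)) (subsets n))

  degreeMatrix : Matrix order
  degreeMatrix = diag λ s → degree (vertex s)

  H : ℝ → Matrix order
  H ϑ = adjacency +ᴹ ϑ • degreeMatrix

  -- 1* e^{tH} 1 is the sum of all entries of e^{tH}.
  a : ℝ → ℝ → ℝ
  a ϑ t = ∑ λ s → ∑ λ s′ → expᴹ (t • H ϑ) s s′

nCk≢0 : ∀ {n k} → k ℕ.≤ n → ℕ.NonZero (n C k)
nCk≢0 {n}     {zero}  ℕ.z≤n       = _
nCk≢0 {suc n} {suc k} (ℕ.s≤s k≤n) = subst ℕ.NonZero (nCk+nC[k+1]≡[n+1]C[k+1] n k)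
  (ℕ.>-nonZero (ℕP.<-≤-trans (ℕ.>-nonZero⁻¹ (n C k) {{nCk≢0 k≤n}}) (ℕP.m≤m+n (n C k) (n C suc k))))

normalized-a : ∀ {n} → WeightedGraph n → (ϑ t : ℝ) → ∀ k → k ℕ.≤ n → ℝ
normalized-a {n} G ϑ t k k≤n = (Token.a G k ϑ t /ᴿ (n C k)) {{nCk≢0 k≤n}}

{-# OPTIONS --safe #-}

-- The matrices A_k + ϑ D_k are the blocks of a sum of two-site operators
-- w_e h_e acting on functions c of subsets of V, where h_e sends the pair
-- of values of c at S and S △ e, |S ∩ e| = 1, through [[ϑ, 1], [1, ϑ]].
-- Hence e^{tH} 1 is the limit of the Euler products Π_e (1 + (t/N) w_e h_e)^N 1.
-- Each factor preserves the positive functions c for which every Hessian of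
-- Σ c(S) x^S y^{n-|S|} has Lorentzian signature: on the sites of e it acts
-- as R = [[p, q], [q, p]] with p + q ≥ 1 and |p - q| ≤ 1 (this is -1 ≤ ϑ ≤ 1),
-- and the new Hessians are pullbacks of old ones under R minus positive
-- semidefinite forms, or sums of two forms with a common negative hyperplane.
-- The same sum argument shows that Σ ∂_i preserves the class, and the
-- inequality for (Σ ∂_i)^{k-1} c at the empty set is Newton's inequality for the
-- level sums of c. At the level of the rational approximations all of this is
-- exact, provided the data are first projected onto t, w ≥ 0 and -1 ≤ ϑ ≤ 1.

module Submission where

open import Defs
open import Algebra.Bundles using (CommutativeRing)
open import Data.Bool using (Bool; true; false; if_then_else_; _∧_; _xor_; T)
open import Data.Bool.Properties using (if-float; T?)
open import Data.Fin using (Fin; zero; suc)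
import Data.Fin as Fin
open import Data.Fin.Subset using (Subset; inside; outside; ∁; ⊥; ⊤; ⁅_⁆; _∩_; _∪_; _─_)
  renaming (∣_∣ to ∣_∣ˢ)
import Data.Integer as ℤ
open import Data.List using (List; []; _∷_; _++_; map; foldr; filter; filterᵇ; length; lookup)
open import Data.List.Membership.Propositional.Properties using (∈-lookup; ∈-filter⁻)
open import Data.List.Relation.Unary.All using (All; []; _∷_)
import Data.List.Relation.Unary.All as All
import Data.List.Relation.Unary.All.Properties as AllP
open import Data.Nat using (ℕ; suc; _∸_; _≤_; _<_)
open import Data.Nat using (zero; _≡ᵇ_; _!)
import Data.Nat as ℕ
open import Data.Nat.Combinatorics using (_C_; nCk+nC[k+1]≡[n+1]C[k+1]; k>n⇒nCk≡0)
open import Data.Nat.Properties using (≤-trans; <⇒≤; m∸n≤m)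
import Data.Nat.Properties as ℕP
open import Data.Product using (∃; _×_; _,_; proj₁; proj₂)
open import Data.Rational
  using (ℚ; 0ℚ; 1ℚ; ½; _+_; _*_; _-_; -_; ∣_∣; 1/_; _/_; NonZero; positive; nonNegative)
  renaming (_≤_ to _≤ℚ_; _<_ to _<ℚ_)
import Data.Rational as ℚ
import Data.Rational.Properties as ℚP
open import Data.Rational.Solver using (module +-*-Solver)
open import Data.Sum using (_⊎_; inj₁; inj₂)
open import Data.Vec using (Vec; []; _∷_)
import Data.Vec as Vec
import Data.Vec.Properties as VecP
open import Relation.Binary.PropositionalEquality
  using (_≡_; _≢_; _≗_; refl; sym; trans; cong; cong₂; subst; subst₂; module ≡-Reasoning)
open import Relation.Nullary using (does)
open import Relation.Unary using (Decidable)

open import Algebra.Properties.Semiring.Exp (CommutativeRing.semiring ℚP.+-*-commutativeRing) using (_^_; ^-assocʳ)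
open import Algebra.Properties.Semiring.Sum (CommutativeRing.semiring ℚP.+-*-commutativeRing)
  using (sum; sum-cong-≗; ∑-distrib-+; ∑-comm; *-distribˡ-sum; sum-replicate-zero)
open +-*-Solver using (solve; _:=_; _:+_; _:*_; _:-_; :-_; con)

-- Rational inequalities

-- Strict positivity of all coefficients keeps the class elementary. Lorentzian polynomials in
-- general also need a condition on the support; with full support only the quadratic conditions
-- remain, and their leading coefficients can be divided by. The constant field starts in the class,
-- and a hop keeps strict positivity because its diagonal coefficient `1 + aϑ` is at least 1/2 as
-- soon as `a ≤ 1/2`.
--
-- The price of working with rational Euler factors is a double limit. A real number is a Cauchy
-- sequence, its inequalities hold only in the limit, and the rational data at index `i` change with
-- `i`. The number of Euler sweeps therefore has to be fixed before `i`, and the error bounds may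
-- depend on the data only through a bound on their size. Such bounds come from majorants: each
-- operator identity is repeated with norms in place of operators.
--
-- Homogenization produces the binomial denominators: the exponents of y turn into the factors
-- `2 + m` and `1 + m`, which cancel against ratios of consecutive binomial coefficients.

≤-by-diff : ∀ {p q} r → 0ℚ ≤ℚ r → q ≡ p + r → p ≤ℚ q
≤-by-diff {p} r 0≤r refl = subst (_≤ℚ p + r) (ℚP.+-identityʳ p) (ℚP.+-monoʳ-≤ p 0≤r)

diff-nonNeg : ∀ {p q} → p ≤ℚ q → 0ℚ ≤ℚ q - p
diff-nonNeg {p} {q} p≤q = subst (_≤ℚ q - p) (p-p≡0 p) (ℚP.+-monoˡ-≤ (- p) p≤q)

+-nonNeg : ∀ {p q} → 0ℚ ≤ℚ p → 0ℚ ≤ℚ q → 0ℚ ≤ℚ p + q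
+-nonNeg = ℚP.+-mono-≤

+-pos-nonNeg : ∀ {p q} → 0ℚ <ℚ p → 0ℚ ≤ℚ q → 0ℚ <ℚ p + q
+-pos-nonNeg = ℚP.+-mono-<-≤

square-nonNeg : ∀ p → 0ℚ ≤ℚ p * p
square-nonNeg p with ℚP.≤-total 0ℚ p
... | inj₁ 0≤p = *-nonNeg 0≤p 0≤p
... | inj₂ p≤0 = subst (0ℚ ≤ℚ_) (solve 1 (λ p → :- p :* :- p := p :* p) refl p)
  (*-nonNeg (ℚP.neg-antimono-≤ p≤0) (ℚP.neg-antimono-≤ p≤0))

*-monoˡ : ∀ {r p q} → 0ℚ ≤ℚ r → p ≤ℚ q → r * p ≤ℚ r * q
*-monoˡ {r} 0≤r = ℚP.*-monoˡ-≤-nonNeg r {{nonNegative 0≤r}}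

*-monoʳ : ∀ {r p q} → 0ℚ ≤ℚ r → p ≤ℚ q → p * r ≤ℚ q * r
*-monoʳ {r} 0≤r = ℚP.*-monoʳ-≤-nonNeg r {{nonNegative 0≤r}}

*-cancelˡ : ∀ {r p q} → 0ℚ <ℚ r → r * p ≤ℚ r * q → p ≤ℚ q
*-cancelˡ {r} 0<r = ℚP.*-cancelˡ-≤-pos r {{positive 0<r}}

inverse : ∀ {q} → 0ℚ <ℚ q → ∃ λ r → r * q ≡ 1ℚ
inverse {q} 0<q = 1/ q , ℚP.*-inverseˡ q
  where
  instance
    _ : NonZero q
    _ = ℚP.pos⇒nonZero q {{positive 0<q}}

-- The free parameter of each hypothesis is tuned so that both squares
-- become κ² times the square of the leading coefficient, for the same κ;
-- the two inequalities can then be added.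
combine : ∀ {μ ν a b g A B D α β p q} →
          0ℚ <ℚ a → 0ℚ <ℚ b → 0ℚ <ℚ g → 0ℚ <ℚ p → 0ℚ ≤ℚ q →
          (∀ s → μ * (a * (A + (s + s) * D)) ≤ℚ ν * ((α + s * g) * (α + s * g))) →
          (∀ s → μ * (b * (B + (s + s) * D)) ≤ℚ ν * ((β + s * g) * (β + s * g))) →
          ∀ s → μ * ((p * a + q * b) * (p * A + q * B + (s + s) * D))
                  ≤ℚ ν * ((p * α + q * β + s * g) * (p * α + q * β + s * g))
combine {μ} {ν} {a} {b} {g} {A} {B} {D} {α} {β} {p} {q} 0<a 0<b 0<g 0<p 0≤q ha hb s =
  subst₂ _≤ℚ_ left right (*-monoˡ (ℚP.<⇒≤ 0<c) (ℚP.+-mono-≤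
    (*-monoˡ (ℚP.<⇒≤ 0<p) (tuned a α A 0<a ha)) (*-monoˡ 0≤q (tuned b β B 0<b hb))))
  where
  c = p * a + q * b
  0<c : 0ℚ <ℚ c
  0<c = +-pos-nonNeg (*-pos 0<p 0<a) (*-nonNeg 0≤q (ℚP.<⇒≤ 0<b))
  c⁻¹ = proj₁ (inverse 0<c)
  g⁻¹ = proj₁ (inverse 0<g)
  γ = p * α + q * β + s * g
  κ = γ * c⁻¹
  κc≡γ : κ * c ≡ γ
  κc≡γ = trans (ℚP.*-assoc γ c⁻¹ c) (trans (cong (γ *_) (proj₂ (inverse 0<c))) (ℚP.*-identityʳ γ))
  shift : ℚ → ℚ → ℚ
  shift b β = (κ * b - β) * g⁻¹
  shift-g : ∀ b β → β + shift b β * g ≡ κ * b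
  shift-g b β = trans (cong (β +_) (trans (ℚP.*-assoc (κ * b - β) g⁻¹ g)
    (trans (cong ((κ * b - β) *_) (proj₂ (inverse 0<g))) (ℚP.*-identityʳ _))))
    (solve 2 (λ β k → β :+ (k :- β) := k) refl β (κ * b))
  tuned : ∀ b β B → 0ℚ <ℚ b →
          (∀ s → μ * (b * (B + (s + s) * D)) ≤ℚ ν * ((β + s * g) * (β + s * g))) →
          μ * (B + (shift b β + shift b β) * D) ≤ℚ ν * (κ * κ * b)
  tuned b β B 0<b h = *-cancelˡ 0<b (subst₂ _≤ℚ_
    (solve 3 (λ m b x → m :* (b :* x) := b :* (m :* x)) refl μ b _)
    (trans (cong (λ z → ν * (z * z)) (shift-g b β))
      (solve 3 (λ n k b → n :* (k :* b :* (k :* b)) := b :* (n :* (k :* k :* b))) refl ν κ b))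
    (h (shift b β)))
  shifts : p * shift a α + q * shift b β ≡ s
  shifts = begin
    p * shift a α + q * shift b β
      ≡⟨ solve 8 (λ p q k a b α β i → p :* ((k :* a :- α) :* i) :+ q :* ((k :* b :- β) :* i)
           := (k :* (p :* a :+ q :* b) :- (p :* α :+ q :* β)) :* i) refl p q κ a b α β g⁻¹ ⟩
    (κ * c - (p * α + q * β)) * g⁻¹
      ≡⟨ cong (λ z → (z - (p * α + q * β)) * g⁻¹) κc≡γ ⟩
    (p * α + q * β + s * g - (p * α + q * β)) * g⁻¹
      ≡⟨ solve 4 (λ x s g i → (x :+ s :* g :- x) :* i := s :* (i :* g)) refl (p * α + q * β) s g g⁻¹ ⟩
    s * (g⁻¹ * g)
      ≡⟨ trans (cong (s *_) (proj₂ (inverse 0<g))) (ℚP.*-identityʳ s) ⟩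
    s ∎
    where open ≡-Reasoning
  left : c * (p * (μ * (A + (shift a α + shift a α) * D)) + q * (μ * (B + (shift b β + shift b β) * D)))
         ≡ μ * (c * (p * A + q * B + (s + s) * D))
  left = trans
    (solve 9 (λ c p m A s₁ D q B s₂ →
        c :* (p :* (m :* (A :+ (s₁ :+ s₁) :* D)) :+ q :* (m :* (B :+ (s₂ :+ s₂) :* D)))
        := m :* (c :* (p :* A :+ q :* B :+ ((p :* s₁ :+ q :* s₂) :+ (p :* s₁ :+ q :* s₂)) :* D)))
      refl c p μ A (shift a α) D q B (shift b β))
    (cong (λ z → μ * (c * (p * A + q * B + (z + z) * D))) shifts)
  right : c * (p * (ν * (κ * κ * a)) + q * (ν * (κ * κ * b))) ≡ ν * (γ * γ)
  right = trans
    (solve 6 (λ p a q b n k → (p :* a :+ q :* b) :* (p :* (n :* (k :* k :* a)) :+ q :* (n :* (k :* k :* b)))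
        := n :* (k :* (p :* a :+ q :* b) :* (k :* (p :* a :+ q :* b)))) refl p a q b ν κ)
    (cong (λ z → ν * (z * z)) κc≡γ)

-- Lorentzian fields

Field : ℕ → Set
Field n = Subset n → ℚ

-- ∂ x c S is the sum of xᵢ c(S ∪ {i}) over i ∉ S: the directional
-- derivative of the multiaffine polynomial with coefficients c.
∂ : ∀ {n} → Vec ℚ n → Field n → Field n
∂ []       c []            = 0ℚ
∂ (x ∷ xs) c (outside ∷ S) = x * c (inside ∷ S) + ∂ xs (λ T → c (outside ∷ T)) S
∂ (x ∷ xs) c (inside ∷ S)  = ∂ xs (λ T → c (inside ∷ T)) S

∂-cong : ∀ {n} (x : Vec ℚ n) {c d : Field n} → c ≗ d → ∂ x c ≗ ∂ x d
∂-cong []       e []            = refl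
∂-cong (x ∷ xs) e (outside ∷ S) = cong₂ (λ a b → x * a + b) (e (inside ∷ S)) (∂-cong xs (λ T → e (outside ∷ T)) S)
∂-cong (x ∷ xs) e (inside ∷ S)  = ∂-cong xs (λ T → e (inside ∷ T)) S

∂-+ : ∀ {n} (x : Vec ℚ n) (c d : Field n) S → ∂ x (λ T → c T + d T) S ≡ ∂ x c S + ∂ x d S
∂-+ []       c d []            = refl
∂-+ (x ∷ xs) c d (outside ∷ S) = trans (cong (x * (c (inside ∷ S) + d (inside ∷ S)) +_) (∂-+ xs _ _ S))
  (solve 5 (λ x a b u v → x :* (a :+ b) :+ (u :+ v) := x :* a :+ u :+ (x :* b :+ v)) refl x (c (inside ∷ S)) (d (inside ∷ S)) (∂ xs (λ T → c (outside ∷ T)) S) (∂ xs (λ T → d (outside ∷ T)) S))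
∂-+ (x ∷ xs) c d (inside ∷ S)  = ∂-+ xs _ _ S

∂-* : ∀ {n} (x : Vec ℚ n) p (c : Field n) S → ∂ x (λ T → p * c T) S ≡ p * ∂ x c S
∂-* []       p c []            = sym (ℚP.*-zeroʳ p)
∂-* (x ∷ xs) p c (outside ∷ S) = trans (cong (x * (p * c (inside ∷ S)) +_) (∂-* xs p _ S))
  (solve 4 (λ x p a u → x :* (p :* a) :+ p :* u := p :* (x :* a :+ u)) refl x p (c (inside ∷ S)) (∂ xs (λ T → c (outside ∷ T)) S))
∂-* (x ∷ xs) p c (inside ∷ S)  = ∂-* xs p _ S

∂-*+ : ∀ {n} (x : Vec ℚ n) p (c d : Field n) S → ∂ x (λ T → p * c T + d T) S ≡ p * ∂ x c S + ∂ x d S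
∂-*+ x p c d S = trans (∂-+ x (λ T → p * c T) d S) (cong (_+ ∂ x d S) (∂-* x p c S))

∂-linear : ∀ {n} (x : Vec ℚ n) p q (c d : Field n) S →
           ∂ x (λ T → p * c T + q * d T) S ≡ p * ∂ x c S + q * ∂ x d S
∂-linear x p q c d S = trans (∂-*+ x p c (λ T → q * d T) S) (cong (p * ∂ x c S +_) (∂-* x q d S))

∂-comm : ∀ {n} (x y : Vec ℚ n) (c : Field n) S → ∂ x (∂ y c) S ≡ ∂ y (∂ x c) S
∂-comm []       []       c []            = refl
∂-comm (x ∷ xs) (y ∷ ys) c (inside ∷ S)  = ∂-comm xs ys _ S
∂-comm (x ∷ xs) (y ∷ ys) c (outside ∷ S) = begin
  x * ∂ ys c₁ S + ∂ xs (λ T → y * c₁ T + ∂ ys c₀ T) S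
    ≡⟨ cong (x * ∂ ys c₁ S +_) (∂-*+ xs y c₁ (∂ ys c₀) S) ⟩
  x * ∂ ys c₁ S + (y * ∂ xs c₁ S + ∂ xs (∂ ys c₀) S)
    ≡⟨ cong (λ z → x * ∂ ys c₁ S + (y * ∂ xs c₁ S + z)) (∂-comm xs ys c₀ S) ⟩
  x * ∂ ys c₁ S + (y * ∂ xs c₁ S + ∂ ys (∂ xs c₀) S)
    ≡⟨ solve 3 (λ a b z → a :+ (b :+ z) := b :+ (a :+ z)) refl (x * ∂ ys c₁ S) (y * ∂ xs c₁ S) (∂ ys (∂ xs c₀) S) ⟩
  y * ∂ xs c₁ S + (x * ∂ ys c₁ S + ∂ ys (∂ xs c₀) S)
    ≡⟨ cong (y * ∂ xs c₁ S +_) (∂-*+ ys x c₁ (∂ xs c₀) S) ⟨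
  y * ∂ xs c₁ S + ∂ ys (λ T → x * c₁ T + ∂ xs c₀ T) S ∎
  where
  open ≡-Reasoning
  c₀ c₁ : Field _
  c₀ T = c (outside ∷ T)
  c₁ T = c (inside ∷ T)

-- The Hessian of the homogenized polynomial at S has at most one
-- positive eigenvalue; the homogenizing variable has been eliminated by
-- completing the square. The index j is the number of derivatives taken.
Lorentz : ∀ {n} → ℕ → Field n → Set
Lorentz j c = ∀ m S x → ∣ ∁ S ∣ˢ ≡ j ℕ.+ (2 ℕ.+ m) →
  fromℕ (2 ℕ.+ m) * (c S * ∂ x (∂ x c) S) ≤ℚ fromℕ (1 ℕ.+ m) * (∂ x c S * ∂ x c S)

Lorentz-cong : ∀ {n} j {c d : Field n} → c ≗ d → Lorentz j c → Lorentz j d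
Lorentz-cong j c≗d L m S x eq = subst₂ _≤ℚ_
  (cong₂ (λ u v → fromℕ (2 ℕ.+ m) * (u * v)) (c≗d S) (∂-cong x (∂-cong x c≗d) S))
  (cong (λ u → fromℕ (1 ℕ.+ m) * (u * u)) (∂-cong x c≗d S))
  (L m S x eq)

one : ∀ {n} → Field n
one _ = 1ℚ

squares : ∀ {n} → Vec ℚ n → Field n
squares []       []            = 0ℚ
squares (x ∷ xs) (outside ∷ S) = x * x + squares xs S
squares (x ∷ xs) (inside ∷ S)  = squares xs S

-- For the constant field the second derivative is twice the second elementary symmetric polynomial
-- of the coordinates outside `S`, hence the square of their sum minus the sum of their squares.
∂∂-one : ∀ {n} (x : Vec ℚ n) S → ∂ x (∂ x one) S + squares x S ≡ ∂ x one S * ∂ x one S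
∂∂-one []       []            = refl
∂∂-one (x ∷ xs) (inside ∷ S)  = ∂∂-one xs S
∂∂-one (x ∷ xs) (outside ∷ S) = begin
  (x * σ + ∂ xs (λ T → x * 1ℚ + ∂ xs one T) S) + (x * x + squares xs S)
    ≡⟨ cong (λ z → (x * σ + z) + (x * x + squares xs S)) (∂-*+ xs x one (∂ xs one) S) ⟩
  (x * σ + (x * σ + ∂ xs (∂ xs one) S)) + (x * x + squares xs S)
    ≡⟨ solve 4 (λ x a b c → (x :* a :+ (x :* a :+ b)) :+ (x :* x :+ c)
                         := (b :+ c) :+ (x :* a :+ x :* a :+ x :* x)) refl x σ (∂ xs (∂ xs one) S) (squares xs S) ⟩
  (∂ xs (∂ xs one) S + squares xs S) + (x * σ + x * σ + x * x)
    ≡⟨ cong (_+ (x * σ + x * σ + x * x)) (∂∂-one xs S) ⟩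
  σ * σ + (x * σ + x * σ + x * x)
    ≡⟨ solve 2 (λ x a → a :* a :+ (x :* a :+ x :* a :+ x :* x) := (x :* con 1ℚ :+ a) :* (x :* con 1ℚ :+ a)) refl x σ ⟩
  (x * 1ℚ + σ) * (x * 1ℚ + σ) ∎
  where
  open ≡-Reasoning
  σ = ∂ xs one S

-- Summed over the free sites, `(xᵢ - y)² ≥ 0`. It controls the cross term in the inductive step of
-- Cauchy-Schwarz, with `y` the coordinate just added.
∂-one-linear-bound : ∀ {n} y (x : Vec ℚ n) S →
                     (y + y) * ∂ x one S ≤ℚ squares x S + fromℕ ∣ ∁ S ∣ˢ * (y * y)
∂-one-linear-bound y []       []            = ℚP.≤-reflexive
  (solve 1 (λ y → (y :+ y) :* con 0ℚ := con 0ℚ :+ con 0ℚ :* (y :* y)) refl y)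
∂-one-linear-bound y (x ∷ xs) (inside ∷ S)  = ∂-one-linear-bound y xs S
∂-one-linear-bound y (x ∷ xs) (outside ∷ S) = begin
  (y + y) * (x * 1ℚ + ∂ xs one S)
    ≡⟨ solve 3 (λ y x a → (y :+ y) :* (x :* con 1ℚ :+ a) := (y :+ y) :* x :+ (y :+ y) :* a) refl y x (∂ xs one S) ⟩
  (y + y) * x + (y + y) * ∂ xs one S
    ≤⟨ ℚP.+-mono-≤ (≤-by-diff {(y + y) * x} ((x - y) * (x - y)) (square-nonNeg (x - y))
         (solve 2 (λ x y → x :* x :+ y :* y := (y :+ y) :* x :+ (x :- y) :* (x :- y)) refl x y))
       (∂-one-linear-bound y xs S) ⟩
  (x * x + y * y) + (squares xs S + fromℕ ∣ ∁ S ∣ˢ * (y * y))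
    ≡⟨ solve 4 (λ a b c m → (a :+ b) :+ (c :+ m :* b) := (a :+ c) :+ (con 1ℚ :+ m) :* b) refl (x * x) (y * y) (squares xs S) (fromℕ ∣ ∁ S ∣ˢ) ⟩
  (x * x + squares xs S) + (1ℚ + fromℕ ∣ ∁ S ∣ˢ) * (y * y)
    ≡⟨ cong (λ z → (x * x + squares xs S) + z * (y * y)) (fromℕ-suc ∣ ∁ S ∣ˢ) ⟨
  (x * x + squares xs S) + fromℕ (suc ∣ ∁ S ∣ˢ) * (y * y) ∎
  where open ℚP.≤-Reasoning

∂-one-cauchy-schwarz : ∀ {n} (x : Vec ℚ n) S →
                       ∂ x one S * ∂ x one S ≤ℚ fromℕ ∣ ∁ S ∣ˢ * squares x S
∂-one-cauchy-schwarz []       []            = ℚP.≤-refl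
∂-one-cauchy-schwarz (x ∷ xs) (inside ∷ S)  = ∂-one-cauchy-schwarz xs S
∂-one-cauchy-schwarz (x ∷ xs) (outside ∷ S) = begin
  (x * 1ℚ + σ) * (x * 1ℚ + σ)
    ≡⟨ solve 2 (λ x a → (x :* con 1ℚ :+ a) :* (x :* con 1ℚ :+ a) := (x :* x :+ a :* a) :+ (x :+ x) :* a) refl x σ ⟩
  (x * x + σ * σ) + (x + x) * σ
    ≤⟨ ℚP.+-mono-≤ (ℚP.+-monoʳ-≤ (x * x) (∂-one-cauchy-schwarz xs S)) (∂-one-linear-bound x xs S) ⟩
  (x * x + fromℕ ∣ ∁ S ∣ˢ * squares xs S) + (squares xs S + fromℕ ∣ ∁ S ∣ˢ * (x * x))
    ≡⟨ solve 3 (λ a m c → (a :+ m :* c) :+ (c :+ m :* a) := (con 1ℚ :+ m) :* (a :+ c)) refl (x * x) (fromℕ ∣ ∁ S ∣ˢ) (squares xs S) ⟩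
  (1ℚ + fromℕ ∣ ∁ S ∣ˢ) * (x * x + squares xs S)
    ≡⟨ cong (_* (x * x + squares xs S)) (fromℕ-suc ∣ ∁ S ∣ˢ) ⟨
  fromℕ (suc ∣ ∁ S ∣ˢ) * (x * x + squares xs S) ∎
  where
  open ℚP.≤-Reasoning
  σ = ∂ xs one S

-- Here the homogenized polynomial is the product of the linear forms `y + xᵢ`. By `∂∂-one` the
-- claim becomes Cauchy-Schwarz for the `2 + m` free coordinates against the all-ones vector.
one-Lorentz : ∀ {n} → Lorentz {n} 0 one
one-Lorentz m S x eq = ≤-by-diff
  (fromℕ (2 ℕ.+ m) * squares x S - σ * σ)
  (diff-nonNeg (subst (λ k → σ * σ ≤ℚ fromℕ k * squares x S) eq (∂-one-cauchy-schwarz x S)))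
  (begin
    fromℕ (1 ℕ.+ m) * (σ * σ)
      ≡⟨ solve 2 (λ k a → k :* a := (con 1ℚ :+ k) :* a :- a) refl (fromℕ (1 ℕ.+ m)) (σ * σ) ⟩
    (1ℚ + fromℕ (1 ℕ.+ m)) * (σ * σ) - σ * σ
      ≡⟨ cong₂ (λ k a → k * a - σ * σ) (fromℕ-suc (1 ℕ.+ m)) (∂∂-one x S) ⟨
    fromℕ (2 ℕ.+ m) * (∂ x (∂ x one) S + squares x S) - σ * σ
      ≡⟨ solve 4 (λ k a b c → k :* (a :+ b) :- c := k :* (con 1ℚ :* a) :+ (k :* b :- c)) refl
           (fromℕ (2 ℕ.+ m)) (∂ x (∂ x one) S) (squares x S) (σ * σ) ⟩
    fromℕ (2 ℕ.+ m) * (1ℚ * ∂ x (∂ x one) S) + (fromℕ (2 ℕ.+ m) * squares x S - σ * σ) ∎)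
  where
  open ≡-Reasoning
  σ = ∂ x one S

-- Hops preserve the Lorentzian property

headHop : ∀ {n} → ℚ → ℚ → Field (2 ℕ.+ n) → Field (2 ℕ.+ n)
headHop p q c (outside ∷ outside ∷ S) = c (outside ∷ outside ∷ S)
headHop p q c (inside  ∷ inside  ∷ S) = c (inside ∷ inside ∷ S)
headHop p q c (outside ∷ inside  ∷ S) = p * c (outside ∷ inside ∷ S) + q * c (inside ∷ outside ∷ S)
headHop p q c (inside  ∷ outside ∷ S) = p * c (inside ∷ outside ∷ S) + q * c (outside ∷ inside ∷ S)

-- The conditions p + q ≥ 1 and |p - q| ≤ 1, squared.
record Admissible (p q : ℚ) : Set where
  field
    p-pos    : 0ℚ <ℚ p
    q-nonNeg : 0ℚ ≤ℚ q
    sum≥1    : 1ℚ ≤ℚ (p + q) * (p + q)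
    diff≤1   : (p - q) * (p - q) ≤ℚ 1ℚ

module _ {n : ℕ} (x y : ℚ) (z : Vec ℚ n) (c : Field (2 ℕ.+ n)) where

  private
    c₀₀ c₀₁ c₁₀ c₁₁ : Field n
    c₀₀ T = c (outside ∷ outside ∷ T)
    c₀₁ T = c (outside ∷ inside ∷ T)
    c₁₀ T = c (inside ∷ outside ∷ T)
    c₁₁ T = c (inside ∷ inside ∷ T)
    v : Vec ℚ (2 ℕ.+ n)
    v = x ∷ y ∷ z

  ∂∂-outside-outside : ∀ S → ∂ v (∂ v c) (outside ∷ outside ∷ S) ≡
    (x * y + x * y) * c₁₁ S + ((x + x) * ∂ z c₁₀ S + ((y + y) * ∂ z c₀₁ S + ∂ z (∂ z c₀₀) S))
  ∂∂-outside-outside S = begin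
    x * (y * c₁₁ S + ∂ z c₁₀ S) + (y * (x * c₁₁ S + ∂ z c₀₁ S) + ∂ z (λ T → x * c₁₀ T + (y * c₀₁ T + ∂ z c₀₀ T)) S)
      ≡⟨ cong (λ w → x * (y * c₁₁ S + ∂ z c₁₀ S) + (y * (x * c₁₁ S + ∂ z c₀₁ S) + w))
           (trans (∂-*+ z x c₁₀ _ S) (cong (x * ∂ z c₁₀ S +_) (∂-*+ z y c₀₁ (∂ z c₀₀) S))) ⟩
    x * (y * c₁₁ S + ∂ z c₁₀ S) + (y * (x * c₁₁ S + ∂ z c₀₁ S) + (x * ∂ z c₁₀ S + (y * ∂ z c₀₁ S + ∂ z (∂ z c₀₀) S)))
      ≡⟨ solve 6 (λ x y c d e f → x :* (y :* c :+ d) :+ (y :* (x :* c :+ e) :+ (x :* d :+ (y :* e :+ f)))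
           := (x :* y :+ x :* y) :* c :+ ((x :+ x) :* d :+ ((y :+ y) :* e :+ f)))
           refl x y (c₁₁ S) (∂ z c₁₀ S) (∂ z c₀₁ S) (∂ z (∂ z c₀₀) S) ⟩
    (x * y + x * y) * c₁₁ S + ((x + x) * ∂ z c₁₀ S + ((y + y) * ∂ z c₀₁ S + ∂ z (∂ z c₀₀) S)) ∎
    where open ≡-Reasoning

-- The new coordinate enters linearly, since a multiaffine polynomial has no repeated derivative at
-- a single site. This is the shape `A + 2sD` to which `combine` applies.
∂∂-outside : ∀ {n} y (z : Vec ℚ n) (c : Field (suc n)) S → ∂ (y ∷ z) (∂ (y ∷ z) c) (outside ∷ S) ≡
             ∂ z (∂ z (λ T → c (outside ∷ T))) S + (y + y) * ∂ z (λ T → c (inside ∷ T)) S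
∂∂-outside y z c S = trans (cong (y * ∂ z c₁ S +_) (∂-*+ z y c₁ (∂ z c₀) S))
  (solve 3 (λ y d e → y :* d :+ (y :* d :+ e) := e :+ (y :+ y) :* d) refl y (∂ z c₁ S) (∂ z (∂ z c₀) S))
  where
  c₀ c₁ : Field _
  c₀ T = c (outside ∷ T)
  c₁ T = c (inside ∷ T)

module _ {n : ℕ} {p q : ℚ} (adm : Admissible p q) {c : Field (2 ℕ.+ n)}
         (c-pos : ∀ S → 0ℚ <ℚ c S) (L : Lorentz 0 c) where

  open Admissible adm

  private
    c₀₀ c₀₁ c₁₀ c₁₁ : Field n
    c₀₀ T = c (outside ∷ outside ∷ T)
    c₀₁ T = c (outside ∷ inside ∷ T)
    c₁₀ T = c (inside ∷ outside ∷ T)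
    c₁₁ T = c (inside ∷ inside ∷ T)

    hop : Field (2 ℕ.+ n)
    hop = headHop p q c

    -- The map `R` multiplies `x + y` by `p + q` and `x - y` by `p - q`, while `xy` is a quarter of
    -- the difference of their squares. The two squared conditions in `Admissible` therefore make
    -- `x′y′ - xy` positive semidefinite.
    reflect : ∀ x y → x * y ≤ℚ (p * x + q * y) * (q * x + p * y)
    reflect x y = ≤-by-diff {x * y}
      (½ * ½ * (((p + q) * (p + q) - 1ℚ) * ((x + y) * (x + y)) + (1ℚ - (p - q) * (p - q)) * ((x - y) * (x - y))))
      (*-nonNeg (ℚP.nonNegative⁻¹ (½ * ½)) (+-nonNeg
        (*-nonNeg (diff-nonNeg sum≥1) (square-nonNeg (x + y)))
        (*-nonNeg (diff-nonNeg diff≤1) (square-nonNeg (x - y)))))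
      (solve 4 (λ p q x y → (p :* x :+ q :* y) :* (q :* x :+ p :* y) := x :* y :+
        con ½ :* con ½ :* (((p :+ q) :* (p :+ q) :- con 1ℚ) :* ((x :+ y) :* (x :+ y))
                           :+ (con 1ℚ :- (p :- q) :* (p :- q)) :* ((x :- y) :* (x :- y)))) refl p q x y)

    -- When exactly one site of the edge is occupied, the hop mixes the fields `d` and `e` of the
    -- two placements. Filling the remaining free site leads from either of them to the same field
    -- `f`, so the two forms share their row in that direction; this common row is what `combine`
    -- requires.
    occupied : ∀ {μ ν} y (z : Vec ℚ n) S (d e f : Field n) →
      0ℚ <ℚ d S → 0ℚ <ℚ e S → 0ℚ <ℚ f S →
      (∀ s → μ * (d S * (∂ z (∂ z d) S + (s + s) * ∂ z f S)) ≤ℚ ν * ((∂ z d S + s * f S) * (∂ z d S + s * f S))) →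
      (∀ s → μ * (e S * (∂ z (∂ z e) S + (s + s) * ∂ z f S)) ≤ℚ ν * ((∂ z e S + s * f S) * (∂ z e S + s * f S))) →
      let h = λ T → p * d T + q * e T in
      μ * (h S * (∂ z (∂ z h) S + (y + y) * ∂ z f S)) ≤ℚ ν * ((∂ z h S + y * f S) * (∂ z h S + y * f S))
    occupied {μ} {ν} y z S d e f 0<d 0<e 0<f hd he = subst₂ _≤ℚ_
      (cong (λ w → μ * ((p * d S + q * e S) * (w + (y + y) * ∂ z f S)))
        (sym (trans (∂-cong z (∂-linear z p q d e) S) (∂-linear z p q (∂ z d) (∂ z e) S))))
      (cong (λ w → ν * ((w + y * f S) * (w + y * f S))) (sym (∂-linear z p q d e S)))
      (combine {μ} {ν} {A = ∂ z (∂ z d) S} {∂ z (∂ z e) S} {∂ z f S} {∂ z d S} {∂ z e S}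
        0<d 0<e 0<f p-pos q-nonNeg hd he y)

    at₁₀ : ∀ {m} (z : Vec ℚ n) S → suc ∣ ∁ S ∣ˢ ≡ 2 ℕ.+ m → ∀ s →
      fromℕ (2 ℕ.+ m) * (c₁₀ S * (∂ z (∂ z c₁₀) S + (s + s) * ∂ z c₁₁ S))
      ≤ℚ fromℕ (1 ℕ.+ m) * ((∂ z c₁₀ S + s * c₁₁ S) * (∂ z c₁₀ S + s * c₁₁ S))
    at₁₀ {m} z S eq s = subst₂ _≤ℚ_
      (cong (λ w → fromℕ (2 ℕ.+ m) * (c₁₀ S * w)) (∂∂-outside s z (λ T → c (inside ∷ T)) S))
      (cong (λ w → fromℕ (1 ℕ.+ m) * (w * w)) (ℚP.+-comm (s * c₁₁ S) (∂ z c₁₀ S)))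
      -- The coordinate of an occupied site is never read by `∂`, so 0 is as good as any value.
      (L m (inside ∷ outside ∷ S) (0ℚ ∷ s ∷ z) eq)

    at₀₁ : ∀ {m} (z : Vec ℚ n) S → suc ∣ ∁ S ∣ˢ ≡ 2 ℕ.+ m → ∀ s →
      fromℕ (2 ℕ.+ m) * (c₀₁ S * (∂ z (∂ z c₀₁) S + (s + s) * ∂ z c₁₁ S))
      ≤ℚ fromℕ (1 ℕ.+ m) * ((∂ z c₀₁ S + s * c₁₁ S) * (∂ z c₀₁ S + s * c₁₁ S))
    at₀₁ {m} z S eq s = subst₂ _≤ℚ_
      (cong (λ w → fromℕ (2 ℕ.+ m) * (c₀₁ S * w)) (∂∂-outside s z (λ { (b ∷ T) → c (b ∷ inside ∷ T) }) S))
      (cong (λ w → fromℕ (1 ℕ.+ m) * (w * w)) (ℚP.+-comm (s * c₁₁ S) (∂ z c₀₁ S)))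
      (L m (outside ∷ inside ∷ S) (s ∷ 0ℚ ∷ z) eq)

  headHop-Lorentz : Lorentz 0 hop
  headHop-Lorentz m (inside ∷ inside ∷ S) v@(_ ∷ _ ∷ _) eq = L m (inside ∷ inside ∷ S) v eq
  headHop-Lorentz m (inside ∷ outside ∷ S) (x ∷ y ∷ z) eq = subst₂ _≤ℚ_
    (cong (λ w → fromℕ (2 ℕ.+ m) * (hop (inside ∷ outside ∷ S) * w)) (sym (∂∂-outside y z (λ T → hop (inside ∷ T)) S)))
    (cong (λ w → fromℕ (1 ℕ.+ m) * (w * w)) (ℚP.+-comm (∂ z (λ T → hop (inside ∷ outside ∷ T)) S) (y * c₁₁ S)))
    (occupied {fromℕ (2 ℕ.+ m)} {fromℕ (1 ℕ.+ m)} y z S c₁₀ c₀₁ c₁₁ (c-pos _) (c-pos _) (c-pos _) (at₁₀ z S eq) (at₀₁ z S eq))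
  headHop-Lorentz m (outside ∷ inside ∷ S) (x ∷ y ∷ z) eq = subst₂ _≤ℚ_
    (cong (λ w → fromℕ (2 ℕ.+ m) * (hop (outside ∷ inside ∷ S) * w))
      (sym (∂∂-outside x z (λ { (b ∷ T) → hop (b ∷ inside ∷ T) }) S)))
    (cong (λ w → fromℕ (1 ℕ.+ m) * (w * w)) (ℚP.+-comm (∂ z (λ T → hop (outside ∷ inside ∷ T)) S) (x * c₁₁ S)))
    (occupied {fromℕ (2 ℕ.+ m)} {fromℕ (1 ℕ.+ m)} x z S c₀₁ c₁₀ c₁₁ (c-pos _) (c-pos _) (c-pos _) (at₀₁ z S eq) (at₁₀ z S eq))
  -- With both sites free the value at the set is unchanged, and the first derivative along `(x, y)`
  -- is the old one along `(x′, y′)`. The second derivative differs from the old one by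
  -- `2(x′y′ - xy)` times the value `c₁₁`; it can only be smaller, and it stands on the smaller
  -- side.
  headHop-Lorentz m (outside ∷ outside ∷ S) (x ∷ y ∷ z) eq = begin
    fromℕ (2 ℕ.+ m) * (c₀₀ S * ∂ (x ∷ y ∷ z) (∂ (x ∷ y ∷ z) hop) (outside ∷ outside ∷ S))
      ≤⟨ *-monoˡ (fromℕ-nonNeg (2 ℕ.+ m)) (*-monoˡ (ℚP.<⇒≤ (c-pos (outside ∷ outside ∷ S))) second) ⟩
    fromℕ (2 ℕ.+ m) * (c₀₀ S * ∂ (x′ ∷ y′ ∷ z) (∂ (x′ ∷ y′ ∷ z) c) (outside ∷ outside ∷ S))
      ≤⟨ L m (outside ∷ outside ∷ S) (x′ ∷ y′ ∷ z) eq ⟩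
    fromℕ (1 ℕ.+ m) * (∂ (x′ ∷ y′ ∷ z) c (outside ∷ outside ∷ S) * ∂ (x′ ∷ y′ ∷ z) c (outside ∷ outside ∷ S))
      ≡⟨ cong (λ w → fromℕ (1 ℕ.+ m) * (w * w)) first ⟨
    fromℕ (1 ℕ.+ m) * (∂ (x ∷ y ∷ z) hop (outside ∷ outside ∷ S) * ∂ (x ∷ y ∷ z) hop (outside ∷ outside ∷ S)) ∎
    where
    open ℚP.≤-Reasoning
    x′ = p * x + q * y
    y′ = q * x + p * y
    first : ∂ (x ∷ y ∷ z) hop (outside ∷ outside ∷ S) ≡ ∂ (x′ ∷ y′ ∷ z) c (outside ∷ outside ∷ S)
    first = solve 7 (λ p q x y a b f → x :* (p :* a :+ q :* b) :+ (y :* (p :* b :+ q :* a) :+ f)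
        := (p :* x :+ q :* y) :* a :+ ((q :* x :+ p :* y) :* b :+ f))
      refl p q x y (c₁₀ S) (c₀₁ S) (∂ z c₀₀ S)
    K : ℚ
    K = ((x + x) * (p * ∂ z c₁₀ S + q * ∂ z c₀₁ S) + ((y + y) * (p * ∂ z c₀₁ S + q * ∂ z c₁₀ S) + ∂ z (∂ z c₀₀) S))
    second : ∂ (x ∷ y ∷ z) (∂ (x ∷ y ∷ z) hop) (outside ∷ outside ∷ S)
             ≤ℚ ∂ (x′ ∷ y′ ∷ z) (∂ (x′ ∷ y′ ∷ z) c) (outside ∷ outside ∷ S)
    second = begin
      ∂ (x ∷ y ∷ z) (∂ (x ∷ y ∷ z) hop) (outside ∷ outside ∷ S)
        ≡⟨ ∂∂-outside-outside x y z hop S ⟩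
      (x * y + x * y) * c₁₁ S + ((x + x) * ∂ z (λ T → p * c₁₀ T + q * c₀₁ T) S
        + ((y + y) * ∂ z (λ T → p * c₀₁ T + q * c₁₀ T) S + ∂ z (∂ z c₀₀) S))
        ≡⟨ cong₂ (λ u v → (x * y + x * y) * c₁₁ S + ((x + x) * u + ((y + y) * v + ∂ z (∂ z c₀₀) S)))
             (∂-linear z p q c₁₀ c₀₁ S) (∂-linear z p q c₀₁ c₁₀ S) ⟩
      (x * y + x * y) * c₁₁ S + K
        ≤⟨ ℚP.+-monoˡ-≤ K (*-monoʳ (ℚP.<⇒≤ (c-pos (inside ∷ inside ∷ S))) (ℚP.+-mono-≤ (reflect x y) (reflect x y))) ⟩
      (x′ * y′ + x′ * y′) * c₁₁ S + K
        ≡⟨ cong ((x′ * y′ + x′ * y′) * c₁₁ S +_)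
             (solve 7 (λ p q x y a b f → (x :+ x) :* (p :* a :+ q :* b) :+ ((y :+ y) :* (p :* b :+ q :* a) :+ f)
               := ((p :* x :+ q :* y) :+ (p :* x :+ q :* y)) :* a :+ (((q :* x :+ p :* y) :+ (q :* x :+ p :* y)) :* b :+ f))
             refl p q x y (∂ z c₁₀ S) (∂ z c₀₁ S) (∂ z (∂ z c₀₀) S)) ⟩
      (x′ * y′ + x′ * y′) * c₁₁ S + ((x′ + x′) * ∂ z c₁₀ S + ((y′ + y′) * ∂ z c₀₁ S + ∂ z (∂ z c₀₀) S))
        ≡⟨ ∂∂-outside-outside x′ y′ z c S ⟨
      ∂ (x′ ∷ y′ ∷ z) (∂ (x′ ∷ y′ ∷ z) c) (outside ∷ outside ∷ S) ∎

-- Hops on an arbitrary edge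

infixl 5 _⊕_

_⊕_ : ∀ {n} → Subset n → Subset n → Subset n
_⊕_ = Vec.zipWith _xor_

hop : ∀ {n} → ℚ → ℚ → Subset n → Field n → Field n
hop p q e c S = if ∣ S ∩ e ∣ˢ ≡ᵇ 1 then p * c S + q * c (S ⊕ e) else c S

hop-pos : ∀ {n p q} → Admissible p q → ∀ (e : Subset n) {c} → (∀ S → 0ℚ <ℚ c S) → ∀ S → 0ℚ <ℚ hop p q e c S
hop-pos adm e c-pos S with ∣ S ∩ e ∣ˢ ≡ᵇ 1
... | true  = +-pos-nonNeg (*-pos p-pos (c-pos S)) (*-nonNeg q-nonNeg (ℚP.<⇒≤ (c-pos (S ⊕ e))))
  where open Admissible adm
... | false = c-pos S

∩-⊥-size : ∀ {n} (S : Subset n) → ∣ S ∩ ⊥ ∣ˢ ≡ 0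
∩-⊥-size []            = refl
∩-⊥-size (inside ∷ S)  = ∩-⊥-size S
∩-⊥-size (outside ∷ S) = ∩-⊥-size S

⊕-⊥ : ∀ {n} (S : Subset n) → S ⊕ ⊥ ≡ S
⊕-⊥ []            = refl
⊕-⊥ (inside ∷ S)  = cong (inside ∷_) (⊕-⊥ S)
⊕-⊥ (outside ∷ S) = cong (outside ∷_) (⊕-⊥ S)

size0⇒⊥ : ∀ {n} (S : Subset n) → ∣ S ∣ˢ ≡ 0 → S ≡ ⊥
size0⇒⊥ []            _  = refl
size0⇒⊥ (outside ∷ S) eq = cong (outside ∷_) (size0⇒⊥ S eq)

headHop≗hop : ∀ {n} p q (c : Field (2 ℕ.+ n)) → headHop p q c ≗ hop p q (inside ∷ inside ∷ ⊥) c
headHop≗hop p q c (outside ∷ outside ∷ S) rewrite ∩-⊥-size S = refl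
headHop≗hop p q c (outside ∷ inside ∷ S)  rewrite ∩-⊥-size S | ⊕-⊥ S = refl
headHop≗hop p q c (inside ∷ outside ∷ S)  rewrite ∩-⊥-size S | ⊕-⊥ S = refl
headHop≗hop p q c (inside ∷ inside ∷ S)   = refl

-- Adjacent transpositions suffice to bring any edge to the first two sites, and they act on vectors
-- by plain structural recursion.
data AdjacentSwap : ℕ → Set where
  here  : ∀ {n} → AdjacentSwap (2 ℕ.+ n)
  there : ∀ {n} → AdjacentSwap n → AdjacentSwap (suc n)

swap : ∀ {A : Set} {n} → AdjacentSwap n → Vec A n → Vec A n
swap here      (x ∷ y ∷ xs) = y ∷ x ∷ xs
swap (there σ) (x ∷ xs)     = x ∷ swap σ xs

swap-involutive : ∀ {A : Set} {n} (σ : AdjacentSwap n) (xs : Vec A n) → swap σ (swap σ xs) ≡ xs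
swap-involutive here      (x ∷ y ∷ xs) = refl
swap-involutive (there σ) (x ∷ xs)     = cong (x ∷_) (swap-involutive σ xs)

swap-zipWith : ∀ {A B C : Set} {n} (f : A → B → C) (σ : AdjacentSwap n) xs ys →
               swap σ (Vec.zipWith f xs ys) ≡ Vec.zipWith f (swap σ xs) (swap σ ys)
swap-zipWith f here      (_ ∷ _ ∷ _) (_ ∷ _ ∷ _) = refl
swap-zipWith f (there σ) (x ∷ xs)    (y ∷ ys)    = cong (f x y ∷_) (swap-zipWith f σ xs ys)

swap-∁ : ∀ {n} (σ : AdjacentSwap n) S → swap σ (∁ S) ≡ ∁ (swap σ S)
swap-∁ here      (_ ∷ _ ∷ _) = refl
swap-∁ (there σ) (_ ∷ S)     = cong (_ ∷_) (swap-∁ σ S)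

swap-size : ∀ {n} (σ : AdjacentSwap n) S → ∣ swap σ S ∣ˢ ≡ ∣ S ∣ˢ
swap-size here      (inside  ∷ inside  ∷ S) = refl
swap-size here      (inside  ∷ outside ∷ S) = refl
swap-size here      (outside ∷ inside  ∷ S) = refl
swap-size here      (outside ∷ outside ∷ S) = refl
swap-size (there σ) (inside  ∷ S)           = cong suc (swap-size σ S)
swap-size (there σ) (outside ∷ S)           = swap-size σ S

∂-swap : ∀ {n} (σ : AdjacentSwap n) x (c : Field n) S → ∂ x (λ T → c (swap σ T)) S ≡ ∂ (swap σ x) c (swap σ S)
∂-swap here      (x ∷ y ∷ z) c (inside  ∷ inside  ∷ S) = refl
∂-swap here      (x ∷ y ∷ z) c (inside  ∷ outside ∷ S) = refl
∂-swap here      (x ∷ y ∷ z) c (outside ∷ inside  ∷ S) = refl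
∂-swap here      (x ∷ y ∷ z) c (outside ∷ outside ∷ S) =
  solve 3 (λ a b d → a :+ (b :+ d) := b :+ (a :+ d)) refl
    (x * c (outside ∷ inside ∷ S)) (y * c (inside ∷ outside ∷ S)) (∂ z (λ T → c (outside ∷ outside ∷ T)) S)
∂-swap (there σ) (x ∷ z)     c (inside  ∷ S)           = ∂-swap σ z (λ T → c (inside ∷ T)) S
∂-swap (there σ) (x ∷ z)     c (outside ∷ S)           =
  cong (x * c (inside ∷ swap σ S) +_) (∂-swap σ z (λ T → c (outside ∷ T)) S)

swap-Lorentz : ∀ {n} j (σ : AdjacentSwap n) {c} → Lorentz j c → Lorentz j (λ S → c (swap σ S))
swap-Lorentz j σ {c} L m S x eq = subst₂ _≤ℚ_
  (cong (λ w → fromℕ (2 ℕ.+ m) * (c (swap σ S) * w))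
    (sym (trans (∂-cong x (∂-swap σ x c) S) (∂-swap σ x (∂ (swap σ x) c) S))))
  (cong (λ w → fromℕ (1 ℕ.+ m) * (w * w)) (sym (∂-swap σ x c S)))
  (L m (swap σ S) (swap σ x)
    (trans (trans (cong ∣_∣ˢ (sym (swap-∁ σ S))) (swap-size σ (∁ S))) eq))

hop-swap : ∀ {n} p q (σ : AdjacentSwap n) e c S →
           hop p q (swap σ e) (λ T → c (swap σ T)) (swap σ S) ≡ hop p q e c S
hop-swap p q σ e c S
  rewrite sym (swap-zipWith _∧_ σ S e) | swap-size σ (S ∩ e) | sym (swap-zipWith _xor_ σ S e)
        | swap-involutive σ S | swap-involutive σ (S ⊕ e) = refl

singleton-induction : ∀ {n} (P : Subset (suc n) → Set) → (∀ σ e → P (swap σ e) → P e) →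
                      P (inside ∷ ⊥) → ∀ e → ∣ e ∣ˢ ≡ 1 → P e
singleton-induction         P step base (inside ∷ e)  eq =
  subst (λ e → P (inside ∷ e)) (sym (size0⇒⊥ e (ℕP.suc-injective eq))) base
singleton-induction {zero}  P step base (outside ∷ []) ()
singleton-induction {suc n} P step base (outside ∷ e) eq =
  singleton-induction (λ e → P (outside ∷ e)) (λ σ e → step (there σ) (outside ∷ e))
    (step here (outside ∷ inside ∷ ⊥) base) e eq

-- If the first site is missing from `e`, the argument recurses on the tail. The base case there has
-- its pair in positions 1 and 2, and two adjacent swaps carry it to positions 0 and 1.
pair-induction : ∀ {n} (P : Subset (2 ℕ.+ n) → Set) → (∀ σ e → P (swap σ e) → P e) →
                 P (inside ∷ inside ∷ ⊥) → ∀ e → ∣ e ∣ˢ ≡ 2 → P e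
pair-induction         P step base (inside ∷ e)  eq =
  singleton-induction (λ e → P (inside ∷ e)) (λ σ e → step (there σ) (inside ∷ e)) base e (ℕP.suc-injective eq)
pair-induction {zero}  P step base (outside ∷ inside ∷ [])  ()
pair-induction {zero}  P step base (outside ∷ outside ∷ []) ()
pair-induction {suc n} P step base (outside ∷ e) eq =
  pair-induction (λ e → P (outside ∷ e)) (λ σ e → step (there σ) (outside ∷ e))
    (step here (outside ∷ inside ∷ inside ∷ ⊥) (step (there here) (inside ∷ outside ∷ inside ∷ ⊥) base)) e eq

hop-Lorentz : ∀ {n p q} → Admissible p q → ∀ (e : Subset n) → ∣ e ∣ˢ ≡ 2 →
              ∀ {c} → (∀ S → 0ℚ <ℚ c S) → Lorentz 0 c → Lorentz 0 (hop p q e c)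
hop-Lorentz {zero}        adm []             ()
hop-Lorentz {suc zero}    adm (inside ∷ [])  ()
hop-Lorentz {suc zero}    adm (outside ∷ []) ()
hop-Lorentz {suc (suc n)} {p} {q} adm = pair-induction
  (λ e → ∀ {c} → (∀ S → 0ℚ <ℚ c S) → Lorentz 0 c → Lorentz 0 (hop p q e c))
  (λ σ e ih {c} c-pos L → Lorentz-cong 0 (hop-swap p q σ e c)
    (swap-Lorentz 0 σ (ih (λ S → c-pos (swap σ S)) (swap-Lorentz 0 σ L))))
  (λ {c} c-pos L → Lorentz-cong 0 (headHop≗hop p q c) (headHop-Lorentz adm c-pos L))

-- Directional derivatives and Newton's inequalities

addMultiple : ∀ {n} → Vec ℚ n → ℚ → Vec ℚ n → Vec ℚ n
addMultiple x s y = Vec.zipWith (λ a b → a + s * b) x y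

∂-addMultiple : ∀ {n} (x : Vec ℚ n) s y (c : Field n) S → ∂ (addMultiple x s y) c S ≡ ∂ x c S + s * ∂ y c S
∂-addMultiple []       s []       c []            = solve 1 (λ s → con 0ℚ := con 0ℚ :+ s :* con 0ℚ) refl s
∂-addMultiple (x ∷ xs) s (y ∷ ys) c (inside ∷ S)  = ∂-addMultiple xs s ys _ S
∂-addMultiple (x ∷ xs) s (y ∷ ys) c (outside ∷ S) = trans
  (cong ((x + s * y) * c (inside ∷ S) +_) (∂-addMultiple xs s ys (λ T → c (outside ∷ T)) S))
  (solve 6 (λ x s y a u v → (x :+ s :* y) :* a :+ (u :+ s :* v) := x :* a :+ u :+ s :* (y :* a :+ v)) refl
    x s y (c (inside ∷ S)) (∂ xs (λ T → c (outside ∷ T)) S) (∂ ys (λ T → c (outside ∷ T)) S))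

∂∂-addMultiple : ∀ {n} (x : Vec ℚ n) s y (c : Field n) S →
                 ∂ (addMultiple x s y) (∂ (addMultiple x s y) c) S ≡
                 (∂ x (∂ x c) S + (s + s) * ∂ x (∂ y c) S) + s * s * ∂ y (∂ y c) S
∂∂-addMultiple x s y c S = begin
  ∂ z (∂ z c) S
    ≡⟨ ∂-cong z (∂-addMultiple x s y c) S ⟩
  ∂ z (λ T → ∂ x c T + s * ∂ y c T) S
    ≡⟨ ∂-addMultiple x s y (λ T → ∂ x c T + s * ∂ y c T) S ⟩
  ∂ x (λ T → ∂ x c T + s * ∂ y c T) S + s * ∂ y (λ T → ∂ x c T + s * ∂ y c T) S
    ≡⟨ cong₂ (λ a b → a + s * b) (expand x) (expand y) ⟩
  (∂ x (∂ x c) S + s * ∂ x (∂ y c) S) + s * (∂ y (∂ x c) S + s * ∂ y (∂ y c) S)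
    ≡⟨ cong (λ w → (∂ x (∂ x c) S + s * ∂ x (∂ y c) S) + s * (w + s * ∂ y (∂ y c) S)) (∂-comm y x c S) ⟩
  (∂ x (∂ x c) S + s * ∂ x (∂ y c) S) + s * (∂ x (∂ y c) S + s * ∂ y (∂ y c) S)
    ≡⟨ solve 4 (λ s a b d → (a :+ s :* b) :+ s :* (b :+ s :* d) := (a :+ (s :+ s) :* b) :+ s :* s :* d) refl
         s (∂ x (∂ x c) S) (∂ x (∂ y c) S) (∂ y (∂ y c) S) ⟩
  (∂ x (∂ x c) S + (s + s) * ∂ x (∂ y c) S) + s * s * ∂ y (∂ y c) S ∎
  where
  open ≡-Reasoning
  z = addMultiple x s y
  expand : ∀ w → ∂ w (λ T → ∂ x c T + s * ∂ y c T) S ≡ ∂ w (∂ x c) S + s * ∂ w (∂ y c) S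
  expand w = trans (∂-+ w (∂ x c) (λ T → s * ∂ y c T) S) (cong (∂ w (∂ x c) S +_) (∂-* w s (∂ y c) S))

indicator : ∀ {n} → Subset n → Vec ℚ n
indicator = Vec.map (λ b → if b then 1ℚ else 0ℚ)

∂-nonNeg : ∀ {n} W {c : Field n} → (∀ S → 0ℚ ≤ℚ c S) → ∀ S → 0ℚ ≤ℚ ∂ (indicator W) c S
∂-nonNeg []            0≤c []            = ℚP.≤-refl
∂-nonNeg (_ ∷ W)       0≤c (inside ∷ S)  = ∂-nonNeg W (λ T → 0≤c (inside ∷ T)) S
∂-nonNeg (inside ∷ W)  0≤c (outside ∷ S) = +-nonNeg (*-nonNeg (ℚP.nonNegative⁻¹ 1ℚ) (0≤c _)) (∂-nonNeg W (λ T → 0≤c (outside ∷ T)) S)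
∂-nonNeg (outside ∷ W) 0≤c (outside ∷ S) = +-nonNeg (*-nonNeg (ℚP.≤-refl {0ℚ}) (0≤c _)) (∂-nonNeg W (λ T → 0≤c (outside ∷ T)) S)

∂-pos : ∀ {n} W S (l : Fin n) {c : Field n} → (∀ T → 0ℚ ≤ℚ c T) → Vec.lookup W l ≡ inside → Vec.lookup S l ≡ outside →
        0ℚ <ℚ c (S Vec.[ l ]≔ inside) → 0ℚ <ℚ ∂ (indicator W) c S
∂-pos (_ ∷ W)       (inside ∷ S)  (suc l) 0≤c l∈W l∉S 0<c = ∂-pos W S l (λ T → 0≤c (inside ∷ T)) l∈W l∉S 0<c
∂-pos (inside ∷ W)  (outside ∷ S) zero    0≤c l∈W l∉S 0<c =
  +-pos-nonNeg (*-pos (ℚP.positive⁻¹ 1ℚ) 0<c) (∂-nonNeg W (λ T → 0≤c (outside ∷ T)) S)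
∂-pos (b ∷ W)       (outside ∷ S) (suc l) 0≤c l∈W l∉S 0<c = ℚP.+-mono-≤-<
  (first b) (∂-pos W S l (λ T → 0≤c (outside ∷ T)) l∈W l∉S 0<c)
  where
  first : ∀ b → 0ℚ ≤ℚ (if b then 1ℚ else 0ℚ) * _
  first true  = *-nonNeg (ℚP.nonNegative⁻¹ 1ℚ) (0≤c (inside ∷ S))
  first false = *-nonNeg (ℚP.≤-refl {0ℚ}) (0≤c (inside ∷ S))

∂-⊥ : ∀ {n} (c : Field n) S → ∂ (indicator ⊥) c S ≡ 0ℚ
∂-⊥ c []            = refl
∂-⊥ c (inside ∷ S)  = ∂-⊥ _ S
∂-⊥ c (outside ∷ S) = trans (cong (0ℚ * c (inside ∷ S) +_) (∂-⊥ (λ T → c (outside ∷ T)) S))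
  (solve 1 (λ a → con 0ℚ :* a :+ con 0ℚ := con 0ℚ) refl (c (inside ∷ S)))

∂-∈ : ∀ {n} i (c : Field n) S → Vec.lookup S i ≡ inside → ∂ (indicator ⁅ i ⁆) c S ≡ 0ℚ
∂-∈ zero    c (inside ∷ S)  i∈S = ∂-⊥ _ S
∂-∈ (suc i) c (inside ∷ S)  i∈S = ∂-∈ i _ S i∈S
∂-∈ (suc i) c (outside ∷ S) i∈S = trans (cong (0ℚ * c (inside ∷ S) +_) (∂-∈ i (λ T → c (outside ∷ T)) S i∈S))
  (solve 1 (λ a → con 0ℚ :* a :+ con 0ℚ := con 0ℚ) refl (c (inside ∷ S)))

∂-∉ : ∀ {n} i (c : Field n) S → Vec.lookup S i ≡ outside → ∂ (indicator ⁅ i ⁆) c S ≡ c (S Vec.[ i ]≔ inside)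
∂-∉ zero    c (outside ∷ S) i∉S = trans (cong (1ℚ * c (inside ∷ S) +_) (∂-⊥ (λ T → c (outside ∷ T)) S))
  (solve 1 (λ a → con 1ℚ :* a :+ con 0ℚ := a) refl (c (inside ∷ S)))
∂-∉ (suc i) c (inside ∷ S)  i∉S = ∂-∉ i _ S i∉S
∂-∉ (suc i) c (outside ∷ S) i∉S = trans (cong (0ℚ * c (inside ∷ S) +_) (∂-∉ i (λ T → c (outside ∷ T)) S i∉S))
  (solve 2 (λ a b → con 0ℚ :* a :+ b := b) refl (c (inside ∷ S)) (c (outside ∷ S Vec.[ i ]≔ inside)))

∂-insert : ∀ {n} W i (c : Field n) S → Vec.lookup W i ≡ outside →
           ∂ (indicator (W Vec.[ i ]≔ inside)) c S ≡ ∂ (indicator W) c S + ∂ (indicator ⁅ i ⁆) c S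
∂-insert (outside ∷ W) zero c (inside ∷ S) i∉W = sym (trans
  (cong (∂ (indicator W) (λ T → c (inside ∷ T)) S +_) (∂-⊥ (λ T → c (inside ∷ T)) S)) (ℚP.+-identityʳ _))
∂-insert (outside ∷ W) zero c (outside ∷ S) i∉W = sym (trans
  (cong (λ w → 0ℚ * a + u + (1ℚ * a + w)) (∂-⊥ (λ T → c (outside ∷ T)) S))
  (solve 2 (λ a u → con 0ℚ :* a :+ u :+ (con 1ℚ :* a :+ con 0ℚ) := con 1ℚ :* a :+ u) refl a u))
  where
  a = c (inside ∷ S)
  u = ∂ (indicator W) (λ T → c (outside ∷ T)) S
∂-insert (b ∷ W) (suc i) c (inside ∷ S)  i∉W = ∂-insert W i _ S i∉W
∂-insert (b ∷ W) (suc i) c (outside ∷ S) i∉W = trans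
  (cong (w * a +_) (∂-insert W i (λ T → c (outside ∷ T)) S i∉W))
  (solve 4 (λ w a u v → w :* a :+ (u :+ v) := w :* a :+ u :+ (con 0ℚ :* a :+ v)) refl
    w a (∂ (indicator W) (λ T → c (outside ∷ T)) S) (∂ (indicator ⁅ i ⁆) (λ T → c (outside ∷ T)) S))
  where
  a = c (inside ∷ S)
  w = if b then 1ℚ else 0ℚ

∁-insert : ∀ {n} (S : Subset n) i → Vec.lookup S i ≡ outside → ∣ ∁ S ∣ˢ ≡ suc ∣ ∁ (S Vec.[ i ]≔ inside) ∣ˢ
∁-insert (outside ∷ S) zero    _   = refl
∁-insert (inside ∷ S)  (suc i) i∉S = ∁-insert S i i∉S
∁-insert (outside ∷ S) (suc i) i∉S = cong suc (∁-insert S i i∉S)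

∁-nonempty : ∀ {n} (S : Subset n) {k} → ∣ ∁ S ∣ˢ ≡ suc k → ∃ λ l → Vec.lookup S l ≡ outside
∁-nonempty (outside ∷ S) eq = zero , refl
∁-nonempty (inside ∷ S)  eq = let l , l∉S = ∁-nonempty S eq in suc l , l∉S

∁-⊥ : ∀ n → ∣ ∁ (⊥ {n}) ∣ˢ ≡ n
∁-⊥ zero    = refl
∁-⊥ (suc n) = cong suc (∁-⊥ n)

insert-induction : ∀ {n} (P : Subset n → Set) → P ⊥ →
                   (∀ W i → Vec.lookup W i ≡ outside → P W → P (W Vec.[ i ]≔ inside)) → ∀ W → P W
insert-induction P base step []      = base
insert-induction P base step (b ∷ W) = add b
  where
  without : P (outside ∷ W)
  without = insert-induction (λ W → P (outside ∷ W)) base (λ W i → step (outside ∷ W) (suc i)) W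
  add : ∀ b → P (b ∷ W)
  add outside = without
  add inside  = step (outside ∷ W) zero refl without

-- Each derivative uses up a free site, so after `j` of them the field vanishes at every set with
-- fewer than `j` free sites; positivity can be asked only of the other sets.
record PositiveField {n} (j : ℕ) (c : Field n) : Set where
  field
    nonNeg : ∀ S → 0ℚ ≤ℚ c S
    pos    : ∀ S {k} → ∣ ∁ S ∣ˢ ≡ j ℕ.+ k → 0ℚ <ℚ c S

module _ {n j : ℕ} {c : Field n} (c-pos : PositiveField j c) (L : Lorentz j c) where

  open PositiveField c-pos

  private
    module At (m : ℕ) (S : Subset n) (eq : ∣ ∁ S ∣ˢ ≡ suc j ℕ.+ (2 ℕ.+ m)) where

      μ ν : ℚ
      μ = fromℕ (2 ℕ.+ m)
      ν = fromℕ (1 ℕ.+ m)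

      Derived : Vec ℚ n → Set
      Derived u = ∀ x → μ * (∂ u c S * ∂ x (∂ x (∂ u c)) S) ≤ℚ ν * (∂ x (∂ u c) S * ∂ x (∂ u c) S)

      ∂∂∂-comm : ∀ x u → ∂ x (∂ x (∂ u c)) S ≡ ∂ u (∂ x (∂ x c)) S
      ∂∂∂-comm x u = trans (∂-cong x (∂-comm x u c) S) (∂-comm x u (∂ x c) S)

      -- Tested at `x + s v`, the hypothesis on `u` has linear coefficients that involve only
      -- `∂ v (∂ u c)`. The same expression arises with `u` and `v` exchanged, since derivatives
      -- commute: this is the common row of the two Hessians. The term in `s²` is nonnegative and
      -- stands on the smaller side, so it may be dropped.
      Derived-shift : ∀ U V → Derived (indicator U) → ∀ x s → let u = indicator U; v = indicator V in
        μ * (∂ u c S * (∂ x (∂ x (∂ u c)) S + (s + s) * ∂ x (∂ v (∂ u c)) S))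
        ≤ℚ ν * ((∂ x (∂ u c) S + s * ∂ v (∂ u c) S) * (∂ x (∂ u c) S + s * ∂ v (∂ u c) S))
      Derived-shift U V h x s = begin
        μ * (∂ u c S * A)
          ≤⟨ *-monoˡ (fromℕ-nonNeg (2 ℕ.+ m)) (*-monoˡ (∂-nonNeg U nonNeg S)
               (≤-by-diff {A} (s * s * ∂ v (∂ v (∂ u c)) S)
                 (*-nonNeg (square-nonNeg s) (∂-nonNeg V (∂-nonNeg V (∂-nonNeg U nonNeg)) S)) refl)) ⟩
        μ * (∂ u c S * (A + s * s * ∂ v (∂ v (∂ u c)) S))
          ≡⟨ cong (λ w → μ * (∂ u c S * w)) (∂∂-addMultiple x s v (∂ u c) S) ⟨
        μ * (∂ u c S * ∂ z (∂ z (∂ u c)) S)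
          ≤⟨ h z ⟩
        ν * (∂ z (∂ u c) S * ∂ z (∂ u c) S)
          ≡⟨ cong (λ w → ν * (w * w)) (∂-addMultiple x s v (∂ u c) S) ⟩
        ν * ((∂ x (∂ u c) S + s * ∂ v (∂ u c) S) * (∂ x (∂ u c) S + s * ∂ v (∂ u c) S)) ∎
        where
        open ℚP.≤-Reasoning
        u v z : Vec ℚ n
        u = indicator U
        v = indicator V
        z = addMultiple x s v
        A : ℚ
        A = ∂ x (∂ x (∂ u c)) S + (s + s) * ∂ x (∂ v (∂ u c)) S

      -- A derivative along one free site is evaluation at `S ∪ {i}`, so this is the Lorentz
      -- property of `c` itself at the larger set.
      Derived-singleton : ∀ i → Vec.lookup S i ≡ outside → Derived (indicator ⁅ i ⁆)
      Derived-singleton i i∉S x = subst₂ _≤ℚ_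
        (cong₂ (λ a b → μ * (a * b)) (sym (∂-∉ i c S i∉S))
          (sym (trans (∂∂∂-comm x (indicator ⁅ i ⁆)) (∂-∉ i (∂ x (∂ x c)) S i∉S))))
        (cong (λ a → ν * (a * a)) (sym (trans (∂-comm x (indicator ⁅ i ⁆) c S) (∂-∉ i (∂ x c) S i∉S))))
        (L m (S Vec.[ i ]≔ inside) x (ℕP.suc-injective (trans (sym (∁-insert S i i∉S)) eq)))

      -- `combine` asks for positive leading coefficients, and the derivative along `W` has one at
      -- `S` only when `W` meets the free sites of `S`. The witness `l` records this; as long as
      -- there is none, every derivative along `W` vanishes at `S`.
      Partial : Subset n → Set
      Partial W = (∀ f → ∂ (indicator W) f S ≡ 0ℚ) ⊎
        ((∃ λ l → Vec.lookup W l ≡ inside × Vec.lookup S l ≡ outside) × Derived (indicator W))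

      Derived-cong : ∀ u v → (∀ f → ∂ v f S ≡ ∂ u f S) → Derived u → Derived v
      Derived-cong u v e h x = subst₂ _≤ℚ_
        (cong₂ (λ a b → μ * (a * b)) (sym (e c)) (trans (∂∂∂-comm x u) (trans (sym (e (∂ x (∂ x c)))) (sym (∂∂∂-comm x v)))))
        (cong (λ a → ν * (a * a)) (trans (∂-comm x u c S) (trans (sym (e (∂ x c))) (∂-comm v x c S))))
        (h x)

      lookup-insert-other : ∀ (U W : Subset n) i l → Vec.lookup W i ≡ outside → Vec.lookup W l ≡ inside →
                            Vec.lookup (U Vec.[ i ]≔ inside) l ≡ Vec.lookup U l
      lookup-insert-other U W i l i∉W l∈W = VecP.lookup∘update′ l≢i U inside
        where
        l≢i : l ≢ i
        l≢i refl with trans (sym i∉W) l∈W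
        ... | ()

      insert-size : ∀ i → Vec.lookup S i ≡ outside → ∣ ∁ (S Vec.[ i ]≔ inside) ∣ˢ ≡ j ℕ.+ (2 ℕ.+ m)
      insert-size i i∉S = ℕP.suc-injective (trans (sym (∁-insert S i i∉S)) eq)

      insert₂-size : ∀ i l → Vec.lookup S i ≡ outside → Vec.lookup (S Vec.[ i ]≔ inside) l ≡ outside →
                     ∣ ∁ ((S Vec.[ i ]≔ inside) Vec.[ l ]≔ inside) ∣ˢ ≡ j ℕ.+ (1 ℕ.+ m)
      insert₂-size i l i∉S l∉Si = ℕP.suc-injective
        (trans (sym (∁-insert (S Vec.[ i ]≔ inside) l l∉Si)) (trans (insert-size i i∉S) (ℕP.+-suc j (suc m))))

      -- The mixed derivative `∂ e (∂ u c)` at `S` is the `g` of `combine`. It is positive because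
      -- `i` and `l` are distinct free sites, so that both can be filled.
      Derived-+ : ∀ W i → Vec.lookup W i ≡ outside → Vec.lookup S i ≡ outside →
                  (∃ λ l → Vec.lookup W l ≡ inside × Vec.lookup S l ≡ outside) →
                  Derived (indicator W) → Derived (indicator (W Vec.[ i ]≔ inside))
      Derived-+ W i i∉W i∉S (l , l∈W , l∉S) h x = subst₂ _≤ℚ_
        (cong₂ (λ a b → μ * (a * b)) first second)
        (cong (λ a → ν * (a * a)) third)
        (combine {μ} {ν} {∂ u c S} {∂ e c S} {∂ e (∂ u c) S} {∂ x (∂ x (∂ u c)) S} {∂ x (∂ x (∂ e c)) S}
          {∂ x (∂ e (∂ u c)) S} {∂ x (∂ u c) S} {∂ x (∂ e c) S} {1ℚ} {1ℚ}
          (∂-pos W S l nonNeg l∈W l∉S (pos _ (insert-size l l∉S)))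
          (subst (0ℚ <ℚ_) (sym (∂-∉ i c S i∉S)) (pos _ (insert-size i i∉S)))
          (subst (0ℚ <ℚ_) (sym (∂-∉ i (∂ u c) S i∉S))
            (∂-pos W (S Vec.[ i ]≔ inside) l nonNeg l∈W l∉Si (pos _ (insert₂-size i l i∉S l∉Si))))
          (ℚP.positive⁻¹ 1ℚ) (ℚP.nonNegative⁻¹ 1ℚ)
          (Derived-shift W ⁅ i ⁆ h x)
          (λ s → subst₂ _≤ℚ_
            (cong (λ w → μ * (∂ e c S * (∂ x (∂ x (∂ e c)) S + (s + s) * w))) (∂-cong x (∂-comm u e c) S))
            (cong (λ w → ν * ((∂ x (∂ e c) S + s * w) * (∂ x (∂ e c) S + s * w))) (∂-comm u e c S))
            (Derived-shift ⁅ i ⁆ W (Derived-singleton i i∉S) x s))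
          -- At `s = 0` the shared row drops out and the plain inequality for the sum of the two
          -- directions remains.
          0ℚ)
        where
        u e : Vec ℚ n
        u = indicator W
        e = indicator ⁅ i ⁆
        l∉Si : Vec.lookup (S Vec.[ i ]≔ inside) l ≡ outside
        l∉Si = trans (lookup-insert-other S W i l i∉W l∈W) l∉S
        insert-sum : ∀ f → ∂ (indicator (W Vec.[ i ]≔ inside)) f S ≡ ∂ u f S + ∂ e f S
        insert-sum f = ∂-insert W i f S i∉W
        first : 1ℚ * ∂ u c S + 1ℚ * ∂ e c S ≡ ∂ (indicator (W Vec.[ i ]≔ inside)) c S
        first = trans (solve 2 (λ a b → con 1ℚ :* a :+ con 1ℚ :* b := a :+ b) refl (∂ u c S) (∂ e c S)) (sym (insert-sum c))
        second : 1ℚ * ∂ x (∂ x (∂ u c)) S + 1ℚ * ∂ x (∂ x (∂ e c)) S + (0ℚ + 0ℚ) * ∂ x (∂ e (∂ u c)) S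
                 ≡ ∂ x (∂ x (∂ (indicator (W Vec.[ i ]≔ inside)) c)) S
        second = trans
          (solve 3 (λ a b d → con 1ℚ :* a :+ con 1ℚ :* b :+ (con 0ℚ :+ con 0ℚ) :* d := a :+ b) refl
            (∂ x (∂ x (∂ u c)) S) (∂ x (∂ x (∂ e c)) S) (∂ x (∂ e (∂ u c)) S))
          (trans (cong₂ _+_ (∂∂∂-comm x u) (∂∂∂-comm x e))
            (trans (sym (insert-sum (∂ x (∂ x c)))) (sym (∂∂∂-comm x (indicator (W Vec.[ i ]≔ inside))))))
        third : 1ℚ * ∂ x (∂ u c) S + 1ℚ * ∂ x (∂ e c) S + 0ℚ * ∂ e (∂ u c) S
                ≡ ∂ x (∂ (indicator (W Vec.[ i ]≔ inside)) c) S
        third = trans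
          (solve 3 (λ a b d → con 1ℚ :* a :+ con 1ℚ :* b :+ con 0ℚ :* d := a :+ b) refl
            (∂ x (∂ u c) S) (∂ x (∂ e c) S) (∂ e (∂ u c) S))
          (trans (cong₂ _+_ (∂-comm x u c S) (∂-comm x e c S))
            (trans (sym (insert-sum (∂ x c))) (∂-comm (indicator (W Vec.[ i ]≔ inside)) x c S)))

      step : ∀ W i → Vec.lookup W i ≡ outside → Partial W → Partial (W Vec.[ i ]≔ inside)
      step W i i∉W P with Vec.lookup S i in i?S
      step W i i∉W P | inside = extend P
        where
        unchanged : ∀ f → ∂ (indicator (W Vec.[ i ]≔ inside)) f S ≡ ∂ (indicator W) f S
        unchanged f = trans (∂-insert W i f S i∉W) (trans (cong (∂ (indicator W) f S +_) (∂-∈ i f S i?S)) (ℚP.+-identityʳ _))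
        extend : Partial W → Partial (W Vec.[ i ]≔ inside)
        extend (inj₁ vanish)                = inj₁ λ f → trans (unchanged f) (vanish f)
        extend (inj₂ ((l , l∈W , l∉S) , h)) = inj₂
          ((l , trans (lookup-insert-other W W i l i∉W l∈W) l∈W , l∉S) , Derived-cong (indicator W) (indicator (W Vec.[ i ]≔ inside)) unchanged h)
      step W i i∉W (inj₁ vanish) | outside = inj₂ ((i , VecP.lookup∘update i W inside , i?S) , Derived-cong (indicator ⁅ i ⁆) (indicator (W Vec.[ i ]≔ inside))
        (λ f → trans (∂-insert W i f S i∉W) (trans (cong (_+ ∂ (indicator ⁅ i ⁆) f S) (vanish f)) (ℚP.+-identityˡ _)))
        (Derived-singleton i i?S))
      step W i i∉W (inj₂ (w@(l , l∈W , l∉S) , h)) | outside = inj₂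
        ((l , trans (lookup-insert-other W W i l i∉W l∈W) l∈W , l∉S) , Derived-+ W i i∉W i?S w h)

      derived : ∀ W → Derived (indicator W)
      derived W with insert-induction Partial (inj₁ λ f → ∂-⊥ f S) step W
      ... | inj₂ (_ , h) = h
      ... | inj₁ vanish  = λ x → ℚP.≤-reflexive (trans
        (cong (λ a → μ * (a * ∂ x (∂ x (∂ (indicator W) c)) S)) (vanish c))
        (trans (solve 3 (λ m n b → m :* (con 0ℚ :* b) := n :* (con 0ℚ :* con 0ℚ)) refl μ ν (∂ x (∂ x (∂ (indicator W) c)) S))
          (sym (cong (λ a → ν * (a * a)) (trans (∂-comm x (indicator W) c S) (vanish (∂ x c)))))))

  ∂-Lorentz : ∀ W → Lorentz (suc j) (∂ (indicator W) c)
  ∂-Lorentz W m S x eq = At.derived m S eq W x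

∂-PositiveField : ∀ {n j} {c : Field n} → PositiveField j c → PositiveField (suc j) (∂ (indicator ⊤) c)
∂-PositiveField {n} {j} {c} c-pos = record
  { nonNeg = ∂-nonNeg ⊤ nonNeg
  ; pos    = λ S eq → let l , l∉S = ∁-nonempty S eq in
      ∂-pos ⊤ S l nonNeg (VecP.lookup-replicate l inside) l∉S
        (pos _ (ℕP.suc-injective (trans (sym (∁-insert S l l∉S)) eq)))
  }
  where open PositiveField c-pos

∂^ : ∀ {n} → ℕ → Field n → Field n
∂^ zero    c = c
∂^ (suc k) c = ∂ (indicator ⊤) (∂^ k c)

module _ {n : ℕ} {c : Field n} (c-pos : ∀ S → 0ℚ <ℚ c S) (L : Lorentz 0 c) where

  ∂^-PositiveField : ∀ k → PositiveField k (∂^ k c)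
  ∂^-PositiveField zero    = record { nonNeg = λ S → ℚP.<⇒≤ (c-pos S) ; pos = λ S _ → c-pos S }
  ∂^-PositiveField (suc k) = ∂-PositiveField (∂^-PositiveField k)

  ∂^-Lorentz : ∀ k → Lorentz k (∂^ k c)
  ∂^-Lorentz zero    = L
  ∂^-Lorentz (suc k) = ∂-Lorentz (∂^-PositiveField k) (∂^-Lorentz k) ⊤

-- Level sums and their normalization

sumˢ : ∀ {n} → Field n → ℚ
sumˢ {zero}  f = f []
sumˢ {suc n} f = sumˢ (λ S → f (outside ∷ S)) + sumˢ (λ S → f (inside ∷ S))

sumˢ-cong : ∀ {n} {f g : Field n} → f ≗ g → sumˢ f ≡ sumˢ g
sumˢ-cong {zero}  e = e []
sumˢ-cong {suc n} e = cong₂ _+_ (sumˢ-cong (λ S → e (outside ∷ S))) (sumˢ-cong (λ S → e (inside ∷ S)))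

sumˢ-0 : ∀ {n} → sumˢ {n} (λ _ → 0ℚ) ≡ 0ℚ
sumˢ-0 {zero}  = refl
sumˢ-0 {suc n} = cong₂ _+_ (sumˢ-0 {n}) (sumˢ-0 {n})

level : ∀ {n} → ℕ → Field n → ℚ
level k f = sumˢ (λ S → if ∣ S ∣ˢ ≡ᵇ k then f S else 0ℚ)

fromℕ-+ : ∀ m n → fromℕ (m ℕ.+ n) ≡ fromℕ m + fromℕ n
fromℕ-+ zero    n = sym (ℚP.+-identityˡ (fromℕ n))
fromℕ-+ (suc m) n = trans (fromℕ-suc (m ℕ.+ n)) (trans (cong (1ℚ +_) (fromℕ-+ m n))
  (trans (sym (ℚP.+-assoc 1ℚ (fromℕ m) (fromℕ n))) (cong (_+ fromℕ n) (sym (fromℕ-suc m)))))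

fromℕ-* : ∀ m n → fromℕ (m ℕ.* n) ≡ fromℕ m * fromℕ n
fromℕ-* zero    n = sym (ℚP.*-zeroˡ (fromℕ n))
fromℕ-* (suc m) n = trans (fromℕ-+ n (m ℕ.* n)) (trans (cong (fromℕ n +_) (fromℕ-* m n))
  (trans (solve 2 (λ n m → n :+ m :* n := (con 1ℚ :+ m) :* n) refl (fromℕ n) (fromℕ m))
    (cong (_* fromℕ n) (sym (fromℕ-suc m)))))

∂^-inside : ∀ {n} k (f : Field (suc n)) S → ∂^ k f (inside ∷ S) ≡ ∂^ k (λ T → f (inside ∷ T)) S
∂^-inside zero    f S = refl
∂^-inside (suc k) f S = ∂-cong (indicator ⊤) (∂^-inside k f) S

-- The additional site may be filled at any one of the `suc k` steps, and the result does not depend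
-- on which; hence the factor.
∂^-outside : ∀ {n} k (f : Field (suc n)) S → ∂^ (suc k) f (outside ∷ S) ≡
             fromℕ (suc k) * ∂^ k (λ T → f (inside ∷ T)) S + ∂^ (suc k) (λ T → f (outside ∷ T)) S
∂^-outside zero    f S = refl
∂^-outside (suc k) f S = begin
  1ℚ * ∂^ (suc k) f (inside ∷ S) + ∂ 𝟏 (λ T → ∂^ (suc k) f (outside ∷ T)) S
    ≡⟨ cong₂ (λ a b → 1ℚ * a + b) (∂^-inside (suc k) f S)
         (trans (∂-cong 𝟏 (∂^-outside k f) S) (∂-*+ 𝟏 (fromℕ (suc k)) (∂^ k f₁) (∂^ (suc k) f₀) S)) ⟩
  1ℚ * D + (fromℕ (suc k) * D + E)
    ≡⟨ solve 3 (λ d r e → con 1ℚ :* d :+ (r :* d :+ e) := (con 1ℚ :+ r) :* d :+ e) refl D (fromℕ (suc k)) E ⟩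
  (1ℚ + fromℕ (suc k)) * D + E
    ≡⟨ cong (λ r → r * D + E) (fromℕ-suc (suc k)) ⟨
  fromℕ (suc (suc k)) * D + E ∎
  where
  open ≡-Reasoning
  𝟏 = indicator ⊤
  f₀ f₁ : Field _
  f₀ T = f (outside ∷ T)
  f₁ T = f (inside ∷ T)
  D E : ℚ
  D = ∂^ (suc k) f₁ S
  E = ∂^ (suc (suc k)) f₀ S

-- Every `k`-set is filled from the empty set in `k !` orders.
∂^-⊥ : ∀ {n} k (f : Field n) → ∂^ k f ⊥ ≡ fromℕ (k !) * level k f
∂^-⊥ {zero}  zero    f = sym (ℚP.*-identityˡ (f []))
∂^-⊥ {zero}  (suc k) f = sym (ℚP.*-zeroʳ (fromℕ (suc k !)))
∂^-⊥ {suc n} zero    f = trans (∂^-⊥ zero (λ S → f (outside ∷ S)))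
  (cong (1ℚ *_) (sym (trans (cong (level 0 (λ S → f (outside ∷ S)) +_) (sumˢ-0 {n}))
    (ℚP.+-identityʳ (level 0 (λ S → f (outside ∷ S)))))))
∂^-⊥ {suc n} (suc k) f = begin
  ∂^ (suc k) f ⊥
    ≡⟨ ∂^-outside k f ⊥ ⟩
  fromℕ (suc k) * ∂^ k f₁ ⊥ + ∂^ (suc k) f₀ ⊥
    ≡⟨ cong₂ (λ a b → fromℕ (suc k) * a + b) (∂^-⊥ k f₁) (∂^-⊥ (suc k) f₀) ⟩
  fromℕ (suc k) * (fromℕ (k !) * level k f₁) + fromℕ (suc k !) * level (suc k) f₀
    ≡⟨ cong (λ r → fromℕ (suc k) * (fromℕ (k !) * level k f₁) + r * level (suc k) f₀) (fromℕ-* (suc k) (k !)) ⟩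
  fromℕ (suc k) * (fromℕ (k !) * level k f₁) + fromℕ (suc k) * fromℕ (k !) * level (suc k) f₀
    ≡⟨ solve 4 (λ r s a b → r :* (s :* a) :+ r :* s :* b := r :* s :* (b :+ a)) refl
         (fromℕ (suc k)) (fromℕ (k !)) (level k f₁) (level (suc k) f₀) ⟩
  fromℕ (suc k) * fromℕ (k !) * level (suc k) f
    ≡⟨ cong (_* level (suc k) f) (fromℕ-* (suc k) (k !)) ⟨
  fromℕ (suc k !) * level (suc k) f ∎
  where
  open ≡-Reasoning
  f₀ f₁ : Field n
  f₀ T = f (outside ∷ T)
  f₁ T = f (inside ∷ T)

-- For the field `∂^ k c` at the empty set, along the all-ones vector, the Lorentz inequality
-- involves three consecutive iterated derivatives; their factorials leave the common factor `F`.
-- The middle level is `1 + k`, so `k` here is one below the index of the final inequality.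
newton : ∀ {k m} {c : Field (k ℕ.+ (2 ℕ.+ m))} → (∀ S → 0ℚ <ℚ c S) → Lorentz 0 c →
         fromℕ (2 ℕ.+ m) * fromℕ (2 ℕ.+ k) * (level k c * level (2 ℕ.+ k) c)
         ≤ℚ fromℕ (1 ℕ.+ m) * fromℕ (1 ℕ.+ k) * (level (1 ℕ.+ k) c * level (1 ℕ.+ k) c)
newton {k} {m} {c} c-pos L = *-cancelˡ 0<F (subst₂ _≤ℚ_ left right (∂^-Lorentz c-pos L k m ⊥ (indicator ⊤) (∁-⊥ _)))
  where
  open ≡-Reasoning
  f₀ r₁ r₂ F : ℚ
  f₀ = fromℕ (k !)
  r₁ = fromℕ (1 ℕ.+ k)
  r₂ = fromℕ (2 ℕ.+ k)
  F = r₁ * (f₀ * f₀)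
  0<f₀ : 0ℚ <ℚ f₀
  0<f₀ = ℚP.<-≤-trans (ℚP.positive⁻¹ 1ℚ) (fromℕ-mono (ℕ.>-nonZero⁻¹ (k !) {{k ℕP.!≢0}}))
  0<F : 0ℚ <ℚ F
  0<F = *-pos (fromℕ-pos k) (*-pos 0<f₀ 0<f₀)
  a₀ a₁ a₂ : ℚ
  a₀ = level k c
  a₁ = level (1 ℕ.+ k) c
  a₂ = level (2 ℕ.+ k) c
  e₁ : ∂^ (1 ℕ.+ k) c ⊥ ≡ r₁ * f₀ * a₁
  e₁ = trans (∂^-⊥ (suc k) c) (cong (_* a₁) (fromℕ-* (suc k) (k !)))
  e₂ : ∂^ (2 ℕ.+ k) c ⊥ ≡ r₂ * (r₁ * f₀) * a₂
  e₂ = trans (∂^-⊥ (2 ℕ.+ k) c) (cong (_* a₂)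
    (trans (fromℕ-* (2 ℕ.+ k) (suc k !)) (cong (r₂ *_) (fromℕ-* (suc k) (k !)))))
  left : fromℕ (2 ℕ.+ m) * (∂^ k c ⊥ * ∂^ (2 ℕ.+ k) c ⊥) ≡ F * (fromℕ (2 ℕ.+ m) * r₂ * (a₀ * a₂))
  left = trans (cong₂ (λ u v → fromℕ (2 ℕ.+ m) * (u * v)) (∂^-⊥ k c) e₂)
    (solve 6 (λ μ f r₁ r₂ a b → μ :* (f :* a :* (r₂ :* (r₁ :* f) :* b)) := r₁ :* (f :* f) :* (μ :* r₂ :* (a :* b)))
      refl (fromℕ (2 ℕ.+ m)) f₀ r₁ r₂ a₀ a₂)
  right : fromℕ (1 ℕ.+ m) * (∂^ (1 ℕ.+ k) c ⊥ * ∂^ (1 ℕ.+ k) c ⊥) ≡ F * (fromℕ (1 ℕ.+ m) * r₁ * (a₁ * a₁))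
  right = trans (cong (λ u → fromℕ (1 ℕ.+ m) * (u * u)) e₁)
    (solve 4 (λ ν f r a → ν :* (r :* f :* a :* (r :* f :* a)) := r :* (f :* f) :* (ν :* r :* (a :* a)))
      refl (fromℕ (1 ℕ.+ m)) f₀ r₁ a₁)

-- The difference is taken in ℚ, where it turns negative for `k > n`; both binomial coefficients are
-- then 0. `coefficient-absorption` uses this range as well.
absorption : ∀ n k → fromℕ (suc k) * fromℕ (n C suc k) ≡ (fromℕ n - fromℕ k) * fromℕ (n C k)
absorption zero    zero    = refl
absorption zero    (suc k) = trans (ℚP.*-zeroʳ (fromℕ (2 ℕ.+ k))) (sym (ℚP.*-zeroʳ (0ℚ - fromℕ (suc k))))
absorption (suc n) k = begin
  s * fromℕ (suc n C suc k)
    ≡⟨ cong (λ r → s * fromℕ r) (nCk+nC[k+1]≡[n+1]C[k+1] n k) ⟨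
  s * fromℕ (n C k ℕ.+ n C suc k)
    ≡⟨ trans (cong (s *_) (fromℕ-+ (n C k) (n C suc k))) (ℚP.*-distribˡ-+ s _ _) ⟩
  s * fromℕ (n C k) + s * fromℕ (n C suc k)
    ≡⟨ cong₂ (λ r t → r * fromℕ (n C k) + t) (fromℕ-suc k) (absorption n k) ⟩
  (1ℚ + fromℕ k) * fromℕ (n C k) + (fromℕ n - fromℕ k) * fromℕ (n C k)
    ≡⟨ solve 3 (λ n k c → (con 1ℚ :+ k) :* c :+ (n :- k) :* c := (con 1ℚ :+ n) :* c) refl (fromℕ n) (fromℕ k) (fromℕ (n C k)) ⟩
  (1ℚ + fromℕ n) * fromℕ (n C k)
    ≡⟨ below k ⟩
  (1ℚ + fromℕ n - fromℕ k) * fromℕ (suc n C k)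
    ≡⟨ cong (λ r → (r - fromℕ k) * fromℕ (suc n C k)) (fromℕ-suc n) ⟨
  (fromℕ (suc n) - fromℕ k) * fromℕ (suc n C k) ∎
  where
  open ≡-Reasoning
  s = fromℕ (suc k)
  below : ∀ k → (1ℚ + fromℕ n) * fromℕ (n C k) ≡ (1ℚ + fromℕ n - fromℕ k) * fromℕ (suc n C k)
  below zero    = solve 1 (λ a → a :* con 1ℚ := (a :- con 0ℚ) :* con 1ℚ) refl (1ℚ + fromℕ n)
  below (suc k) = begin
    (1ℚ + fromℕ n) * B
      ≡⟨ solve 3 (λ n k b → (con 1ℚ :+ n) :* b := (n :- k) :* b :+ (con 1ℚ :+ k) :* b) refl (fromℕ n) (fromℕ k) B ⟩
    (fromℕ n - fromℕ k) * B + (1ℚ + fromℕ k) * B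
      ≡⟨ cong (λ r → (fromℕ n - fromℕ k) * B + r * B) (fromℕ-suc k) ⟨
    (fromℕ n - fromℕ k) * B + fromℕ (suc k) * B
      ≡⟨ cong ((fromℕ n - fromℕ k) * B +_) (absorption n k) ⟩
    (fromℕ n - fromℕ k) * B + (fromℕ n - fromℕ k) * A
      ≡⟨ solve 4 (λ n k a b → (n :- k) :* b :+ (n :- k) :* a := (con 1ℚ :+ n :- (con 1ℚ :+ k)) :* (a :+ b)) refl (fromℕ n) (fromℕ k) A B ⟩
    (1ℚ + fromℕ n - (1ℚ + fromℕ k)) * (A + B)
      ≡⟨ cong₂ (λ r t → (1ℚ + fromℕ n - r) * t) (fromℕ-suc k)
           (trans (cong fromℕ (sym (nCk+nC[k+1]≡[n+1]C[k+1] n k))) (fromℕ-+ (n C k) (n C suc k))) ⟨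
    (1ℚ + fromℕ n - fromℕ (suc k)) * fromℕ (suc n C suc k) ∎
    where
    A = fromℕ (n C k)
    B = fromℕ (n C suc k)

*-unit : ∀ d .{{_ : ℕ.NonZero d}} → fromℕ d * (ℤ.+ 1 / d) ≡ 1ℚ
*-unit (suc d) = trans (cong (fromℕ (suc d) *_) (ℚP./-cong {ℤ.+ 1} refl (sym (ℕP.*-identityʳ (suc d))))) (fromℕ-*-unit d 0)

-- `transfer` turns the absorption identity into relations between consecutive reciprocals,
-- `r₁u₀ = μu₁` and `r₂u₁ = νu₂`. After multiplication by `u₁²` they convert the constants of
-- `newton` into the same factor `r₁ν` on both sides.
newton-normalized : ∀ {k m u₀ u₁ u₂} (let n = k ℕ.+ (2 ℕ.+ m)) {c : Field n} → (∀ S → 0ℚ <ℚ c S) → Lorentz 0 c →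
  fromℕ (n C k) * u₀ ≡ 1ℚ → fromℕ (n C suc k) * u₁ ≡ 1ℚ → fromℕ (n C (2 ℕ.+ k)) * u₂ ≡ 1ℚ →
  (level k c * u₀) * (level (2 ℕ.+ k) c * u₂) ≤ℚ (level (1 ℕ.+ k) c * u₁) * (level (1 ℕ.+ k) c * u₁)
newton-normalized {k} {m} {u₀} {u₁} {u₂} {c} c-pos L e₀ e₁ e₂ =
  *-cancelˡ (*-pos (fromℕ-pos k) (fromℕ-pos m)) (subst₂ _≤ℚ_ left right
    (*-monoʳ (square-nonNeg u₁) (newton {k} {m} c-pos L)))
  where
  open ≡-Reasoning
  n = k ℕ.+ (2 ℕ.+ m)
  a₀ a₁ a₂ r₁ r₂ μ ν : ℚ
  a₀ = level k c
  a₁ = level (1 ℕ.+ k) c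
  a₂ = level (2 ℕ.+ k) c
  r₁ = fromℕ (1 ℕ.+ k)
  r₂ = fromℕ (2 ℕ.+ k)
  μ = fromℕ (2 ℕ.+ m)
  ν = fromℕ (1 ℕ.+ m)
  transfer : ∀ {r μ c₀ c₁ u₀ u₁} → r * c₁ ≡ μ * c₀ → c₀ * u₀ ≡ 1ℚ → c₁ * u₁ ≡ 1ℚ → r * u₀ ≡ μ * u₁
  transfer {r} {μ} {c₀} {c₁} {u₀} {u₁} e e₀ e₁ = begin
    r * u₀                ≡⟨ trans (cong (r * u₀ *_) e₁) (ℚP.*-identityʳ (r * u₀)) ⟨
    r * u₀ * (c₁ * u₁)    ≡⟨ solve 4 (λ r u c v → r :* u :* (c :* v) := r :* c :* (u :* v)) refl r u₀ c₁ u₁ ⟩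
    r * c₁ * (u₀ * u₁)    ≡⟨ cong (_* (u₀ * u₁)) e ⟩
    μ * c₀ * (u₀ * u₁)    ≡⟨ solve 4 (λ r u c v → r :* c :* (u :* v) := r :* v :* (c :* u)) refl μ u₀ c₀ u₁ ⟩
    μ * u₁ * (c₀ * u₀)    ≡⟨ trans (cong (μ * u₁ *_) e₀) (ℚP.*-identityʳ (μ * u₁)) ⟩
    μ * u₁                ∎
  complement : ∀ j i → fromℕ (j ℕ.+ i) - fromℕ j ≡ fromℕ i
  complement j i = trans (cong (_- fromℕ j) (fromℕ-+ j i))
    (solve 2 (λ a b → a :+ b :- a := b) refl (fromℕ j) (fromℕ i))
  t₁ : r₁ * u₀ ≡ μ * u₁
  t₁ = transfer {r₁} {μ} {fromℕ (n C k)} {fromℕ (n C suc k)}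
    (trans (absorption n k) (cong (_* fromℕ (n C k)) (complement k (2 ℕ.+ m)))) e₀ e₁
  t₂ : r₂ * u₁ ≡ ν * u₂
  t₂ = transfer {r₂} {ν} {fromℕ (n C suc k)} {fromℕ (n C (2 ℕ.+ k))}
    (trans (absorption n (suc k)) (cong (_* fromℕ (n C suc k))
      (trans (cong (λ j → fromℕ j - r₁) (ℕP.+-suc k (suc m))) (complement (suc k) (suc m))))) e₁ e₂
  left : μ * r₂ * (a₀ * a₂) * (u₁ * u₁) ≡ (r₁ * ν) * ((a₀ * u₀) * (a₂ * u₂))
  left = begin
    μ * r₂ * (a₀ * a₂) * (u₁ * u₁)
      ≡⟨ solve 5 (λ μ r a b u → μ :* r :* (a :* b) :* (u :* u) := (μ :* u) :* (r :* u) :* (a :* b)) refl μ r₂ a₀ a₂ u₁ ⟩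
    (μ * u₁) * (r₂ * u₁) * (a₀ * a₂)
      ≡⟨ cong₂ (λ p q → p * q * (a₀ * a₂)) (sym t₁) t₂ ⟩
    (r₁ * u₀) * (ν * u₂) * (a₀ * a₂)
      ≡⟨ solve 6 (λ r u ν v a b → (r :* u) :* (ν :* v) :* (a :* b) := (r :* ν) :* ((a :* u) :* (b :* v))) refl r₁ u₀ ν u₂ a₀ a₂ ⟩
    (r₁ * ν) * ((a₀ * u₀) * (a₂ * u₂)) ∎
  right : ν * r₁ * (a₁ * a₁) * (u₁ * u₁) ≡ (r₁ * ν) * ((a₁ * u₁) * (a₁ * u₁))
  right = solve 4 (λ ν r a u → ν :* r :* (a :* a) :* (u :* u) := (r :* ν) :* ((a :* u) :* (a :* u))) refl ν r₁ a₁ u₁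

-- Powers, Bernoulli inequalities and binomial coefficients

^-nonNeg : ∀ {p} → 0ℚ ≤ℚ p → ∀ j → 0ℚ ≤ℚ p ^ j
^-nonNeg 0≤p zero    = ℚP.nonNegative⁻¹ 1ℚ
^-nonNeg 0≤p (suc j) = *-nonNeg 0≤p (^-nonNeg 0≤p j)

^-mono : ∀ {p q} → 0ℚ ≤ℚ p → p ≤ℚ q → ∀ j → p ^ j ≤ℚ q ^ j
^-mono 0≤p p≤q zero    = ℚP.≤-refl
^-mono 0≤p p≤q (suc j) = *-mono-≤-nonNeg 0≤p (^-nonNeg (ℚP.≤-trans 0≤p p≤q) j) p≤q (^-mono 0≤p p≤q j)

^-distrib-* : ∀ p q j → (p * q) ^ j ≡ p ^ j * q ^ j
^-distrib-* p q zero    = refl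
^-distrib-* p q (suc j) = trans (cong (p * q *_) (^-distrib-* p q j))
  (solve 4 (λ p q a b → p :* q :* (a :* b) := p :* a :* (q :* b)) refl p q (p ^ j) (q ^ j))

bernoulli : ∀ {y} → 0ℚ ≤ℚ y → ∀ j → 1ℚ + fromℕ j * y ≤ℚ (1ℚ + y) ^ j
bernoulli {y} 0≤y zero    = ℚP.≤-reflexive (solve 1 (λ y → con 1ℚ :+ con 0ℚ :* y := con 1ℚ) refl y)
bernoulli {y} 0≤y (suc j) = begin
  1ℚ + fromℕ (suc j) * y
    ≡⟨ cong (λ r → 1ℚ + r * y) (fromℕ-suc j) ⟩
  1ℚ + (1ℚ + fromℕ j) * y
    ≤⟨ ≤-by-diff {1ℚ + (1ℚ + fromℕ j) * y} (fromℕ j * (y * y)) (*-nonNeg (fromℕ-nonNeg j) (square-nonNeg y))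
         (solve 2 (λ j y → (con 1ℚ :+ y) :* (con 1ℚ :+ j :* y) := con 1ℚ :+ (con 1ℚ :+ j) :* y :+ j :* (y :* y)) refl (fromℕ j) y) ⟩
  (1ℚ + y) * (1ℚ + fromℕ j * y)
    ≤⟨ *-monoˡ (+-nonNeg (ℚP.nonNegative⁻¹ 1ℚ) 0≤y) (bernoulli 0≤y j) ⟩
  (1ℚ + y) * (1ℚ + y) ^ j ∎
  where open ℚP.≤-Reasoning

-- The induction rests on `(1 + y)(1 - (1 + j)y) ≤ 1 - jy`. When `jy < 1` this bounds powers from
-- above by rational means, in place of a comparison with the exponential function.
bernoulli-reverse : ∀ {y} → 0ℚ ≤ℚ y → ∀ j → (1ℚ + y) ^ j * (1ℚ - fromℕ j * y) ≤ℚ 1ℚ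
bernoulli-reverse {y} 0≤y zero    = ℚP.≤-reflexive (solve 1 (λ y → con 1ℚ :* (con 1ℚ :- con 0ℚ :* y) := con 1ℚ) refl y)
bernoulli-reverse {y} 0≤y (suc j) = begin
  (1ℚ + y) * (1ℚ + y) ^ j * (1ℚ - fromℕ (suc j) * y)
    ≡⟨ cong (λ r → (1ℚ + y) * (1ℚ + y) ^ j * (1ℚ - r * y)) (fromℕ-suc j) ⟩
  (1ℚ + y) * (1ℚ + y) ^ j * (1ℚ - (1ℚ + fromℕ j) * y)
    ≤⟨ ≤-by-diff {(1ℚ + y) * (1ℚ + y) ^ j * (1ℚ - (1ℚ + fromℕ j) * y)} ((1ℚ + y) ^ j * ((1ℚ + fromℕ j) * (y * y)))
         (*-nonNeg (^-nonNeg (+-nonNeg (ℚP.nonNegative⁻¹ 1ℚ) 0≤y) j)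
           (*-nonNeg (+-nonNeg (ℚP.nonNegative⁻¹ 1ℚ) (fromℕ-nonNeg j)) (square-nonNeg y)))
         (solve 3 (λ y j p → p :* (con 1ℚ :- j :* y)
             := (con 1ℚ :+ y) :* p :* (con 1ℚ :- (con 1ℚ :+ j) :* y) :+ p :* ((con 1ℚ :+ j) :* (y :* y)))
           refl y (fromℕ j) ((1ℚ + y) ^ j)) ⟩
  (1ℚ + y) ^ j * (1ℚ - fromℕ j * y)
    ≤⟨ bernoulli-reverse 0≤y j ⟩
  1ℚ ∎
  where open ℚP.≤-Reasoning

^-≤-2 : ∀ {y} → 0ℚ ≤ℚ y → ∀ j → fromℕ j * y ≤ℚ ½ → (1ℚ + y) ^ j ≤ℚ fromℕ 2
^-≤-2 {y} 0≤y j jy≤½ = *-cancelˡ (ℚP.positive⁻¹ ½) (begin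
  ½ * (1ℚ + y) ^ j
    ≡⟨ ℚP.*-comm ½ ((1ℚ + y) ^ j) ⟩
  (1ℚ + y) ^ j * ½
    ≤⟨ *-monoˡ (^-nonNeg (+-nonNeg (ℚP.nonNegative⁻¹ 1ℚ) 0≤y) j)
         (≤-by-diff {½} (½ - fromℕ j * y) (diff-nonNeg jy≤½)
           (solve 1 (λ x → con 1ℚ :- x := con ½ :+ (con ½ :- x)) refl (fromℕ j * y))) ⟩
  (1ℚ + y) ^ j * (1ℚ - fromℕ j * y)
    ≤⟨ bernoulli-reverse 0≤y j ⟩
  1ℚ ∎)
  where open ℚP.≤-Reasoning

^-≤-1+2jy : ∀ {y} → 0ℚ ≤ℚ y → ∀ j → fromℕ j * y ≤ℚ ½ → (1ℚ + y) ^ j ≤ℚ 1ℚ + fromℕ 2 * (fromℕ j * y)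
^-≤-1+2jy {y} 0≤y j jy≤½ = begin
  p
    ≡⟨ solve 2 (λ p x → p := p :* (con 1ℚ :- x) :+ p :* x) refl p (fromℕ j * y) ⟩
  p * (1ℚ - fromℕ j * y) + p * (fromℕ j * y)
    ≤⟨ ℚP.+-mono-≤ (bernoulli-reverse 0≤y j) (*-monoʳ (*-nonNeg (fromℕ-nonNeg j) 0≤y) (^-≤-2 0≤y j jy≤½)) ⟩
  1ℚ + fromℕ 2 * (fromℕ j * y) ∎
  where
  open ℚP.≤-Reasoning
  p = (1ℚ + y) ^ j

-- (1 + K/2N)^N ≤ ((1 + 1/2N)^N)^K ≤ 2^K.
^-bounded : ∀ {x s} N K → 0ℚ ≤ℚ x → 0ℚ ≤ℚ s → fromℕ N * s ≡ 1ℚ → x ≤ℚ fromℕ K * (½ * s) → (1ℚ + x) ^ N ≤ℚ fromℕ 2 ^ K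
^-bounded {x} {s} N K 0≤x 0≤s Ns≡1 x≤ = begin
  (1ℚ + x) ^ N
    ≤⟨ ^-mono (+-nonNeg (ℚP.nonNegative⁻¹ 1ℚ) 0≤x)
         (ℚP.≤-trans (ℚP.+-monoʳ-≤ 1ℚ x≤) (bernoulli 0≤y K)) N ⟩
  ((1ℚ + y) ^ K) ^ N
    ≡⟨ trans (^-assocʳ (1ℚ + y) K N) (trans (cong ((1ℚ + y) ^_) (ℕP.*-comm K N)) (sym (^-assocʳ (1ℚ + y) N K))) ⟩
  ((1ℚ + y) ^ N) ^ K
    ≤⟨ ^-mono (^-nonNeg (+-nonNeg (ℚP.nonNegative⁻¹ 1ℚ) 0≤y) N)
         (^-≤-2 0≤y N (ℚP.≤-reflexive (trans (solve 2 (λ n s → n :* (con ½ :* s) := con ½ :* (n :* s)) refl (fromℕ N) s)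
           (cong (½ *_) Ns≡1)))) K ⟩
  fromℕ 2 ^ K ∎
  where
  open ℚP.≤-Reasoning
  y = ½ * s
  0≤y : 0ℚ ≤ℚ y
  0≤y = *-nonNeg (ℚP.nonNegative⁻¹ ½) 0≤s

sumTo : ℕ → (ℕ → ℚ) → ℚ
sumTo zero    f = 0ℚ
sumTo (suc M) f = sumTo M f + f M

sumTo-cong : ∀ M {f g} → (∀ m → f m ≡ g m) → sumTo M f ≡ sumTo M g
sumTo-cong zero    e = refl
sumTo-cong (suc M) e = cong₂ _+_ (sumTo-cong M e) (e M)

sumTo-dominated : ∀ M {f g h} → (∀ m → ∣ f m - g m ∣ ≤ℚ h m) → ∣ sumTo M f - sumTo M g ∣ ≤ℚ sumTo M h
sumTo-dominated zero            e = ℚP.≤-refl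
sumTo-dominated (suc M) {f} {g} {h} e = begin
  ∣ (sumTo M f + f M) - (sumTo M g + g M) ∣
    ≡⟨ cong ∣_∣ (solve 4 (λ a b c d → (a :+ b) :- (c :+ d) := (a :- c) :+ (b :- d)) refl (sumTo M f) (f M) (sumTo M g) (g M)) ⟩
  ∣ (sumTo M f - sumTo M g) + (f M - g M) ∣
    ≤⟨ ℚP.∣p+q∣≤∣p∣+∣q∣ (sumTo M f - sumTo M g) (f M - g M) ⟩
  ∣ sumTo M f - sumTo M g ∣ + ∣ f M - g M ∣
    ≤⟨ ℚP.+-mono-≤ (sumTo-dominated M e) (e M) ⟩
  sumTo M h + h M ∎
  where open ℚP.≤-Reasoning

sumTo-*ˡ : ∀ M r f → sumTo M (λ m → r * f m) ≡ r * sumTo M f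
sumTo-*ˡ zero    r f = sym (ℚP.*-zeroʳ r)
sumTo-*ˡ (suc M) r f = trans (cong (_+ r * f M) (sumTo-*ˡ M r f)) (sym (ℚP.*-distribˡ-+ r (sumTo M f) (f M)))

module Binomial (N : ℕ) (s : ℚ) (0≤s : 0ℚ ≤ℚ s) (Ns≡1 : fromℕ N * s ≡ 1ℚ) where

  -- With `s = 1/N`, `coefficient N m` is the coefficient of the `m`-th power of `H` in
  -- `(1 + sH)^N`, to be compared with `1/! m`.
  coefficient : ℕ → ℕ → ℚ
  coefficient j m = fromℕ (j C m) * s ^ m

  coefficient-step : ∀ j m → coefficient (suc j) (suc m) ≡ coefficient j (suc m) + s * coefficient j m
  coefficient-step j m = trans
    (cong (_* (s * s ^ m)) (trans (cong fromℕ (sym (nCk+nC[k+1]≡[n+1]C[k+1] j m))) (fromℕ-+ (j C m) (j C suc m))))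
    (solve 4 (λ a b s p → (a :+ b) :* (s :* p) := b :* (s :* p) :+ s :* (a :* p)) refl (fromℕ (j C m)) (fromℕ (j C suc m)) s (s ^ m))

  coefficient-nonNeg : ∀ j m → 0ℚ ≤ℚ coefficient j m
  coefficient-nonNeg j m = *-nonNeg (fromℕ-nonNeg (j C m)) (^-nonNeg 0≤s m)

  coefficient-absorption : ∀ m → fromℕ (suc m) * coefficient N (suc m) ≡ (1ℚ - s * fromℕ m) * coefficient N m
  coefficient-absorption m = begin
    fromℕ (suc m) * (fromℕ (N C suc m) * (s * s ^ m))
      ≡⟨ solve 4 (λ r c s p → r :* (c :* (s :* p)) := (r :* c) :* (s :* p)) refl (fromℕ (suc m)) (fromℕ (N C suc m)) s (s ^ m) ⟩
    (fromℕ (suc m) * fromℕ (N C suc m)) * (s * s ^ m)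
      ≡⟨ cong (_* (s * s ^ m)) (absorption N m) ⟩
    (fromℕ N - fromℕ m) * fromℕ (N C m) * (s * s ^ m)
      ≡⟨ solve 5 (λ n m c s p → (n :- m) :* c :* (s :* p) := (n :* s :- s :* m) :* (c :* p)) refl (fromℕ N) (fromℕ m) (fromℕ (N C m)) s (s ^ m) ⟩
    (fromℕ N * s - s * fromℕ m) * coefficient N m
      ≡⟨ cong (λ r → (r - s * fromℕ m) * coefficient N m) Ns≡1 ⟩
    (1ℚ - s * fromℕ m) * coefficient N m ∎
    where open ≡-Reasoning

  coefficient-upper : ∀ m → coefficient N m ≤ℚ 1/! m
  coefficient-upper zero    = ℚP.≤-refl
  coefficient-upper (suc m) = *-cancelˡ (fromℕ-pos m) (begin
    fromℕ (suc m) * coefficient N (suc m)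
      ≡⟨ coefficient-absorption m ⟩
    (1ℚ - s * fromℕ m) * coefficient N m
      ≤⟨ ≤-by-diff {(1ℚ - s * fromℕ m) * coefficient N m} (s * fromℕ m * coefficient N m)
           (*-nonNeg (*-nonNeg 0≤s (fromℕ-nonNeg m)) (coefficient-nonNeg N m))
           (solve 2 (λ x c → c := (con 1ℚ :- x) :* c :+ x :* c) refl (s * fromℕ m) (coefficient N m)) ⟩
    coefficient N m
      ≤⟨ coefficient-upper m ⟩
    1/! m
      ≡⟨ fromℕ-*-1/! m ⟨
    fromℕ (suc m) * 1/! (suc m) ∎)
    where open ℚP.≤-Reasoning

  private
    m≤2^m : ∀ m → fromℕ m ≤ℚ fromℕ 2 ^ m
    m≤2^m m = ℚP.≤-trans (≤-by-diff {fromℕ m} 1ℚ (ℚP.nonNegative⁻¹ 1ℚ)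
      (solve 1 (λ m → con 1ℚ :+ m :* con 1ℚ := m :+ con 1ℚ) refl (fromℕ m))) (bernoulli (ℚP.nonNegative⁻¹ 1ℚ) m)

  1/!-nonNeg : ∀ m → 0ℚ ≤ℚ 1/! m
  1/!-nonNeg m = unit-nonNeg (m !) {{m ℕP.!≢0}}

  -- Multiplied by `m + 1`, the error at `m + 1` is the error at `m` plus `s m` times a coefficient.
  -- The estimate `m ≤ 2^m` gives both parts the same bound, which therefore doubles. The factor
  -- `2^m` is later absorbed by passing from `X` to `X + X`.
  coefficient-lower : ∀ m → 1/! m - coefficient N m ≤ℚ s * (fromℕ 2 ^ m * 1/! m)
  coefficient-lower zero    = subst (0ℚ ≤ℚ_) (solve 1 (λ s → s := s :* (con 1ℚ :* con 1ℚ)) refl s) 0≤s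
  coefficient-lower (suc m) = *-cancelˡ (fromℕ-pos m) (begin
    r * (1/! (suc m) - coefficient N (suc m))
      ≡⟨ solve 3 (λ r a c → r :* (a :- c) := r :* a :- r :* c) refl r (1/! (suc m)) (coefficient N (suc m)) ⟩
    r * 1/! (suc m) - r * coefficient N (suc m)
      ≡⟨ cong₂ _-_ (fromℕ-*-1/! m) (coefficient-absorption m) ⟩
    1/! m - (1ℚ - s * fromℕ m) * coefficient N m
      ≡⟨ solve 4 (λ a s m c → a :- (con 1ℚ :- s :* m) :* c := (a :- c) :+ s :* (m :* c)) refl (1/! m) s (fromℕ m) (coefficient N m) ⟩
    (1/! m - coefficient N m) + s * (fromℕ m * coefficient N m)
      ≤⟨ ℚP.+-mono-≤ (coefficient-lower m) (*-monoˡ 0≤s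
           (*-mono-≤-nonNeg (fromℕ-nonNeg m) (1/!-nonNeg m) (m≤2^m m) (coefficient-upper m))) ⟩
    s * (fromℕ 2 ^ m * 1/! m) + s * (fromℕ 2 ^ m * 1/! m)
      ≡⟨ solve 3 (λ s p a → s :* (p :* a) :+ s :* (p :* a) := s :* ((con 1ℚ :+ con 1ℚ) :* p :* a)) refl s (fromℕ 2 ^ m) (1/! m) ⟩
    s * (fromℕ 2 ^ suc m * 1/! m)
      ≡⟨ cong (λ a → s * (fromℕ 2 ^ suc m * a)) (fromℕ-*-1/! m) ⟨
    s * (fromℕ 2 ^ suc m * (r * 1/! (suc m)))
      ≡⟨ solve 4 (λ s p r a → s :* (p :* (r :* a)) := r :* (s :* (p :* a))) refl s (fromℕ 2 ^ suc m) r (1/! (suc m)) ⟩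
    r * (s * (fromℕ 2 ^ suc m * 1/! (suc m))) ∎)
    where
    open ℚP.≤-Reasoning
    r = fromℕ (suc m)

  -- Pascal's rule for sums cut off at `M`: the shift leaves a boundary term with `coefficient j M`,
  -- which vanishes once `j < M`.
  binomial-step : ∀ j M (u : ℕ → ℚ) →
    sumTo (suc M) (λ m → coefficient j m * u m) + s * sumTo (suc M) (λ m → coefficient j m * u (suc m))
    ≡ sumTo (suc M) (λ m → coefficient (suc j) m * u m) + s * (coefficient j M * u (suc M))
  binomial-step j zero    u = solve 3 (λ a s b → (con 0ℚ :+ con 1ℚ :* con 1ℚ :* a) :+ s :* (con 0ℚ :+ b)
      := (con 0ℚ :+ con 1ℚ :* con 1ℚ :* a) :+ s :* b) refl (u 0) s (coefficient j 0 * u 1)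
  binomial-step j (suc M) u = begin
    (A + a) + s * (B + b)
      ≡⟨ solve 5 (λ A a s B b → (A :+ a) :+ s :* (B :+ b) := (A :+ s :* B) :+ (a :+ s :* b)) refl A a s B b ⟩
    (A + s * B) + (a + s * b)
      ≡⟨ cong (_+ (a + s * b)) (binomial-step j M u) ⟩
    (D + s * (coefficient j M * u (suc M))) + (a + s * b)
      ≡⟨ solve 6 (λ D s c v c′ b → (D :+ s :* (c :* v)) :+ (c′ :* v :+ s :* b) := (D :+ (c′ :+ s :* c) :* v) :+ s :* b) refl
           D s (coefficient j M) (u (suc M)) (coefficient j (suc M)) b ⟩
    (D + (coefficient j (suc M) + s * coefficient j M) * u (suc M)) + s * b
      ≡⟨ cong (λ c → (D + c * u (suc M)) + s * b) (coefficient-step j M) ⟨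
    (D + coefficient (suc j) (suc M) * u (suc M)) + s * b ∎
    where
    open ≡-Reasoning
    A B D a b : ℚ
    A = sumTo (suc M) (λ m → coefficient j m * u m)
    B = sumTo (suc M) (λ m → coefficient j m * u (suc m))
    D = sumTo (suc M) (λ m → coefficient (suc j) m * u m)
    a = coefficient j (suc M) * u (suc M)
    b = coefficient j (suc M) * u (suc (suc M))

-- Euler approximation of the exponential

∣p∣≤r : ∀ {p r} → - r ≤ℚ p → p ≤ℚ r → ∣ p ∣ ≤ℚ r
∣p∣≤r {p} {r} -r≤p p≤r with ℚP.∣p∣≡p∨∣p∣≡-p p
... | inj₁ eq = subst (_≤ℚ r) (sym eq) p≤r
... | inj₂ eq = subst₂ _≤ℚ_ (sym eq) (solve 1 (λ r → :- (:- r) := r) refl r) (ℚP.neg-antimono-≤ -r≤p)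

_≼_ : ∀ {n} → Field n → ℚ → Set
f ≼ r = ∀ S → ∣ f S ∣ ≤ℚ r

infix 4 _≼_

≼-+ : ∀ {n} {f g : Field n} {p q} → f ≼ p → g ≼ q → (λ S → f S + g S) ≼ p + q
≼-+ {f = f} {g} hf hg S = ℚP.≤-trans (ℚP.∣p+q∣≤∣p∣+∣q∣ (f S) (g S)) (ℚP.+-mono-≤ (hf S) (hg S))

≼-* : ∀ {n} {f : Field n} {r} p → 0ℚ ≤ℚ p → f ≼ r → (λ S → p * f S) ≼ p * r
≼-* {f = f} {r} p 0≤p hf S = subst (_≤ℚ p * r)
  (sym (trans (ℚP.∣p*q∣≡∣p∣*∣q∣ p (f S)) (cong (_* ∣ f S ∣) (ℚP.0≤p⇒∣p∣≡p 0≤p)))) (*-monoˡ 0≤p (hf S))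

≼-nonNeg : ∀ {n} {f : Field n} {r} → f ≼ r → 0ℚ ≤ℚ r
≼-nonNeg {f = f} hf = ℚP.≤-trans (ℚP.0≤∣p∣ (f ⊥)) (hf ⊥)

≼-cong : ∀ {n} {f g : Field n} {p q} → f ≗ g → p ≡ q → f ≼ p → g ≼ q
≼-cong e refl hf S = subst (λ v → ∣ v ∣ ≤ℚ _) (e S) (hf S)

≼-mono : ∀ {n} {f : Field n} {p q} → p ≤ℚ q → f ≼ p → f ≼ q
≼-mono p≤q hf S = ℚP.≤-trans (hf S) p≤q

module Hamiltonian {n : ℕ} (ϑ : ℚ) (-1≤ϑ : - 1ℚ ≤ℚ ϑ) (ϑ≤1 : ϑ ≤ℚ 1ℚ)
                   (w : Subset n → ℚ) (0≤w : ∀ e → 0ℚ ≤ℚ w e) where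

  exchange : Subset n → Field n → Field n
  exchange e f S = if ∣ S ∩ e ∣ˢ ≡ᵇ 1 then f (S ⊕ e) + ϑ * f S else 0ℚ

  ham : List (Subset n) → Field n → Field n
  ham es f S = foldr (λ e r → w e * exchange e f S + r) 0ℚ es

  step : ℚ → Subset n → Field n → Field n
  step s e f S = f S + s * (w e * exchange e f S)

  sweep : ℚ → List (Subset n) → Field n → Field n
  sweep s es f = foldr (step s) f es

  exchange-cong : ∀ e {f g} → f ≗ g → exchange e f ≗ exchange e g
  exchange-cong e f≗g S with ∣ S ∩ e ∣ˢ ≡ᵇ 1
  ... | true  = cong₂ (λ a b → a + ϑ * b) (f≗g (S ⊕ e)) (f≗g S)
  ... | false = refl

  exchange-linear : ∀ e p f g S → exchange e (λ T → f T + p * g T) S ≡ exchange e f S + p * exchange e g S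
  exchange-linear e p f g S with ∣ S ∩ e ∣ˢ ≡ᵇ 1
  ... | true  = solve 6 (λ p t a b c d → a :+ p :* b :+ t :* (c :+ p :* d) := a :+ t :* c :+ p :* (b :+ t :* d)) refl
                  p ϑ (f (S ⊕ e)) (g (S ⊕ e)) (f S) (g S)
  ... | false = solve 1 (λ p → con 0ℚ := con 0ℚ :+ p :* con 0ℚ) refl p

  exchange-≼ : ∀ e {f r} → f ≼ r → exchange e f ≼ r + r
  exchange-≼ e {f} {r} hf S with ∣ S ∩ e ∣ˢ ≡ᵇ 1
  ... | true  = begin
      ∣ f (S ⊕ e) + ϑ * f S ∣       ≤⟨ ℚP.∣p+q∣≤∣p∣+∣q∣ (f (S ⊕ e)) (ϑ * f S) ⟩
      ∣ f (S ⊕ e) ∣ + ∣ ϑ * f S ∣   ≡⟨ cong (∣ f (S ⊕ e) ∣ +_) (ℚP.∣p*q∣≡∣p∣*∣q∣ ϑ (f S)) ⟩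
      ∣ f (S ⊕ e) ∣ + ∣ ϑ ∣ * ∣ f S ∣  ≤⟨ ℚP.+-mono-≤ (hf (S ⊕ e))
        (*-mono-≤-nonNeg (ℚP.0≤∣p∣ ϑ) (≼-nonNeg hf) (∣p∣≤r -1≤ϑ ϑ≤1) (hf S)) ⟩
      r + 1ℚ * r                    ≡⟨ cong (r +_) (ℚP.*-identityˡ r) ⟩
      r + r                         ∎
    where open ℚP.≤-Reasoning
  ... | false = +-nonNeg (≼-nonNeg hf) (≼-nonNeg hf)

  ham-cong : ∀ es {f g} → f ≗ g → ham es f ≗ ham es g
  ham-cong []       f≗g S = refl
  ham-cong (e ∷ es) f≗g S = cong₂ (λ a b → w e * a + b) (exchange-cong e f≗g S) (ham-cong es f≗g S)

  ham-linear : ∀ es p f g S → ham es (λ T → f T + p * g T) S ≡ ham es f S + p * ham es g S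
  ham-linear []       p f g S = solve 1 (λ p → con 0ℚ := con 0ℚ :+ p :* con 0ℚ) refl p
  ham-linear (e ∷ es) p f g S = trans
    (cong₂ (λ a b → w e * a + b) (exchange-linear e p f g S) (ham-linear es p f g S))
    (solve 6 (λ w p a b c d → w :* (a :+ p :* b) :+ (c :+ p :* d) := (w :* a :+ c) :+ p :* (w :* b :+ d)) refl
      (w e) p (exchange e f S) (exchange e g S) (ham es f S) (ham es g S))

  ham-0 : ∀ es S → ham es (λ _ → 0ℚ) S ≡ 0ℚ
  ham-0 []       S = refl
  ham-0 (e ∷ es) S = trans (cong₂ (λ a b → w e * a + b) exchange-0 (ham-0 es S))
    (solve 1 (λ w → w :* con 0ℚ :+ con 0ℚ := con 0ℚ) refl (w e))
    where
    exchange-0 : exchange e (λ _ → 0ℚ) S ≡ 0ℚ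
    exchange-0 with ∣ S ∩ e ∣ˢ ≡ᵇ 1
    ... | true  = solve 1 (λ t → con 0ℚ :+ t :* con 0ℚ := con 0ℚ) refl ϑ
    ... | false = refl

  ham-sumTo : ∀ es M (q : ℕ → ℚ) (f : ℕ → Field n) S →
              ham es (λ T → sumTo M (λ m → q m * f m T)) S ≡ sumTo M (λ m → q m * ham es (f m) S)
  ham-sumTo es zero    q f S = ham-0 es S
  ham-sumTo es (suc M) q f S = trans (ham-linear es (q M) (λ T → sumTo M (λ m → q m * f m T)) (f M) S)
    (cong (_+ q M * ham es (f M) S) (ham-sumTo es M q f S))

  -- `exchange` has sup norm at most 2 because `ϑ` lies between -1 and 1, so twice the total weight
  -- bounds `ham`.
  κ : List (Subset n) → ℚ
  κ = foldr (λ e r → (w e + w e) + r) 0ℚ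

  κ-nonNeg : ∀ es → 0ℚ ≤ℚ κ es
  κ-nonNeg []       = ℚP.≤-refl
  κ-nonNeg (e ∷ es) = +-nonNeg (+-nonNeg (0≤w e) (0≤w e)) (κ-nonNeg es)

  ham-≼ : ∀ es {f r} → f ≼ r → ham es f ≼ κ es * r
  ham-≼ []       {r = r} hf S = ℚP.≤-reflexive (sym (ℚP.*-zeroˡ r))
  ham-≼ (e ∷ es) {f} {r} hf = ≼-cong (λ _ → refl)
    (solve 3 (λ w r k → w :* (r :+ r) :+ k :* r := ((w :+ w) :+ k) :* r) refl (w e) r (κ es))
    (≼-+ {f = λ S → w e * exchange e f S} (≼-* (w e) (0≤w e) (exchange-≼ e hf)) (ham-≼ es hf))

  module Sweep (s : ℚ) (0≤s : 0ℚ ≤ℚ s) where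

    -- The norm of a sweep when every exchange is replaced by its norm.
    π : List (Subset n) → ℚ
    π = foldr (λ e r → r + s * (w e * (r + r))) 1ℚ

    perturbation-≼ : ∀ e {f r} → f ≼ r → (λ S → s * (w e * exchange e f S)) ≼ s * (w e * (r + r))
    perturbation-≼ e {f} hf = ≼-* {f = λ S → w e * exchange e f S} s 0≤s (≼-* (w e) (0≤w e) (exchange-≼ e hf))

    sweep-≼ : ∀ es {f r} → f ≼ r → sweep s es f ≼ π es * r
    sweep-≼ []       {r = r} hf = ≼-mono (ℚP.≤-reflexive (sym (ℚP.*-identityˡ r))) hf
    sweep-≼ (e ∷ es) {f} {r} hf = ≼-cong (λ _ → refl)
      (solve 4 (λ p r s w → p :* r :+ s :* (w :* (p :* r :+ p :* r)) := (p :+ s :* (w :* (p :+ p))) :* r) refl (π es) r s (w e))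
      (≼-+ {f = sweep s es f} (sweep-≼ es hf) (perturbation-≼ e (sweep-≼ es hf)))

    sweep-first-order : ∀ es {f r} → f ≼ r → (λ S → sweep s es f S - f S) ≼ (π es - 1ℚ) * r
    sweep-first-order []       {f} {r} hf S = ℚP.≤-reflexive (trans (cong ∣_∣ (p-p≡0 (f S)))
      (solve 1 (λ r → con 0ℚ := (con 1ℚ :- con 1ℚ) :* r) refl r))
    sweep-first-order (e ∷ es) {f} {r} hf = ≼-cong
      (λ S → solve 3 (λ a b d → (a :- b) :+ d := (a :+ d) :- b) refl (sweep s es f S) (f S) (s * (w e * exchange e (sweep s es f) S)))
      (solve 4 (λ p r s w → (p :- con 1ℚ) :* r :+ s :* (w :* (p :* r :+ p :* r))
                         := (p :+ s :* (w :* (p :+ p)) :- con 1ℚ) :* r) refl (π es) r s (w e))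
      (≼-+ {f = λ S → sweep s es f S - f S} (sweep-first-order es hf) (perturbation-≼ e (sweep-≼ es hf)))

    -- Expanded, a sweep minus its terms of order at most one in `s` is a sum of products of
    -- exchanges. Replacing each exchange by its norm turns the same expression into `π - 1 - sκ`,
    -- and the induction runs the two computations in parallel.
    sweep-second-order : ∀ es {f r} → f ≼ r →
      (λ S → sweep s es f S - (f S + s * ham es f S)) ≼ (π es - 1ℚ - s * κ es) * r
    sweep-second-order []       {f} {r} hf S = ℚP.≤-reflexive (trans
      (cong ∣_∣ (solve 2 (λ a s → a :- (a :+ s :* con 0ℚ) := con 0ℚ) refl (f S) s))
      (solve 2 (λ s r → con 0ℚ := (con 1ℚ :- con 1ℚ :- s :* con 0ℚ) :* r) refl s r))
    sweep-second-order (e ∷ es) {f} {r} hf = ≼-cong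
      (λ S → trans
        (cong (λ v → (sweep s es f S - (f S + s * ham es f S)) + s * (w e * v)) (exchange-diff S))
        (solve 7 (λ a b s h w x y → (a :- (b :+ s :* h)) :+ s :* (w :* (x :+ (:- con 1ℚ) :* y))
            := (a :+ s :* (w :* x)) :- (b :+ s :* (w :* y :+ h))) refl
          (sweep s es f S) (f S) s (ham es f S) (w e) (exchange e (sweep s es f) S) (exchange e f S)))
      (solve 5 (λ p r s w k → (p :- con 1ℚ :- s :* k) :* r :+ s :* (w :* ((p :- con 1ℚ) :* r :+ (p :- con 1ℚ) :* r))
          := (p :+ s :* (w :* (p :+ p)) :- con 1ℚ :- s :* ((w :+ w) :+ k)) :* r) refl (π es) r s (w e) (κ es))
      (≼-+ {f = λ S → sweep s es f S - (f S + s * ham es f S)} (sweep-second-order es hf)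
        (perturbation-≼ e (sweep-first-order es hf)))
      where
      exchange-diff : ∀ S → exchange e (λ T → sweep s es f T - f T) S
                            ≡ exchange e (sweep s es f) S + (- 1ℚ) * exchange e f S
      exchange-diff S = trans
        (exchange-cong e (λ T → solve 2 (λ a b → a :- b := a :+ (:- con 1ℚ) :* b) refl (sweep s es f T) (f T)) S)
        (exchange-linear e (- 1ℚ) (sweep s es f) f S)

    π-nonNeg : ∀ es → 0ℚ ≤ℚ π es
    π-nonNeg []       = ℚP.nonNegative⁻¹ 1ℚ
    π-nonNeg (e ∷ es) = +-nonNeg (π-nonNeg es)
      (*-nonNeg 0≤s (*-nonNeg (0≤w e) (+-nonNeg (π-nonNeg es) (π-nonNeg es))))

    -- `π` is the product of the factors `1 + a` with `a = 2 s w_e`, and `sκ` is the sum of these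
    -- `a`. While `sκ ≤ 1`, the bound passes from `y` to `a + y` with slack `ay(1 - y) + a²`. It
    -- makes the remainder of one sweep quadratic in `s`.
    π-bound : ∀ es → s * κ es ≤ℚ 1ℚ → π es ≤ℚ 1ℚ + s * κ es + (s * κ es) * (s * κ es)
    π-bound []       h = ℚP.≤-reflexive
      (solve 1 (λ s → con 1ℚ := con 1ℚ :+ s :* con 0ℚ :+ (s :* con 0ℚ) :* (s :* con 0ℚ)) refl s)
    π-bound (e ∷ es) h = begin
      π es + s * (w e * (π es + π es))
        ≡⟨ solve 3 (λ p s w → p :+ s :* (w :* (p :+ p)) := (con 1ℚ :+ s :* (w :+ w)) :* p) refl (π es) s (w e) ⟩
      (1ℚ + a) * π es
        ≤⟨ *-monoˡ (+-nonNeg (ℚP.nonNegative⁻¹ 1ℚ) 0≤a) (π-bound es y≤1) ⟩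
      (1ℚ + a) * (1ℚ + y + y * y)
        ≤⟨ ≤-by-diff {(1ℚ + a) * (1ℚ + y + y * y)} (a * (y * (1ℚ - y)) + a * a)
             (+-nonNeg (*-nonNeg 0≤a (*-nonNeg 0≤y (diff-nonNeg y≤1))) (square-nonNeg a))
             (solve 2 (λ a y → con 1ℚ :+ (a :+ y) :+ (a :+ y) :* (a :+ y)
                 := (con 1ℚ :+ a) :* (con 1ℚ :+ y :+ y :* y) :+ (a :* (y :* (con 1ℚ :- y)) :+ a :* a)) refl a y) ⟩
      1ℚ + (a + y) + (a + y) * (a + y)
        ≡⟨ cong (λ x → 1ℚ + x + x * x) a+y ⟩
      1ℚ + x + x * x ∎
      where
      open ℚP.≤-Reasoning
      a y x : ℚ
      a = s * (w e + w e)
      y = s * κ es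
      x = s * κ (e ∷ es)
      a+y : a + y ≡ x
      a+y = sym (ℚP.*-distribˡ-+ s (w e + w e) (κ es))
      0≤a : 0ℚ ≤ℚ a
      0≤a = *-nonNeg 0≤s (+-nonNeg (0≤w e) (0≤w e))
      0≤y : 0ℚ ≤ℚ y
      0≤y = *-nonNeg 0≤s (κ-nonNeg es)
      y≤1 : y ≤ℚ 1ℚ
      y≤1 = ℚP.≤-trans (≤-by-diff {y} a 0≤a (trans (sym a+y) (ℚP.+-comm a y))) h

∣p-r∣≤ : ∀ p q r {a b} → ∣ p - q ∣ ≤ℚ a → ∣ q - r ∣ ≤ℚ b → ∣ p - r ∣ ≤ℚ a + b
∣p-r∣≤ p q r h k = ℚP.≤-trans (triangle p q r) (ℚP.+-mono-≤ h k)

-- Comparison of the Euler products with the exponential series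

expSeries : ℚ → ℕ → ℚ
expSeries c M = sumTo M (λ m → 1/! m * c ^ m)

-- The partial sums increase, and past the Cauchy index for tolerance 1 they grow by at most 1.
expSeries-bounded : ∀ {c} → 0ℚ ≤ℚ c → ∃ λ B → ∀ M → expSeries c M ≤ℚ B
expSeries-bounded {c} 0≤c = 1ℚ + U N , λ M → subst (_≤ℚ 1ℚ + U N) (U≡ M) (bounded M (ℕP.≤-total N M))
  where
  open Majorant c 0≤c
  N : ℕ
  N = proj₁ (U-cauchy (ℚP.positive⁻¹ 1ℚ))
  power≡ : ∀ m → power m ≡ c ^ m
  power≡ zero    = refl
  power≡ (suc m) = cong (c *_) (power≡ m)
  U≡ : ∀ M → U M ≡ expSeries c M
  U≡ zero    = refl
  U≡ (suc M) = cong₂ (λ a p → a + 1/! M * p) (U≡ M) (power≡ M)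
  U-mono : ∀ {M M′} → M ℕ.≤′ M′ → U M ≤ℚ U M′
  U-mono ℕ.≤′-refl                = ℚP.≤-refl
  U-mono {M} (ℕ.≤′-step {M′} h) = ℚP.≤-trans (U-mono h) (≤-by-diff {U M′} (u M′) (u-nonNeg M′) refl)
  bounded : ∀ M → N ℕ.≤ M ⊎ M ℕ.≤ N → U M ≤ℚ 1ℚ + U N
  bounded M (inj₂ M≤N) = ℚP.≤-trans (U-mono (ℕP.≤⇒≤′ M≤N)) (p≤1+p (U N))
  bounded M (inj₁ N≤M) = subst (_≤ℚ 1ℚ + U N) (solve 2 (λ a b → (a :- b) :+ b := a) refl (U M) (U N))
    (ℚP.+-monoˡ-≤ (U N) (proj₂ (U-cauchy (ℚP.positive⁻¹ 1ℚ)) ℕP.≤-refl N≤M))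

module Euler {n : ℕ} (ϑ : ℚ) (-1≤ϑ : - 1ℚ ≤ℚ ϑ) (ϑ≤1 : ϑ ≤ℚ 1ℚ)
             (w : Subset n → ℚ) (0≤w : ∀ e → 0ℚ ≤ℚ w e) (es : List (Subset n)) where

  open Hamiltonian ϑ -1≤ϑ ϑ≤1 w 0≤w public

  hamPower : ℕ → Field n
  hamPower zero    = one
  hamPower (suc m) = ham es (hamPower m)

  expTruncated : ℕ → Field n
  expTruncated M S = sumTo M (λ m → 1/! m * hamPower m S)

  euler : ℚ → ℕ → Field n
  euler s zero    = one
  euler s (suc j) = sweep s es (euler s j)

  module _ {X : ℚ} (κ≤X : κ es ≤ℚ X) {s : ℚ} {N K : ℕ} (0≤s : 0ℚ ≤ℚ s) (Ns≡1 : fromℕ N * s ≡ 1ℚ)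
           (sX≤1 : s * X ≤ℚ 1ℚ) (sX²≤½ : s * (X * X) ≤ℚ ½) (X≤K/2 : X ≤ℚ fromℕ K * ½) where

    open Sweep s 0≤s
    open Binomial N s 0≤s Ns≡1

    private
      0≤X : 0ℚ ≤ℚ X
      0≤X = ℚP.≤-trans (κ-nonNeg es) κ≤X
      x ρ σ : ℚ
      x = s * X
      ρ = 1ℚ + x + x * x
      σ = 1ℚ + x
      0≤x : 0ℚ ≤ℚ x
      0≤x = *-nonNeg 0≤s 0≤X
      sκ≤x : s * κ es ≤ℚ x
      sκ≤x = *-monoˡ 0≤s κ≤X
      0≤sκ : 0ℚ ≤ℚ s * κ es
      0≤sκ = *-nonNeg 0≤s (κ-nonNeg es)
      [sκ]²≤x² : (s * κ es) * (s * κ es) ≤ℚ x * x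
      [sκ]²≤x² = *-mono-≤-nonNeg 0≤sκ 0≤x sκ≤x sκ≤x
      0≤σ : 0ℚ ≤ℚ σ
      0≤σ = +-nonNeg (ℚP.nonNegative⁻¹ 1ℚ) 0≤x
      0≤ρ : 0ℚ ≤ℚ ρ
      0≤ρ = +-nonNeg 0≤σ (square-nonNeg x)
      π≤ : π es ≤ℚ 1ℚ + s * κ es + (s * κ es) * (s * κ es)
      π≤ = π-bound es (ℚP.≤-trans sκ≤x sX≤1)
      π≤ρ : π es ≤ℚ ρ
      π≤ρ = ℚP.≤-trans π≤ (ℚP.+-mono-≤ (ℚP.+-monoʳ-≤ 1ℚ sκ≤x) [sκ]²≤x²)
      π-1-sκ≤x² : π es - 1ℚ - s * κ es ≤ℚ x * x
      π-1-sκ≤x² = ℚP.≤-trans (subst (π es - 1ℚ - s * κ es ≤ℚ_)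
        (solve 2 (λ a b → con 1ℚ :+ a :+ b :- con 1ℚ :- a := b) refl (s * κ es) ((s * κ es) * (s * κ es)))
        (ℚP.+-monoˡ-≤ (- (s * κ es)) (ℚP.+-monoˡ-≤ (- 1ℚ) π≤))) [sκ]²≤x²

    -- This is `(1 + sH)^j` applied to the constant field, without splitting `H` into edges. It
    -- separates the error of the splitting from the error of the series.
    linear : ℕ → Field n
    linear zero    = one
    linear (suc j) S = linear j S + s * ham es (linear j) S

    one-≼ : one {n} ≼ 1ℚ
    one-≼ S = ℚP.≤-refl

    hamPower-≼ : ∀ m → hamPower m ≼ X ^ m
    hamPower-≼ zero    = one-≼
    hamPower-≼ (suc m) = ≼-mono (*-monoʳ (^-nonNeg 0≤X m) κ≤X) (ham-≼ es (hamPower-≼ m))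

    euler-≼ : ∀ j → euler s j ≼ ρ ^ j
    euler-≼ zero    = one-≼
    euler-≼ (suc j) = ≼-mono (*-monoʳ (^-nonNeg 0≤ρ j) π≤ρ) (sweep-≼ es (euler-≼ j))

    -- With `f` the split and `g` the unsplit iterate, the new difference is the remainder of one
    -- sweep at `f` plus `1 + sH` applied to `f - g`. In norms this is `x²ρ^j + σ(ρ^j - σ^j)`, which
    -- equals `ρ^(j+1) - σ^(j+1)` because `ρ = σ + x²`.
    euler-linear : ∀ j → (λ S → euler s j S - linear j S) ≼ ρ ^ j - σ ^ j
    euler-linear zero    S = ℚP.≤-refl
    euler-linear (suc j) = ≼-cong
      (λ S → trans
        (cong (λ v → (sweep s es f S - (f S + s * ham es f S)) + ((f S - g S) + s * v)) (trans
          (ham-cong es (λ T → solve 2 (λ a b → a :- b := a :+ (:- con 1ℚ) :* b) refl (f T) (g T)) S)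
          (ham-linear es (- 1ℚ) f g S)))
        (solve 6 (λ a f s h g k → (a :- (f :+ s :* h)) :+ ((f :- g) :+ s :* (h :+ (:- con 1ℚ) :* k))
            := a :- (g :+ s :* k)) refl (sweep s es f S) (f S) s (ham es f S) (g S) (ham es g S)))
      (solve 3 (λ x r t → x :* x :* r :+ (con 1ℚ :* (r :- t) :+ x :* (r :- t)) := (con 1ℚ :+ x :+ x :* x) :* r :- (con 1ℚ :+ x) :* t)
        refl x (ρ ^ j) (σ ^ j))
      (≼-+ {f = λ S → sweep s es f S - (f S + s * ham es f S)}
        (≼-mono (*-monoʳ (^-nonNeg 0≤ρ j) π-1-sκ≤x²) (sweep-second-order es (euler-≼ j)))
        (≼-+ {f = λ S → f S - g S}
          (≼-mono (ℚP.≤-reflexive (sym (ℚP.*-identityˡ (ρ ^ j - σ ^ j)))) (euler-linear j))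
          (≼-mono {p = s * (κ es * (ρ ^ j - σ ^ j))} (subst (_≤ℚ x * (ρ ^ j - σ ^ j)) (ℚP.*-assoc s (κ es) (ρ ^ j - σ ^ j))
              (*-monoʳ (≼-nonNeg (euler-linear j)) sκ≤x))
            (≼-* s 0≤s (ham-≼ es (euler-linear j))))))
      where
      f g : Field n
      f = euler s j
      g = linear j

    -- From `ρ ≤ σ(1 + x²)` the difference is at most `σ^N` times `(1 + x²)^N - 1`. Since
    -- `N x² = s X²`, the second factor is of order `s`, while `σ^N` stays below `2^K`, a bound free
    -- of `N`.
    ρ-σ-bound : ρ ^ N - σ ^ N ≤ℚ s * (fromℕ 2 ^ K * (fromℕ 2 * (X * X)))
    ρ-σ-bound = begin
      ρ ^ N - σ ^ N
        ≤⟨ ℚP.+-monoˡ-≤ (- σ ^ N) (^-mono 0≤ρ (≤-by-diff {ρ} (x * y) (*-nonNeg 0≤x (square-nonNeg x))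
             (solve 1 (λ x → (con 1ℚ :+ x) :* (con 1ℚ :+ x :* x) := con 1ℚ :+ x :+ x :* x :+ x :* (x :* x)) refl x)) N) ⟩
      (σ * (1ℚ + y)) ^ N - σ ^ N
        ≡⟨ cong (_- σ ^ N) (^-distrib-* σ (1ℚ + y) N) ⟩
      σ ^ N * (1ℚ + y) ^ N - σ ^ N
        ≤⟨ ℚP.+-monoˡ-≤ (- σ ^ N) (*-monoˡ (^-nonNeg 0≤σ N)
             (^-≤-1+2jy (square-nonNeg x) N (subst (_≤ℚ ½) (sym Ny≡) sX²≤½))) ⟩
      σ ^ N * (1ℚ + fromℕ 2 * (fromℕ N * y)) - σ ^ N
        ≡⟨ cong (λ v → σ ^ N * (1ℚ + fromℕ 2 * v) - σ ^ N) Ny≡ ⟩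
      σ ^ N * (1ℚ + fromℕ 2 * (s * (X * X))) - σ ^ N
        ≡⟨ solve 4 (λ p t s z → p :* (con 1ℚ :+ t :* (s :* z)) :- p := p :* (s :* (t :* z))) refl (σ ^ N) (fromℕ 2) s (X * X) ⟩
      σ ^ N * (s * (fromℕ 2 * (X * X)))
        ≤⟨ *-monoʳ (*-nonNeg 0≤s (*-nonNeg (fromℕ-nonNeg 2) (square-nonNeg X)))
             (^-bounded N K 0≤x 0≤s Ns≡1 (subst (x ≤ℚ_)
               (solve 3 (λ s k h → s :* (k :* h) := k :* (h :* s)) refl s (fromℕ K) ½) (*-monoˡ 0≤s X≤K/2))) ⟩
      fromℕ 2 ^ K * (s * (fromℕ 2 * (X * X)))
        ≡⟨ solve 3 (λ p s z → p :* (s :* z) := s :* (p :* z)) refl (fromℕ 2 ^ K) s (fromℕ 2 * (X * X)) ⟩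
      s * (fromℕ 2 ^ K * (fromℕ 2 * (X * X))) ∎
      where
      open ℚP.≤-Reasoning
      y : ℚ
      y = x * x
      Ny≡ : fromℕ N * y ≡ s * (X * X)
      Ny≡ = trans (solve 3 (λ n s z → n :* (s :* z :* (s :* z)) := (n :* s) :* (s :* (z :* z))) refl (fromℕ N) s X)
        (trans (cong (_* (s * (X * X))) Ns≡1) (ℚP.*-identityˡ _))

    -- The binomial theorem, padded with vanishing coefficients up to `M`, so that it can be
    -- compared termwise with a longer truncation of the exponential.
    linear-binomial : ∀ j M S → j ℕ.≤ M → linear j S ≡ sumTo (suc M) (λ m → coefficient j m * hamPower m S)
    linear-binomial zero    zero    S _ = refl
    linear-binomial zero    (suc M) S _ = sym (trans
      (cong₂ _+_ (sym (linear-binomial zero M S ℕ.z≤n))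
        (solve 2 (λ p h → con 0ℚ :* p :* h := con 0ℚ) refl (s ^ suc M) (hamPower (suc M) S)))
      (ℚP.+-identityʳ 1ℚ))
    linear-binomial (suc j) M S j<M = begin
      linear j S + s * ham es (linear j) S
        ≡⟨ cong₂ (λ a b → a + s * b) (linear-binomial j M S j≤M)
             (trans (ham-cong es (λ T → linear-binomial j M T j≤M) S) (ham-sumTo es (suc M) (coefficient j) hamPower S)) ⟩
      sumTo (suc M) (λ m → coefficient j m * u m) + s * sumTo (suc M) (λ m → coefficient j m * u (suc m))
        ≡⟨ binomial-step j M u ⟩
      sumTo (suc M) (λ m → coefficient (suc j) m * u m) + s * (coefficient j M * u (suc M))
        ≡⟨ cong (sumTo (suc M) (λ m → coefficient (suc j) m * u m) +_) (trans
             (cong (λ c → s * (fromℕ c * s ^ M * u (suc M))) (k>n⇒nCk≡0 j<M))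
             (solve 3 (λ s p h → s :* (con 0ℚ :* p :* h) := con 0ℚ) refl s (s ^ M) (u (suc M)))) ⟩
      sumTo (suc M) (λ m → coefficient (suc j) m * u m) + 0ℚ
        ≡⟨ ℚP.+-identityʳ _ ⟩
      sumTo (suc M) (λ m → coefficient (suc j) m * u m) ∎
      where
      open ≡-Reasoning
      u : ℕ → ℚ
      u m = hamPower m S
      j≤M : j ℕ.≤ M
      j≤M = ℕP.<⇒≤ j<M

    exp-linear : ∀ {B} → (∀ M → expSeries (X + X) M ≤ℚ B) → ∀ M → N ℕ.≤ M →
                 ∀ S → ∣ expTruncated (suc M) S - linear N S ∣ ≤ℚ s * B
    exp-linear {B} hB M N≤M S = begin
      ∣ expTruncated (suc M) S - linear N S ∣
        ≡⟨ cong (λ v → ∣ expTruncated (suc M) S - v ∣) (linear-binomial N M S N≤M) ⟩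
      ∣ expTruncated (suc M) S - sumTo (suc M) (λ m → coefficient N m * hamPower m S) ∣
        ≤⟨ sumTo-dominated (suc M) term ⟩
      sumTo (suc M) (λ m → s * (1/! m * (X + X) ^ m))
        ≡⟨ sumTo-*ˡ (suc M) s (λ m → 1/! m * (X + X) ^ m) ⟩
      s * expSeries (X + X) (suc M)
        ≤⟨ *-monoˡ 0≤s (hB (suc M)) ⟩
      s * B ∎
      where
      open ℚP.≤-Reasoning
      term : ∀ m → ∣ 1/! m * hamPower m S - coefficient N m * hamPower m S ∣ ≤ℚ s * (1/! m * (X + X) ^ m)
      term m = begin
        ∣ 1/! m * h - c * h ∣
          ≡⟨ cong ∣_∣ (solve 3 (λ a c h → a :* h :- c :* h := (a :- c) :* h) refl (1/! m) c h) ⟩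
        ∣ (1/! m - c) * h ∣
          ≡⟨ trans (ℚP.∣p*q∣≡∣p∣*∣q∣ (1/! m - c) h)
               (cong (_* ∣ h ∣) (ℚP.0≤p⇒∣p∣≡p (diff-nonNeg (coefficient-upper m)))) ⟩
        (1/! m - c) * ∣ h ∣
          ≤⟨ *-mono-≤-nonNeg (diff-nonNeg (coefficient-upper m)) (^-nonNeg 0≤X m) (coefficient-lower m) (hamPower-≼ m S) ⟩
        s * (fromℕ 2 ^ m * 1/! m) * X ^ m
          ≡⟨ solve 4 (λ s t a p → s :* (t :* a) :* p := s :* (a :* (t :* p))) refl s (fromℕ 2 ^ m) (1/! m) (X ^ m) ⟩
        s * (1/! m * (fromℕ 2 ^ m * X ^ m))
          ≡⟨ cong (λ p → s * (1/! m * p)) (trans (sym (^-distrib-* (fromℕ 2) X m))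
               (cong (_^ m) (solve 1 (λ a → (con 1ℚ :+ con 1ℚ) :* a := a :+ a) refl X))) ⟩
        s * (1/! m * (X + X) ^ m) ∎
        where
        h c : ℚ
        h = hamPower m S
        c = coefficient N m

    exp-euler : ∀ {B} → (∀ M → expSeries (X + X) M ≤ℚ B) → ∀ M → N ℕ.≤ M →
                ∀ S → ∣ expTruncated (suc M) S - euler s N S ∣ ≤ℚ s * (B + fromℕ 2 ^ K * (fromℕ 2 * (X * X)))
    exp-euler {B} hB M N≤M S = subst (∣ expTruncated (suc M) S - euler s N S ∣ ≤ℚ_)
      (sym (ℚP.*-distribˡ-+ s B _))
      (∣p-r∣≤ (expTruncated (suc M) S) (linear N S) (euler s N S)
        (exp-linear hB M N≤M S)
        (subst (_≤ℚ _) (∣p-q∣≡∣q-p∣ (euler s N S) (linear N S)) (ℚP.≤-trans (euler-linear N S) ρ-σ-bound)))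


-- Here `p + q = 1 + a(ϑ + 1)` and `p - q = 1 - y` with `y = a(1 - ϑ)`, so the two ends of the range
-- of `ϑ` give the two conditions. The bound `a ≤ ½` yields `p > 0` and `y ≤ 2`, and then
-- `1 - (1 - y)² = y(2 - y)` is nonnegative.
hop-admissible : ∀ {a ϑ} → 0ℚ ≤ℚ a → a ≤ℚ ½ → - 1ℚ ≤ℚ ϑ → ϑ ≤ℚ 1ℚ → Admissible (1ℚ + a * ϑ) a
hop-admissible {a} {ϑ} 0≤a a≤½ -1≤ϑ ϑ≤1 = record
  { p-pos    = subst (0ℚ <ℚ_) (solve 2 (λ a t → con ½ :+ ((con ½ :- a) :+ a :* (t :- (:- con 1ℚ))) := con 1ℚ :+ a :* t) refl a ϑ)
      (+-pos-nonNeg (ℚP.positive⁻¹ ½) (+-nonNeg (diff-nonNeg a≤½) 0≤z))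
  ; q-nonNeg = 0≤a
  ; sum≥1    = ≤-by-diff {1ℚ} (z + z + z * z) (+-nonNeg (+-nonNeg 0≤z 0≤z) (square-nonNeg z))
      (solve 2 (λ a t → (con 1ℚ :+ a :* t :+ a) :* (con 1ℚ :+ a :* t :+ a) :=
        let z = a :* (t :- (:- con 1ℚ)) in con 1ℚ :+ (z :+ z :+ z :* z)) refl a ϑ)
  ; diff≤1   = ≤-by-diff {(1ℚ + a * ϑ - a) * (1ℚ + a * ϑ - a)} (y * ((1ℚ - ϑ) * (½ - a) + (1ℚ + ½ * (ϑ - - 1ℚ))))
      (*-nonNeg 0≤y (+-nonNeg (*-nonNeg (diff-nonNeg ϑ≤1) (diff-nonNeg a≤½))
        (+-nonNeg (ℚP.nonNegative⁻¹ 1ℚ) (*-nonNeg (ℚP.nonNegative⁻¹ ½) (diff-nonNeg -1≤ϑ)))))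
      (solve 2 (λ a t → con 1ℚ := (con 1ℚ :+ a :* t :- a) :* (con 1ℚ :+ a :* t :- a)
        :+ a :* (con 1ℚ :- t) :* ((con 1ℚ :- t) :* (con ½ :- a) :+ (con 1ℚ :+ con ½ :* (t :- (:- con 1ℚ))))) refl a ϑ)
  }
  where
  y z : ℚ
  y = a * (1ℚ - ϑ)
  z = a * (ϑ - - 1ℚ)
  0≤z : 0ℚ ≤ℚ z
  0≤z = *-nonNeg 0≤a (diff-nonNeg -1≤ϑ)
  0≤y : 0ℚ ≤ℚ y
  0≤y = *-nonNeg 0≤a (diff-nonNeg ϑ≤1)

-- Euler products are positive and Lorentzian

PositiveLorentz : ∀ {n} → Field n → Set
PositiveLorentz c = (∀ S → 0ℚ <ℚ c S) × Lorentz 0 c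

module _ {n : ℕ} (ϑ : ℚ) (-1≤ϑ : - 1ℚ ≤ℚ ϑ) (ϑ≤1 : ϑ ≤ℚ 1ℚ)
         (w : Subset n → ℚ) (0≤w : ∀ e → 0ℚ ≤ℚ w e) where

  open Hamiltonian ϑ -1≤ϑ ϑ≤1 w 0≤w

  hop≗step : ∀ s e f → hop (1ℚ + s * w e * ϑ) (s * w e) e f ≗ step s e f
  hop≗step s e f S with ∣ S ∩ e ∣ˢ ≡ᵇ 1
  ... | true  = solve 5 (λ s w t a b → (con 1ℚ :+ s :* w :* t) :* a :+ s :* w :* b := a :+ s :* (w :* (b :+ t :* a))) refl
                  s (w e) ϑ (f S) (f (S ⊕ e))
  ... | false = solve 3 (λ s w a → a := a :+ s :* (w :* con 0ℚ)) refl s (w e) (f S)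

  step-PositiveLorentz : ∀ {s} → 0ℚ ≤ℚ s → ∀ e → ∣ e ∣ˢ ≡ 2 → s * w e ≤ℚ ½ →
                         ∀ {f} → PositiveLorentz f → PositiveLorentz (step s e f)
  step-PositiveLorentz {s} 0≤s e ∣e∣≡2 sw≤½ {f} (pos , L) =
    (λ S → subst (0ℚ <ℚ_) (hop≗step s e f S) (hop-pos adm e pos S)) ,
    Lorentz-cong 0 (hop≗step s e f) (hop-Lorentz adm e ∣e∣≡2 pos L)
    where
    adm : Admissible (1ℚ + s * w e * ϑ) (s * w e)
    adm = hop-admissible (*-nonNeg 0≤s (0≤w e)) sw≤½ -1≤ϑ ϑ≤1

  sweep-PositiveLorentz : ∀ {s} → 0ℚ ≤ℚ s → ∀ {es} → All (λ e → ∣ e ∣ˢ ≡ 2) es → s * κ es ≤ℚ 1ℚ →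
                          ∀ {f} → PositiveLorentz f → PositiveLorentz (sweep s es f)
  sweep-PositiveLorentz {s} 0≤s {[]}     []           h PL = PL
  sweep-PositiveLorentz {s} 0≤s {e ∷ es} (size ∷ sizes) h {f} PL =
    step-PositiveLorentz 0≤s e size sw≤½ {sweep s es f}
      (sweep-PositiveLorentz 0≤s sizes (ℚP.≤-trans (*-monoˡ 0≤s κ≤) h) PL)
    where
    κ≤ : κ es ≤ℚ κ (e ∷ es)
    κ≤ = ≤-by-diff {κ es} (w e + w e) (+-nonNeg (0≤w e) (0≤w e)) (ℚP.+-comm (w e + w e) (κ es))
    -- `κ` counts every weight twice, so `sκ ≤ 1` yields the bound ½ that `hop-admissible` asks for.
    sw≤½ : s * w e ≤ℚ ½
    sw≤½ = ℚP.≤-trans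
      (≤-by-diff {s * w e} (½ * (s * κ es)) (*-nonNeg (ℚP.nonNegative⁻¹ ½) (*-nonNeg 0≤s (κ-nonNeg es)))
        (solve 3 (λ s w k → con ½ :* (s :* ((w :+ w) :+ k)) := s :* w :+ con ½ :* (s :* k)) refl s (w e) (κ es)))
      (*-monoˡ (ℚP.nonNegative⁻¹ ½) h)

  euler-PositiveLorentz : ∀ {s} → 0ℚ ≤ℚ s → ∀ {es} → All (λ e → ∣ e ∣ˢ ≡ 2) es → s * κ es ≤ℚ 1ℚ →
                          ∀ j → PositiveLorentz (Euler.euler ϑ -1≤ϑ ϑ≤1 w 0≤w es s j)
  euler-PositiveLorentz 0≤s sizes h zero    = (λ S → ℚP.positive⁻¹ 1ℚ) , one-Lorentz
  euler-PositiveLorentz 0≤s sizes h (suc j) = sweep-PositiveLorentz 0≤s sizes h (euler-PositiveLorentz 0≤s sizes h j)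

-- N₀ depends on the data only through the bound X.
expTruncated-approximation : ∀ {n} {es : List (Subset n)} → All (λ e → ∣ e ∣ˢ ≡ 2) es →
  ∀ {X} → 0ℚ ≤ℚ X → ∀ {δ} → 0ℚ <ℚ δ → ∃ λ N₀ → ∀ M → N₀ ℕ.≤ M →
  ∀ ϑ -1≤ϑ ϑ≤1 w 0≤w → Hamiltonian.κ ϑ -1≤ϑ ϑ≤1 w 0≤w es ≤ℚ X →
  ∃ λ c → PositiveLorentz c × (∀ S → ∣ Euler.expTruncated ϑ -1≤ϑ ϑ≤1 w 0≤w es M S - c S ∣ ≤ℚ δ)
expTruncated-approximation {n} {es} sizes {X} 0≤X {δ} 0<δ = suc N , approximate
  where
  B K E n₁ n₂ n₃ : _
  B = proj₁ (expSeries-bounded (+-nonNeg 0≤X 0≤X))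
  K = proj₁ (archimedean-* X (ℚP.positive⁻¹ ½))
  E = B + fromℕ 2 ^ K * (fromℕ 2 * (X * X))
  n₁ = archimedean-* X (ℚP.positive⁻¹ 1ℚ)
  n₂ = archimedean-* (X * X) (ℚP.positive⁻¹ ½)
  n₃ = archimedean-* E 0<δ
  N : ℕ
  N = suc (proj₁ n₁ ℕ.+ (proj₁ n₂ ℕ.+ proj₁ n₃))
  s : ℚ
  s = ℤ.+ 1 / N
  Ns≡1 : fromℕ N * s ≡ 1ℚ
  Ns≡1 = *-unit N
  0≤s : 0ℚ ≤ℚ s
  0≤s = unit-nonNeg N
  small : ∀ {q ε} → 0ℚ <ℚ ε → (h : ∃ λ m → q ≤ℚ ε * fromℕ m) → proj₁ h ℕ.≤ N → s * q ≤ℚ ε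
  small {q} {ε} 0<ε (m , h) m≤N = begin
    s * q              ≤⟨ *-monoˡ 0≤s h ⟩
    s * (ε * fromℕ m)  ≤⟨ *-monoˡ 0≤s (*-monoˡ (ℚP.<⇒≤ 0<ε) (fromℕ-mono m≤N)) ⟩
    s * (ε * fromℕ N)  ≡⟨ solve 3 (λ s e n → s :* (e :* n) := e :* (n :* s)) refl s ε (fromℕ N) ⟩
    ε * (fromℕ N * s)  ≡⟨ trans (cong (ε *_) Ns≡1) (ℚP.*-identityʳ ε) ⟩
    ε                  ∎
    where open ℚP.≤-Reasoning
  sX≤1 : s * X ≤ℚ 1ℚ
  sX≤1 = small (ℚP.positive⁻¹ 1ℚ) n₁ (ℕP.m≤n⇒m≤1+n (ℕP.m≤m+n _ _))
  sX²≤½ : s * (X * X) ≤ℚ ½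
  sX²≤½ = small (ℚP.positive⁻¹ ½) n₂ (ℕP.m≤n⇒m≤1+n (ℕP.≤-trans (ℕP.m≤m+n _ _) (ℕP.m≤n+m _ (proj₁ n₁))))
  sE≤δ : s * E ≤ℚ δ
  sE≤δ = small 0<δ n₃ (ℕP.m≤n⇒m≤1+n (ℕP.≤-trans (ℕP.m≤n+m _ (proj₁ n₂)) (ℕP.m≤n+m _ (proj₁ n₁))))
  X≤K/2 : X ≤ℚ fromℕ K * ½
  X≤K/2 = subst (X ≤ℚ_) (ℚP.*-comm ½ (fromℕ K)) (proj₂ (archimedean-* X (ℚP.positive⁻¹ ½)))
  approximate : ∀ M → suc N ℕ.≤ M →
    ∀ ϑ -1≤ϑ ϑ≤1 w 0≤w → Hamiltonian.κ ϑ -1≤ϑ ϑ≤1 w 0≤w es ≤ℚ X →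
    ∃ λ c → PositiveLorentz c × (∀ S → ∣ Euler.expTruncated ϑ -1≤ϑ ϑ≤1 w 0≤w es M S - c S ∣ ≤ℚ δ)
  approximate (suc M) (ℕ.s≤s N≤M) ϑ -1≤ϑ ϑ≤1 w 0≤w κ≤X =
    euler s N ,
    euler-PositiveLorentz ϑ -1≤ϑ ϑ≤1 w 0≤w 0≤s sizes (ℚP.≤-trans (*-monoˡ 0≤s κ≤X) sX≤1) N ,
    λ S → ℚP.≤-trans (exp-euler κ≤X {K = K} 0≤s Ns≡1 sX≤1 sX²≤½ X≤K/2 (proj₂ (expSeries-bounded (+-nonNeg 0≤X 0≤X))) M N≤M S) sE≤δ
    where open Euler ϑ -1≤ϑ ϑ≤1 w 0≤w es

-- Finite sums and matrix entries

sumList : ∀ {A : Set} → (A → ℚ) → List A → ℚ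
sumList f = foldr (λ x r → f x + r) 0ℚ

sumList-cong : ∀ {A : Set} {f g : A → ℚ} → f ≗ g → sumList f ≗ sumList g
sumList-cong e []       = refl
sumList-cong e (x ∷ xs) = cong₂ _+_ (e x) (sumList-cong e xs)

sumList-++ : ∀ {A : Set} (f : A → ℚ) xs ys → sumList f (xs ++ ys) ≡ sumList f xs + sumList f ys
sumList-++ f []       ys = sym (ℚP.+-identityˡ (sumList f ys))
sumList-++ f (x ∷ xs) ys = trans (cong (f x +_) (sumList-++ f xs ys)) (sym (ℚP.+-assoc (f x) (sumList f xs) (sumList f ys)))

sumList-map : ∀ {A B : Set} (f : B → ℚ) (g : A → B) xs → sumList f (map g xs) ≡ sumList (λ x → f (g x)) xs
sumList-map f g []       = refl
sumList-map f g (x ∷ xs) = cong (f (g x) +_) (sumList-map f g xs)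

sumList-filter : ∀ {A : Set} {P : A → Set} (P? : Decidable P) (f : A → ℚ) xs →
                 sumList f (filter P? xs) ≡ sumList (λ x → if does (P? x) then f x else 0ℚ) xs
sumList-filter P? f []       = refl
sumList-filter P? f (x ∷ xs) with does (P? x)
... | true  = cong (f x +_) (sumList-filter P? f xs)
... | false = trans (sumList-filter P? f xs) (sym (ℚP.+-identityˡ _))

sumList-lookup : ∀ {A : Set} (f : A → ℚ) xs → sum (λ i → f (lookup xs i)) ≡ sumList f xs
sumList-lookup f []       = refl
sumList-lookup f (x ∷ xs) = cong (f x +_) (sumList-lookup f xs)

sumList-subsets : ∀ n (f : Field n) → sumList f (subsets n) ≡ sumˢ f
sumList-subsets zero    f = ℚP.+-identityʳ (f [])
sumList-subsets (suc n) f = trans (sumList-++ f (map (outside ∷_) (subsets n)) (map (inside ∷_) (subsets n)))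
  (cong₂ _+_ (half outside) (half inside))
  where
  half : ∀ b → sumList f (map (b ∷_) (subsets n)) ≡ sumˢ (λ S → f (b ∷ S))
  half b = trans (sumList-map f (b ∷_) (subsets n)) (sumList-subsets n (λ S → f (b ∷ S)))

sumList-filter-subsets : ∀ {n} {P : Subset n → Set} (P? : Decidable P) (f : Field n) →
                         sumList f (filter P? (subsets n)) ≡ sumˢ (λ S → if does (P? S) then f S else 0ℚ)
sumList-filter-subsets {n} P? f = trans (sumList-filter P? f (subsets n)) (sumList-subsets n _)

sum-kSubsets : ∀ n k (f : Field n) → sum (λ i → f (lookup (kSubsets n k) i)) ≡ level k f
sum-kSubsets n k f = trans (sumList-lookup f (kSubsets n k)) (sumList-filter-subsets (λ S → ∣ S ∣ˢ ℕ.≟ k) f)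

sumˢ-+ : ∀ {n} (f g : Field n) → sumˢ (λ S → f S + g S) ≡ sumˢ f + sumˢ g
sumˢ-+ {zero}  f g = refl
sumˢ-+ {suc n} f g = trans (cong₂ _+_ (sumˢ-+ (λ S → f (outside ∷ S)) (λ S → g (outside ∷ S))) (sumˢ-+ (λ S → f (inside ∷ S)) (λ S → g (inside ∷ S))))
  (solve 4 (λ a b c d → (a :+ b) :+ (c :+ d) := (a :+ c) :+ (b :+ d)) refl
    (sumˢ (λ S → f (outside ∷ S))) (sumˢ (λ S → g (outside ∷ S))) (sumˢ (λ S → f (inside ∷ S))) (sumˢ (λ S → g (inside ∷ S))))

sumˢ-* : ∀ {n} r (f : Field n) → sumˢ (λ S → r * f S) ≡ r * sumˢ f
sumˢ-* {zero}  r f = refl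
sumˢ-* {suc n} r f = trans (cong₂ _+_ (sumˢ-* r (λ S → f (outside ∷ S))) (sumˢ-* r (λ S → f (inside ∷ S))))
  (sym (ℚP.*-distribˡ-+ r (sumˢ (λ S → f (outside ∷ S))) (sumˢ (λ S → f (inside ∷ S)))))

sumˢ-translate : ∀ {n} (S : Subset n) (f : Field n) → sumˢ (λ T → f (S ⊕ T)) ≡ sumˢ f
sumˢ-translate []            f = refl
sumˢ-translate (outside ∷ S) f = cong₂ _+_ (sumˢ-translate S (λ T → f (outside ∷ T))) (sumˢ-translate S (λ T → f (inside ∷ T)))
sumˢ-translate (inside ∷ S)  f = trans
  (cong₂ _+_ (sumˢ-translate S (λ T → f (inside ∷ T))) (sumˢ-translate S (λ T → f (outside ∷ T))))
  (ℚP.+-comm (sumˢ (λ T → f (inside ∷ T))) (sumˢ (λ T → f (outside ∷ T))))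

-- Symmetric differences of subsets

⊕-involutive : ∀ {n} (S T : Subset n) → S ⊕ (S ⊕ T) ≡ T
⊕-involutive []            []            = refl
⊕-involutive (inside ∷ S)  (inside ∷ T)  = cong (inside ∷_) (⊕-involutive S T)
⊕-involutive (inside ∷ S)  (outside ∷ T) = cong (outside ∷_) (⊕-involutive S T)
⊕-involutive (outside ∷ S) (_ ∷ T)       = cong (_ ∷_) (⊕-involutive S T)

─≡∩∁ : ∀ {n} (S T : Subset n) → S ─ T ≡ S ∩ ∁ T
─≡∩∁ []            []            = refl
─≡∩∁ (inside ∷ S)  (inside ∷ T)  = cong (outside ∷_) (─≡∩∁ S T)
─≡∩∁ (inside ∷ S)  (outside ∷ T) = cong (inside ∷_) (─≡∩∁ S T)
─≡∩∁ (outside ∷ S) (inside ∷ T)  = cong (outside ∷_) (─≡∩∁ S T)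
─≡∩∁ (outside ∷ S) (outside ∷ T) = cong (outside ∷_) (─≡∩∁ S T)

△≡⊕ : ∀ {n} (S T : Subset n) → S △ T ≡ S ⊕ T
△≡⊕ S T = trans (cong₂ _∪_ (─≡∩∁ S T) (─≡∩∁ T S)) (go S T)
  where
  go : ∀ {n} (S T : Subset n) → (S ∩ ∁ T) ∪ (T ∩ ∁ S) ≡ S ⊕ T
  go []            []            = refl
  go (inside ∷ S)  (inside ∷ T)  = cong (outside ∷_) (go S T)
  go (inside ∷ S)  (outside ∷ T) = cong (inside ∷_) (go S T)
  go (outside ∷ S) (inside ∷ T)  = cong (inside ∷_) (go S T)
  go (outside ∷ S) (outside ∷ T) = cong (outside ∷_) (go S T)

⊕-size : ∀ {n} (S T : Subset n) → ∣ S ⊕ T ∣ˢ ℕ.+ (∣ S ∩ T ∣ˢ ℕ.+ ∣ S ∩ T ∣ˢ) ≡ ∣ S ∣ˢ ℕ.+ ∣ T ∣ˢ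
⊕-size []            []            = refl
⊕-size (outside ∷ S) (outside ∷ T) = ⊕-size S T
⊕-size (outside ∷ S) (inside ∷ T)  = trans (cong suc (⊕-size S T)) (sym (ℕP.+-suc ∣ S ∣ˢ ∣ T ∣ˢ))
⊕-size (inside ∷ S)  (outside ∷ T) = cong suc (⊕-size S T)
⊕-size (inside ∷ S)  (inside ∷ T)  = trans (cong (∣ S ⊕ T ∣ˢ ℕ.+_) (cong suc (ℕP.+-suc ∣ S ∩ T ∣ˢ ∣ S ∩ T ∣ˢ)))
  (trans (ℕP.+-suc ∣ S ⊕ T ∣ˢ _) (cong suc (trans (ℕP.+-suc ∣ S ⊕ T ∣ˢ _)
    (trans (cong suc (⊕-size S T)) (sym (ℕP.+-suc ∣ S ∣ˢ ∣ T ∣ˢ))))))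

-- From `|S ⊕ e| + 2|S ∩ e| = |S| + 2`. The edges leading from `S` to a set of the same size are
-- thereby those counted by the degree of `S`, so adjacency and degree can be combined edge by edge.
⊕-pair-size : ∀ {n} (S e : Subset n) → ∣ e ∣ˢ ≡ 2 → (∣ S ⊕ e ∣ˢ ≡ᵇ ∣ S ∣ˢ) ≡ (∣ S ∩ e ∣ˢ ≡ᵇ 1)
⊕-pair-size S e ∣e∣≡2 = go ∣ S ⊕ e ∣ˢ ∣ S ∣ˢ ∣ S ∩ e ∣ˢ (trans (⊕-size S e) (cong (∣ S ∣ˢ ℕ.+_) ∣e∣≡2))
  where
  ≡ᵇ-refl : ∀ k → (k ≡ᵇ k) ≡ true
  ≡ᵇ-refl zero    = refl
  ≡ᵇ-refl (suc k) = ≡ᵇ-refl k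
  >⇒≢ᵇ : ∀ k i → (suc (k ℕ.+ i) ≡ᵇ k) ≡ false
  >⇒≢ᵇ zero    i = refl
  >⇒≢ᵇ (suc k) i = >⇒≢ᵇ k i
  <⇒≢ᵇ : ∀ k i → (k ≡ᵇ suc (k ℕ.+ i)) ≡ false
  <⇒≢ᵇ zero    i = refl
  <⇒≢ᵇ (suc k) i = <⇒≢ᵇ k i
  go : ∀ b k a → b ℕ.+ (a ℕ.+ a) ≡ k ℕ.+ 2 → (b ≡ᵇ k) ≡ (a ≡ᵇ 1)
  go b k zero          eq = subst (λ b → (b ≡ᵇ k) ≡ false)
    (sym (trans (sym (ℕP.+-identityʳ b)) (trans eq (ℕP.+-suc k 1)))) (>⇒≢ᵇ k 1)
  go b k (suc zero)    eq = subst (λ b → (b ≡ᵇ k) ≡ true) (sym (ℕP.+-cancelʳ-≡ 2 b k eq)) (≡ᵇ-refl k)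
  go b k (suc (suc a)) eq = subst (λ k → (b ≡ᵇ k) ≡ false)
    (ℕP.+-cancelʳ-≡ 2 (suc (b ℕ.+ (a ℕ.+ suc a))) k (trans (trans (ℕP.+-comm _ 2) (shuffle b a)) eq)) (<⇒≢ᵇ b (a ℕ.+ suc a))
    where
    shuffle : ∀ b a → 2 ℕ.+ suc (b ℕ.+ (a ℕ.+ suc a)) ≡ b ℕ.+ (suc (suc a) ℕ.+ suc (suc a))
    shuffle b a = sym (trans (cong (b ℕ.+_) (cong (λ x → suc (suc x)) (ℕP.+-suc a (suc a))))
      (trans (ℕP.+-suc b _) (cong suc (trans (ℕP.+-suc b _) (cong suc (ℕP.+-suc b _))))))

sum-diag : ∀ {d} (s : Fin d) (f g : Fin d → ℚ) → sum (λ o → (if does (s Fin.≟ o) then f s else 0ℚ) * g o) ≡ f s * g s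
sum-diag {suc d} zero    f g = trans (cong (f zero * g zero +_)
  (trans (sum-cong-≗ (λ o → ℚP.*-zeroˡ (g (suc o)))) (sum-replicate-zero d))) (ℚP.+-identityʳ _)
sum-diag {suc d} (suc s) f g = trans (cong₂ _+_ (ℚP.*-zeroˡ (g zero)) (sum-diag s (λ o → f (suc o)) (λ o → g (suc o))))
  (ℚP.+-identityˡ _)

-- Row sums of the matrix exponential

seq-∑ : ∀ {d} (f : Fin d → ℝ) i → seq (∑ f) i ≡ sum (λ s → seq (f s) i)
seq-∑ {zero}  f i = refl
seq-∑ {suc d} f i = cong (seq (f zero) i +_) (seq-∑ (λ s → f (suc s)) i)

seq-foldr : ∀ {A : Set} (f : A → ℝ) i xs → seq (foldr (λ x r → f x +ᴿ r) 0ᴿ xs) i ≡ sumList (λ x → seq (f x) i) xs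
seq-foldr f i []       = refl
seq-foldr f i (x ∷ xs) = cong (seq (f x) i +_) (seq-foldr f i xs)

-- At a fixed index `i` real arithmetic is rational arithmetic, so the row sums of the powers
-- satisfy their recursion exactly. The vectors `h m` stay abstract, to be filled with the
-- restrictions to `k`-sets of fields on all subsets.
matrixPower-row : ∀ {d} (M : Matrix d) i (h : ℕ → Fin d → ℚ) → (∀ s → h 0 s ≡ 1ℚ) →
                  (∀ m s → sum (λ o → seq (M s o) i * h m o) ≡ h (suc m) s) →
                  ∀ m s → sum (λ s′ → seq ((M ^ᴹ m) s s′) i) ≡ h m s
matrixPower-row M i h h-zero h-suc zero    s = trans
  (trans (sum-cong-≗ (λ s′ → trans (if-float (λ x → seq x i) (does (s Fin.≟ s′)))
      (sym (ℚP.*-identityʳ (if does (s Fin.≟ s′) then 1ℚ else 0ℚ)))))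
    (sum-diag s (λ _ → 1ℚ) (λ _ → 1ℚ)))
  (sym (h-zero s))
matrixPower-row M i h h-zero h-suc (suc m) s = begin
  sum (λ s′ → seq (∑ λ o → M s o *ᴿ (M ^ᴹ m) o s′) i)
    ≡⟨ sum-cong-≗ (λ s′ → seq-∑ (λ o → M s o *ᴿ (M ^ᴹ m) o s′) i) ⟩
  sum (λ s′ → sum (λ o → seq (M s o) i * seq ((M ^ᴹ m) o s′) i))
    ≡⟨ ∑-comm (λ s′ o → seq (M s o) i * seq ((M ^ᴹ m) o s′) i) ⟩
  sum (λ o → sum (λ s′ → seq (M s o) i * seq ((M ^ᴹ m) o s′) i))
    ≡⟨ sum-cong-≗ (λ o → trans (sym (*-distribˡ-sum (seq (M s o) i) (λ s′ → seq ((M ^ᴹ m) o s′) i)))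
         (cong (seq (M s o) i *_) (matrixPower-row M i h h-zero h-suc m o))) ⟩
  sum (λ o → seq (M s o) i * h m o)
    ≡⟨ h-suc m s ⟩
  h (suc m) s ∎
  where open ≡-Reasoning

expSum-row : ∀ {d} (M : Matrix d) i (h : ℕ → Fin d → ℚ) → (∀ s → h 0 s ≡ 1ℚ) →
             (∀ m s → sum (λ o → seq (M s o) i * h m o) ≡ h (suc m) s) →
             ∀ N s → sum (λ s′ → seq (expSum M N s s′) i) ≡ sumTo N (λ m → 1/! m * h m s)
expSum-row {d} M i h h-zero h-suc zero    s = sum-replicate-zero d
expSum-row {d} M i h h-zero h-suc (suc N) s = trans
  (∑-distrib-+ (λ s′ → seq (expSum M N s s′) i) (λ s′ → 1/! N * seq ((M ^ᴹ N) s s′) i))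
  (cong₂ _+_ (expSum-row M i h h-zero h-suc N s)
    (trans (sym (*-distribˡ-sum (1/! N) (λ s′ → seq ((M ^ᴹ N) s s′) i)))
      (cong (1/! N *_) (matrixPower-row M i h h-zero h-suc N s))))

module _ {n : ℕ} (G : WeightedGraph n) where

  open WeightedGraph G

  edges : List (Subset n)
  edges = filterᵇ isEdge (subsets n)

  vertex-size : ∀ k s → ∣ Token.vertex G k s ∣ˢ ≡ k
  vertex-size k s = proj₂ (∈-filter⁻ (λ S → ∣ S ∣ˢ ℕ.≟ k) {xs = subsets n} (∈-lookup {xs = kSubsets n k} s))

  degree-seq : ∀ k S i → seq (Token.degree G k S) i
               ≡ sumˢ (λ e → if isEdge e ∧ (∣ S ∩ e ∣ˢ ≡ᵇ 1) then seq (weight e) i else 0ℚ)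
  degree-seq k S i = trans (seq-foldr weight i (filterᵇ p (subsets n)))
    (sumList-filter-subsets (λ e → T? (p e)) (λ e → seq (weight e) i))
    where
    p : Subset n → Bool
    p e = isEdge e ∧ (∣ S ∩ e ∣ˢ ≡ᵇ 1)

  module _ (k : ℕ) (s o : Fin (length (kSubsets n k))) (i : ℕ) where

    private
      S O : Subset n
      S = lookup (kSubsets n k) s
      O = lookup (kSubsets n k) o

    adjacency-seq : seq (Token.adjacency G k s o) i ≡ (if isEdge (S ⊕ O) then seq (weight (S ⊕ O)) i else 0ℚ)
    adjacency-seq = trans (if-float (λ x → seq x i) (isEdge (S △ O)))
      (cong (λ e → if isEdge e then seq (weight e) i else 0ℚ) (△≡⊕ S O))

    degreeMatrix-seq : seq (Token.degreeMatrix G k s o) i ≡ (if does (s Fin.≟ o) then seq (Token.degree G k S) i else 0ℚ)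
    degreeMatrix-seq = if-float (λ x → seq x i) (does (s Fin.≟ o))

module _ {n : ℕ} (isEdge : Subset n → Bool) (edge-size : ∀ e → T (isEdge e) → ∣ e ∣ˢ ≡ 2)
         (ϑ : ℚ) (-1≤ϑ : - 1ℚ ≤ℚ ϑ) (ϑ≤1 : ϑ ≤ℚ 1ℚ)
         (t : ℚ) (w : Subset n → ℚ) (0≤tw : ∀ e → 0ℚ ≤ℚ t * w e) where

  open Hamiltonian ϑ -1≤ϑ ϑ≤1 (λ e → t * w e) 0≤tw

  private
    split : ∀ b c c′ v x y → (b ≡ true → c ≡ c′) →
            t * (if c then (if b then v else 0ℚ) * x else 0ℚ) + t * ϑ * y * (if b ∧ c′ then v else 0ℚ)
            ≡ (if b then t * v * (if c′ then x + ϑ * y else 0ℚ) else 0ℚ)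
    split true  c     c′ v x y c≡c′ with c≡c′ refl
    split true  true  _  v x y _ | refl = solve 5 (λ t p w x y → t :* (w :* x) :+ t :* p :* y :* w := t :* w :* (x :+ p :* y)) refl t ϑ v x y
    split true  false _  v x y _ | refl = solve 4 (λ t p y w → t :* con 0ℚ :+ t :* p :* y :* con 0ℚ := t :* w :* con 0ℚ) refl t ϑ y v
    split false true  c′ v x y _ = solve 4 (λ t p x y → t :* (con 0ℚ :* x) :+ t :* p :* y :* con 0ℚ := con 0ℚ) refl t ϑ x y
    split false false c′ v x y _ = solve 3 (λ t p y → t :* con 0ℚ :+ t :* p :* y :* con 0ℚ := con 0ℚ) refl t ϑ y

  -- Writing `T = S ⊕ e` turns the row of the adjacency matrix at `S` into a sum over `e`, to which
  -- the degree term can be added. The field `g` lives on all subsets, so a single `ham` contains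
  -- the blocks of all `k`.
  ham-adjacency-degree : ∀ k S → ∣ S ∣ˢ ≡ k → ∀ g →
    t * level k (λ T → (if isEdge (S ⊕ T) then w (S ⊕ T) else 0ℚ) * g T)
    + t * ϑ * (sumˢ (λ e → if isEdge e ∧ (∣ S ∩ e ∣ˢ ≡ᵇ 1) then w e else 0ℚ) * g S)
    ≡ ham (filterᵇ isEdge (subsets n)) g S
  ham-adjacency-degree k S ∣S∣≡k g = begin
    t * level k (λ T → adj T * g T) + t * ϑ * (sumˢ deg * g S)
      ≡⟨ cong₂ (λ a b → t * a + b) neighbours
           (solve 4 (λ t p d g → t :* p :* (d :* g) := t :* p :* g :* d) refl t ϑ (sumˢ deg) (g S)) ⟩
    t * sumˢ near + t * ϑ * g S * sumˢ deg
      ≡⟨ cong₂ _+_ (sumˢ-* t near) (sumˢ-* (t * ϑ * g S) deg) ⟨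
    sumˢ (λ e → t * near e) + sumˢ (λ e → t * ϑ * g S * deg e)
      ≡⟨ sumˢ-+ (λ e → t * near e) (λ e → t * ϑ * g S * deg e) ⟨
    sumˢ (λ e → t * near e + t * ϑ * g S * deg e)
      ≡⟨ sumˢ-cong (λ e → split (isEdge e) (∣ S ⊕ e ∣ˢ ≡ᵇ k) (∣ S ∩ e ∣ˢ ≡ᵇ 1) (w e) (g (S ⊕ e)) (g S) (hit e)) ⟩
    sumˢ (λ e → if isEdge e then t * w e * exchange e g S else 0ℚ)
      ≡⟨ sumList-filter-subsets (λ e → T? (isEdge e)) (λ e → t * w e * exchange e g S) ⟨
    ham (filterᵇ isEdge (subsets n)) g S ∎
    where
    open ≡-Reasoning
    adj near deg : Field n
    adj T = if isEdge (S ⊕ T) then w (S ⊕ T) else 0ℚ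
    near e = if ∣ S ⊕ e ∣ˢ ≡ᵇ k then (if isEdge e then w e else 0ℚ) * g (S ⊕ e) else 0ℚ
    deg e = if isEdge e ∧ (∣ S ∩ e ∣ˢ ≡ᵇ 1) then w e else 0ℚ
    neighbours : level k (λ T → adj T * g T) ≡ sumˢ near
    neighbours = trans
      (sym (sumˢ-translate S (λ T → if ∣ T ∣ˢ ≡ᵇ k then adj T * g T else 0ℚ)))
      (sumˢ-cong (λ e → cong (λ e′ → if ∣ S ⊕ e ∣ˢ ≡ᵇ k then (if isEdge e′ then w e′ else 0ℚ) * g (S ⊕ e) else 0ℚ)
        (⊕-involutive S e)))
    hit : ∀ e → isEdge e ≡ true → (∣ S ⊕ e ∣ˢ ≡ᵇ k) ≡ (∣ S ∩ e ∣ˢ ≡ᵇ 1)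
    hit e e∈E = trans (cong (∣ S ⊕ e ∣ˢ ≡ᵇ_) (sym ∣S∣≡k)) (⊕-pair-size S e (edge-size e (subst T (sym e∈E) _)))

module _ {n : ℕ} (G : WeightedGraph n) (ϑ t : ℝ) (i : ℕ)
         (-1≤ϑ : - 1ℚ ≤ℚ seq ϑ i) (ϑ≤1 : seq ϑ i ≤ℚ 1ℚ)
         (0≤tw : ∀ e → 0ℚ ≤ℚ seq t i * seq (WeightedGraph.weight G e) i) where

  private
    module E = Euler (seq ϑ i) -1≤ϑ ϑ≤1 (λ e → seq t i * seq (WeightedGraph.weight G e) i) 0≤tw (edges G)

  entries-ham : ∀ k (g : Field n) s →
    sum (λ o → seq ((t • Token.H G k ϑ) s o) i * g (Token.vertex G k o)) ≡ E.ham (edges G) g (Token.vertex G k s)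
  entries-ham k g s = begin
    sum (λ o → seq ((t • Token.H G k ϑ) s o) i * g (v o))
      ≡⟨ sum-cong-≗ (λ o → trans
             (cong₂ (λ a d → τ * (a + θ * d) * g (v o)) (adjacency-seq G k s o i) (degreeMatrix-seq G k s o i))
           (solve 5 (λ t p a d g → t :* (a :+ p :* d) :* g := t :* (a :* g) :+ t :* p :* (d :* g)) refl
             τ θ (adj (v o)) (D o) (g (v o)))) ⟩
    sum (λ o → τ * nearby o + τ * θ * diagonal o)
      ≡⟨ trans (∑-distrib-+ (λ o → τ * nearby o) (λ o → τ * θ * diagonal o))
           (cong₂ _+_ (sym (*-distribˡ-sum τ nearby)) (sym (*-distribˡ-sum (τ * θ) diagonal))) ⟩
    τ * sum nearby + τ * θ * sum diagonal
      ≡⟨ cong₂ (λ a b → τ * a + τ * θ * b) (sum-kSubsets n k (λ T → adj T * g T))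
           (trans (sum-diag s (λ o → seq (Token.degree G k (v o)) i) (λ o → g (v o))) (cong (_* g (v s)) (degree-seq G k (v s) i))) ⟩
    τ * level k (λ T → adj T * g T) + τ * θ * (sumˢ deg * g (v s))
      ≡⟨ ham-adjacency-degree isEdge edge-size θ -1≤ϑ ϑ≤1 τ (λ e → seq (weight e) i) 0≤tw k (v s) (vertex-size G k s) g ⟩
    E.ham (edges G) g (v s) ∎
    where
    open ≡-Reasoning
    open WeightedGraph G
    τ θ : ℚ
    τ = seq t i
    θ = seq ϑ i
    v : Fin (Token.order G k) → Subset n
    v = Token.vertex G k
    adj deg : Field n
    adj T = if isEdge (v s ⊕ T) then seq (weight (v s ⊕ T)) i else 0ℚ
    deg e = if isEdge e ∧ (∣ v s ∩ e ∣ˢ ≡ᵇ 1) then seq (weight e) i else 0ℚ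
    D nearby diagonal : Fin (Token.order G k) → ℚ
    D o = if does (s Fin.≟ o) then seq (Token.degree G k (v s)) i else 0ℚ
    nearby o = adj (v o) * g (v o)
    diagonal o = D o * g (v o)

  -- The field on the right does not depend on `k`, which is why one Lorentzian approximation
  -- controls three consecutive levels at once.
  expSum-level : ∀ k N → seq (∑ λ s → ∑ λ s′ → expSum (t • Token.H G k ϑ) N s s′) i ≡ level k (E.expTruncated N)
  expSum-level k N = begin
    seq (∑ λ s → ∑ λ s′ → expSum M N s s′) i
      ≡⟨ seq-∑ (λ s → ∑ λ s′ → expSum M N s s′) i ⟩
    sum (λ s → seq (∑ λ s′ → expSum M N s s′) i)
      ≡⟨ sum-cong-≗ (λ s → trans (seq-∑ (λ s′ → expSum M N s s′) i)
           (expSum-row M i (λ m s → E.hamPower m (Token.vertex G k s)) (λ _ → refl) (λ m → entries-ham k (E.hamPower m)) N s)) ⟩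
    sum (λ s → E.expTruncated N (Token.vertex G k s))
      ≡⟨ sum-kSubsets n k (E.expTruncated N) ⟩
    level k (E.expTruncated N) ∎
    where
    open ≡-Reasoning
    M : Matrix (Token.order G k)
    M = t • Token.H G k ϑ

-- Passage to the reals

shrink : ∀ D {ε} → 0ℚ <ℚ ε → ∃ λ δ → 0ℚ <ℚ δ × δ ≤ℚ 1ℚ × δ * D ≤ℚ ε
shrink D {ε} 0<ε = δ , ℚP.positive⁻¹ δ {{ℚP.normalize-pos 1 (suc N)}} , δ≤1 , δD≤ε
  where
  open ℚP.≤-Reasoning
  N : ℕ
  N = proj₁ (archimedean-* D 0<ε)
  δ : ℚ
  δ = ℤ.+ 1 / suc N
  0≤δ : 0ℚ ≤ℚ δ
  0≤δ = unit-nonNeg (suc N)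
  δ≤1 : δ ≤ℚ 1ℚ
  δ≤1 = begin
    δ                    ≡⟨ ℚP.*-identityˡ δ ⟨
    fromℕ 1 * δ          ≤⟨ *-monoʳ 0≤δ (fromℕ-mono {1} {suc N} (ℕ.s≤s ℕ.z≤n)) ⟩
    fromℕ (suc N) * δ    ≡⟨ *-unit (suc N) ⟩
    1ℚ                   ∎
  δD≤ε : δ * D ≤ℚ ε
  δD≤ε = begin
    δ * D                      ≤⟨ *-monoˡ 0≤δ (proj₂ (archimedean-* D 0<ε)) ⟩
    δ * (ε * fromℕ N)          ≤⟨ *-monoˡ 0≤δ (*-monoˡ (ℚP.<⇒≤ 0<ε) (fromℕ-mono (ℕP.n≤1+n N))) ⟩
    δ * (ε * fromℕ (suc N))    ≡⟨ solve 3 (λ d e n → d :* (e :* n) := e :* (n :* d)) refl δ ε (fromℕ (suc N)) ⟩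
    ε * (fromℕ (suc N) * δ)    ≡⟨ trans (cong (ε *_) (*-unit (suc N))) (ℚP.*-identityʳ ε) ⟩
    ε                          ∎

∣+-+∣≤ : ∀ a b c d {p q} → ∣ a - c ∣ ≤ℚ p → ∣ b - d ∣ ≤ℚ q → ∣ (a + b) - (c + d) ∣ ≤ℚ p + q
∣+-+∣≤ a b c d {p} {q} h k = subst (λ v → ∣ v ∣ ≤ℚ p + q)
  (solve 4 (λ a b c d → (a :- c) :+ (b :- d) := (a :+ b) :- (c :+ d)) refl a b c d)
  (ℚP.≤-trans (ℚP.∣p+q∣≤∣p∣+∣q∣ (a - c) (b - d)) (ℚP.+-mono-≤ h k))

∣*-*∣≤ : ∀ a b c d {A D δ} → ∣ a ∣ ≤ℚ A → ∣ d ∣ ≤ℚ D → ∣ a - c ∣ ≤ℚ δ → ∣ b - d ∣ ≤ℚ δ → ∣ a * b - c * d ∣ ≤ℚ δ * (A + D)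
∣*-*∣≤ a b c d {A} {D} {δ} hA hD h k = begin
  ∣ a * b - c * d ∣
    ≡⟨ cong ∣_∣ (solve 4 (λ a b c d → a :* b :- c :* d := a :* (b :- d) :+ (a :- c) :* d) refl a b c d) ⟩
  ∣ a * (b - d) + (a - c) * d ∣
    ≤⟨ ℚP.∣p+q∣≤∣p∣+∣q∣ (a * (b - d)) ((a - c) * d) ⟩
  ∣ a * (b - d) ∣ + ∣ (a - c) * d ∣
    ≡⟨ cong₂ _+_ (ℚP.∣p*q∣≡∣p∣*∣q∣ a (b - d)) (ℚP.∣p*q∣≡∣p∣*∣q∣ (a - c) d) ⟩
  ∣ a ∣ * ∣ b - d ∣ + ∣ a - c ∣ * ∣ d ∣
    ≤⟨ ℚP.+-mono-≤ (*-mono-≤-nonNeg (ℚP.0≤∣p∣ a) 0≤δ hA k) (*-mono-≤-nonNeg (ℚP.0≤∣p∣ (a - c)) (ℚP.≤-trans (ℚP.0≤∣p∣ d) hD) h hD) ⟩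
  A * δ + δ * D
    ≡⟨ solve 3 (λ A d D → A :* d :+ d :* D := d :* (A :+ D)) refl A δ D ⟩
  δ * (A + D) ∎
  where
  open ℚP.≤-Reasoning
  0≤δ : 0ℚ ≤ℚ δ
  0≤δ = ℚP.≤-trans (ℚP.0≤∣p∣ (a - c)) h

infix 4 _≈_

_≈_ : (x y : ℕ → ℚ) → Set
x ≈ y = ∀ ε → 0ℚ <ℚ ε → ∃ λ N → ∀ n → N ℕ.≤ n → ∣ x n - y n ∣ ≤ℚ ε

≈-refl : ∀ x → x ≈ x
≈-refl x ε 0<ε = 0 , λ n _ → subst (λ v → ∣ v ∣ ≤ℚ ε) (sym (p-p≡0 (x n))) (ℚP.<⇒≤ 0<ε)

≈-sym : ∀ x y → x ≈ y → y ≈ x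
≈-sym x y h ε 0<ε = let N , k = h ε 0<ε in N , λ n N≤n → subst (_≤ℚ ε) (∣p-q∣≡∣q-p∣ (x n) (y n)) (k n N≤n)

≈-+ : ∀ x y x′ y′ → x ≈ x′ → y ≈ y′ → (λ n → x n + y n) ≈ (λ n → x′ n + y′ n)
≈-+ x y x′ y′ h k ε 0<ε =
  let N₁ , h₁ = h (½ * ε) (½-pos 0<ε)
      N₂ , h₂ = k (½ * ε) (½-pos 0<ε)
  in N₁ ℕ.⊔ N₂ , λ n N≤n → subst (∣ (x n + y n) - (x′ n + y′ n) ∣ ≤ℚ_) (halves ε)
    (∣+-+∣≤ (x n) (y n) (x′ n) (y′ n) (h₁ n (ℕP.m⊔n≤o⇒m≤o N₁ N₂ N≤n)) (h₂ n (ℕP.m⊔n≤o⇒n≤o N₁ N₂ N≤n)))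

≈-* : ∀ (x y x′ y′ : ℝ) → seq x ≈ seq x′ → seq y ≈ seq y′ → seq (x *ᴿ y) ≈ seq (x′ *ᴿ y′)
≈-* x y x′ y′ h k ε 0<ε =
  let A , hA = bound x
      D , hD = bound y′
      δ , 0<δ , _ , δ≤ = shrink (A + D) 0<ε
      N₁ , h₁ = h δ 0<δ
      N₂ , h₂ = k δ 0<δ
  in N₁ ℕ.⊔ N₂ , λ n N≤n → ℚP.≤-trans
    (∣*-*∣≤ (seq x n) (seq y n) (seq x′ n) (seq y′ n) (hA n) (hD n)
      (h₁ n (ℕP.m⊔n≤o⇒m≤o N₁ N₂ N≤n)) (h₂ n (ℕP.m⊔n≤o⇒n≤o N₁ N₂ N≤n))) δ≤

≈-∑ : ∀ {d} (f g : Fin d → ℝ) → (∀ i → seq (f i) ≈ seq (g i)) → seq (∑ f) ≈ seq (∑ g)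
≈-∑ {zero}  f g h = ≈-refl (λ _ → 0ℚ)
≈-∑ {suc d} f g h = ≈-+ (seq (f zero)) (seq (∑ λ i → f (suc i))) (seq (g zero)) (seq (∑ λ i → g (suc i))) (h zero)
  (≈-∑ (λ i → f (suc i)) (λ i → g (suc i)) (λ i → h (suc i)))

≈-if : ∀ b (x y : ℕ → ℚ) → (b ≡ true → x ≈ y) → (λ i → if b then x i else 0ℚ) ≈ (λ i → if b then y i else 0ℚ)
≈-if true  x y h = h refl
≈-if false x y h = ≈-refl (λ _ → 0ℚ)

≈-sumˢ : ∀ {n} (f g : ℕ → Field n) → (∀ S → (λ i → f i S) ≈ (λ i → g i S)) → (λ i → sumˢ (f i)) ≈ (λ i → sumˢ (g i))
≈-sumˢ {zero}  f g h = h []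
≈-sumˢ {suc n} f g h = ≈-+
  (λ i → sumˢ (λ S → f i (outside ∷ S))) (λ i → sumˢ (λ S → f i (inside ∷ S)))
  (λ i → sumˢ (λ S → g i (outside ∷ S))) (λ i → sumˢ (λ S → g i (inside ∷ S)))
  (≈-sumˢ (λ i S → f i (outside ∷ S)) (λ i S → g i (outside ∷ S)) (λ S → h (outside ∷ S)))
  (≈-sumˢ (λ i S → f i (inside ∷ S)) (λ i S → g i (inside ∷ S)) (λ S → h (inside ∷ S)))

≈-resp-≗ : ∀ {x x′ y y′} → x ≗ x′ → y ≗ y′ → x ≈ y → x′ ≈ y′
≈-resp-≗ {x} {x′} {y} {y′} e e′ h ε 0<ε = let N , k = h ε 0<ε in
  N , λ n N≤n → subst₂ (λ a b → ∣ a - b ∣ ≤ℚ ε) (e n) (e′ n) (k n N≤n)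

module _ {d : ℕ} (M M′ : Matrix d) (M≈M′ : ∀ i j → seq (M i j) ≈ seq (M′ i j)) where

  ≈-^ᴹ : ∀ m i j → seq ((M ^ᴹ m) i j) ≈ seq ((M′ ^ᴹ m) i j)
  ≈-^ᴹ zero    i j = ≈-refl (seq ((M ^ᴹ 0) i j))
  ≈-^ᴹ (suc m) i j = ≈-∑ (λ o → M i o *ᴿ (M ^ᴹ m) o j) (λ o → M′ i o *ᴿ (M′ ^ᴹ m) o j)
    (λ o → ≈-* (M i o) ((M ^ᴹ m) o j) (M′ i o) ((M′ ^ᴹ m) o j) (M≈M′ i o) (≈-^ᴹ m o j))

  ≈-expSum : ∀ N i j → seq (expSum M N i j) ≈ seq (expSum M′ N i j)
  ≈-expSum zero    i j = ≈-refl (λ _ → 0ℚ)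
  ≈-expSum (suc N) i j = ≈-+ (seq (expSum M N i j)) (seq (c *ᴿ (M ^ᴹ N) i j)) (seq (expSum M′ N i j)) (seq (c *ᴿ (M′ ^ᴹ N) i j))
    (≈-expSum N i j) (≈-* c ((M ^ᴹ N) i j) c ((M′ ^ᴹ N) i j) (≈-refl (seq c)) (≈-^ᴹ N i j))
    where
    c : ℝ
    c = fromℚ (1/! N)

-- An iterated limit: the threshold `K` for the index within the Cauchy sequences may depend on `m`.
-- This fixes the order in which the parameters are chosen later.
_⟶ₛ_ : (ℕ → ℕ → ℚ) → (ℕ → ℚ) → Set
x ⟶ₛ y = ∀ ε → 0ℚ <ℚ ε → ∃ λ N → ∀ m → N ℕ.≤ m → ∃ λ K → ∀ n → K ℕ.≤ n → ∣ x m n - y n ∣ ≤ℚ ε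

⟶⇒⟶ₛ : ∀ x y → x ⟶ y → (λ m → seq (x m)) ⟶ₛ seq y
⟶⇒⟶ₛ x y h ε 0<ε =
  let N , h₁ = h (½ * ε) (½-pos 0<ε)
  in N , λ m N≤m → let K , h₂ = h₁ m N≤m (½ * ε) (½-pos 0<ε) in
    K , λ n K≤n → subst (∣ seq (x m) n - seq y n ∣ ≤ℚ_) (halves ε) (h₂ n K≤n)

⟶ₛ-+ : ∀ x y x′ y′ → x ⟶ₛ x′ → y ⟶ₛ y′ → (λ m n → x m n + y m n) ⟶ₛ (λ n → x′ n + y′ n)
⟶ₛ-+ x y x′ y′ h k ε 0<ε =
  let N₁ , h₁ = h (½ * ε) (½-pos 0<ε)
      N₂ , h₂ = k (½ * ε) (½-pos 0<ε)
  in N₁ ℕ.⊔ N₂ , λ m N≤m →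
    let K₁ , h₁′ = h₁ m (ℕP.m⊔n≤o⇒m≤o N₁ N₂ N≤m)
        K₂ , h₂′ = h₂ m (ℕP.m⊔n≤o⇒n≤o N₁ N₂ N≤m)
    in K₁ ℕ.⊔ K₂ , λ n K≤n → subst (∣ (x m n + y m n) - (x′ n + y′ n) ∣ ≤ℚ_) (halves ε)
      (∣+-+∣≤ (x m n) (y m n) (x′ n) (y′ n)
        (h₁′ n (ℕP.m⊔n≤o⇒m≤o K₁ K₂ K≤n)) (h₂′ n (ℕP.m⊔n≤o⇒n≤o K₁ K₂ K≤n)))

⟶ₛ-∑ : ∀ {d} (x : ℕ → Fin d → ℝ) y → (∀ i → (λ m → seq (x m i)) ⟶ₛ seq (y i)) → (λ m → seq (∑ (x m))) ⟶ₛ seq (∑ y)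
⟶ₛ-∑ {zero}  x y h ε 0<ε = 0 , λ m _ → ≈-refl (λ _ → 0ℚ) ε 0<ε
⟶ₛ-∑ {suc d} x y h = ⟶ₛ-+ (λ m → seq (x m zero)) (λ m → seq (∑ λ i → x m (suc i))) (seq (y zero)) (seq (∑ λ i → y (suc i))) (h zero)
  (⟶ₛ-∑ (λ m i → x m (suc i)) (λ i → y (suc i)) (λ i → h (suc i)))

-- Projection of the data onto the constraints

p≤∣p∣ : ∀ p → p ≤ℚ ∣ p ∣
p≤∣p∣ p with ℚP.∣p∣≡p∨∣p∣≡-p p
... | inj₁ eq = ℚP.≤-reflexive (sym eq)
... | inj₂ eq = ≤-by-diff {p} (∣ p ∣ + ∣ p ∣) (+-nonNeg (ℚP.0≤∣p∣ p) (ℚP.0≤∣p∣ p))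
  (subst (λ a → a ≡ p + (a + a)) (sym eq) (solve 1 (λ p → :- p := p :+ (:- p :+ :- p)) refl p))

p≤q+∣p-q∣ : ∀ p q → p ≤ℚ q + ∣ p - q ∣
p≤q+∣p-q∣ p q = subst (_≤ℚ q + ∣ p - q ∣) (solve 2 (λ p q → q :+ (p :- q) := p) refl p q)
  (ℚP.+-monoʳ-≤ q (p≤∣p∣ (p - q)))

∣p-q∣≤r : ∀ p q {r} → p ≤ℚ q + r → q ≤ℚ p + r → ∣ p - q ∣ ≤ℚ r
∣p-q∣≤r p q {r} h k = ∣p∣≤r
  (subst (- r ≤ℚ_) (solve 3 (λ p q r → (p :+ r :- q) :- r := p :- q) refl p q r)
    (subst (_≤ℚ (p + r - q) - r) (ℚP.+-identityˡ (- r)) (ℚP.+-monoˡ-≤ (- r) (diff-nonNeg k))))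
  (subst (p - q ≤ℚ_) (solve 2 (λ q r → (q :+ r) :- q := r) refl q r) (ℚP.+-monoˡ-≤ (- q) h))

p≤p+q : ∀ p {q} → 0ℚ ≤ℚ q → p ≤ℚ p + q
p≤p+q p {q} 0≤q = ≤-by-diff {p} q 0≤q refl

-- One-sided form; exchanging the arguments gives the bound on the absolute value. Such maps keep
-- every Cauchy modulus, so they act on real numbers.
Nonexpansive : (ℚ → ℚ) → Set
Nonexpansive f = ∀ p q → f p ≤ℚ f q + ∣ p - q ∣

⊔-nonexpansive : ∀ c → Nonexpansive (ℚ._⊔ c)
⊔-nonexpansive c p q = ℚP.⊔-lub
  (ℚP.≤-trans (p≤q+∣p-q∣ p q) (ℚP.+-monoˡ-≤ ∣ p - q ∣ (ℚP.p≤p⊔q q c)))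
  (ℚP.≤-trans (ℚP.p≤q⊔p q c) (p≤p+q (q ℚ.⊔ c) (ℚP.0≤∣p∣ (p - q))))

⊓-nonexpansive : ∀ c → Nonexpansive (ℚ._⊓ c)
⊓-nonexpansive c p q with ℚP.⊓-sel q c
... | inj₁ eq = subst (λ r → p ℚ.⊓ c ≤ℚ r + ∣ p - q ∣) (sym eq) (ℚP.≤-trans (ℚP.p⊓q≤p p c) (p≤q+∣p-q∣ p q))
... | inj₂ eq = subst (λ r → p ℚ.⊓ c ≤ℚ r + ∣ p - q ∣) (sym eq) (ℚP.≤-trans (ℚP.p⊓q≤q p c) (p≤p+q c (ℚP.0≤∣p∣ (p - q))))

mapᴿ : (f : ℚ → ℚ) → Nonexpansive f → ℝ → ℝ
mapᴿ f f-ne x = mkℝ (λ n → f (seq x n)) λ ε 0<ε →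
  let N , h = cauchy x ε 0<ε in
  N , λ m n N≤m N≤n → ℚP.≤-trans
    (∣p-q∣≤r (f (seq x m)) (f (seq x n)) (f-ne (seq x m) (seq x n))
      (subst (λ d → f (seq x n) ≤ℚ f (seq x m) + d) (∣p-q∣≡∣q-p∣ (seq x n) (seq x m)) (f-ne (seq x n) (seq x m))))
    (h m n N≤m N≤n)

positivePart : ℝ → ℝ
positivePart = mapᴿ (ℚ._⊔ 0ℚ) (⊔-nonexpansive 0ℚ)

-- Nonnegativity of the limit only says that the terms are eventually at least `- ε`; the projection
-- then moves them by at most `ε`.
positivePart-≈ : ∀ x → 0ᴿ ≤ᴿ x → seq (positivePart x) ≈ seq x
positivePart-≈ x 0≤x ε 0<ε = let N , h = 0≤x ε 0<ε in N , λ n N≤n → ∣p-q∣≤r (seq x n ℚ.⊔ 0ℚ) (seq x n)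
  (ℚP.⊔-lub (p≤p+q (seq x n) (ℚP.<⇒≤ 0<ε)) (h n N≤n))
  (ℚP.≤-trans (ℚP.p≤p⊔q (seq x n) 0ℚ) (p≤p+q (seq x n ℚ.⊔ 0ℚ) (ℚP.<⇒≤ 0<ε)))

clampℚ : ℚ → ℚ
clampℚ p = (p ℚ.⊔ - 1ℚ) ℚ.⊓ 1ℚ

clampℚ-lower : ∀ p → - 1ℚ ≤ℚ clampℚ p
clampℚ-lower p = ℚP.⊓-glb (ℚP.p≤q⊔p p (- 1ℚ)) (ℚP.≤-trans (ℚP.<⇒≤ (ℚP.negative⁻¹ (- 1ℚ))) (ℚP.nonNegative⁻¹ 1ℚ))

clampℚ-upper : ∀ p → clampℚ p ≤ℚ 1ℚ
clampℚ-upper p = ℚP.p⊓q≤q (p ℚ.⊔ - 1ℚ) 1ℚ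

clamp : ℝ → ℝ
clamp x = mapᴿ (ℚ._⊓ 1ℚ) (⊓-nonexpansive 1ℚ) (mapᴿ (ℚ._⊔ - 1ℚ) (⊔-nonexpansive (- 1ℚ)) x)

clamp-≈ : ∀ x → -ᴿ 1ᴿ ≤ᴿ x → x ≤ᴿ 1ᴿ → seq (clamp x) ≈ seq x
clamp-≈ x -1≤x x≤1 ε 0<ε =
  let N₁ , h₁ = -1≤x ε 0<ε
      N₂ , h₂ = x≤1 ε 0<ε
  in N₁ ℕ.⊔ N₂ , λ n N≤n → close (seq x n) (h₁ n (ℕP.m⊔n≤o⇒m≤o N₁ N₂ N≤n)) (h₂ n (ℕP.m⊔n≤o⇒n≤o N₁ N₂ N≤n))
  where
  0≤ε : 0ℚ ≤ℚ ε
  0≤ε = ℚP.<⇒≤ 0<ε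
  close : ∀ p → - 1ℚ ≤ℚ p + ε → p ≤ℚ 1ℚ + ε → ∣ clampℚ p - p ∣ ≤ℚ ε
  close p h k = ∣p-q∣≤r (clampℚ p) p
    (ℚP.≤-trans (ℚP.p⊓q≤p (p ℚ.⊔ - 1ℚ) 1ℚ) (ℚP.⊔-lub (p≤p+q p 0≤ε) h))
    (lower (ℚP.⊓-sel (p ℚ.⊔ - 1ℚ) 1ℚ))
    where
    lower : clampℚ p ≡ p ℚ.⊔ - 1ℚ ⊎ clampℚ p ≡ 1ℚ → p ≤ℚ clampℚ p + ε
    lower (inj₁ eq) = subst (λ r → p ≤ℚ r + ε) (sym eq)
      (ℚP.≤-trans (ℚP.p≤p⊔q p (- 1ℚ)) (p≤p+q (p ℚ.⊔ - 1ℚ) 0≤ε))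
    lower (inj₂ eq) = subst (λ r → p ≤ℚ r + ε) (sym eq) k

sumˢ-dominated : ∀ {n} (f g : Field n) {δ} → (∀ S → ∣ f S - g S ∣ ≤ℚ δ) → ∣ sumˢ f - sumˢ g ∣ ≤ℚ fromℕ 2 ^ n * δ
sumˢ-dominated {zero}  f g {δ} h = subst (∣ f [] - g [] ∣ ≤ℚ_) (sym (ℚP.*-identityˡ δ)) (h [])
sumˢ-dominated {suc n} f g {δ} h = subst (∣ sumˢ f - sumˢ g ∣ ≤ℚ_)
  (solve 2 (λ p d → p :* d :+ p :* d := (con 1ℚ :+ con 1ℚ) :* p :* d) refl (fromℕ 2 ^ n) δ)
  (∣+-+∣≤ (sumˢ (λ S → f (outside ∷ S))) (sumˢ (λ S → f (inside ∷ S))) (sumˢ (λ S → g (outside ∷ S))) (sumˢ (λ S → g (inside ∷ S)))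
    (sumˢ-dominated (λ S → f (outside ∷ S)) (λ S → g (outside ∷ S)) (λ S → h (outside ∷ S)))
    (sumˢ-dominated (λ S → f (inside ∷ S)) (λ S → g (inside ∷ S)) (λ S → h (inside ∷ S))))

level-dominated : ∀ {n} k (f g : Field n) {δ} → (∀ S → ∣ f S - g S ∣ ≤ℚ δ) → ∣ level k f - level k g ∣ ≤ℚ fromℕ 2 ^ n * δ
level-dominated k f g {δ} h = sumˢ-dominated (λ S → if ∣ S ∣ˢ ≡ᵇ k then f S else 0ℚ) (λ S → if ∣ S ∣ˢ ≡ᵇ k then g S else 0ℚ)
  (λ S → restrict (∣ S ∣ˢ ≡ᵇ k) S)
  where
  restrict : ∀ b S → ∣ (if b then f S else 0ℚ) - (if b then g S else 0ℚ) ∣ ≤ℚ δ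
  restrict true  S = h S
  restrict false S = ℚP.≤-trans (ℚP.0≤∣p∣ (f S - g S)) (h S)

unit≤1 : ∀ d .{{_ : ℕ.NonZero d}} → ℤ.+ 1 / d ≤ℚ 1ℚ
unit≤1 (suc d) = subst₂ _≤ℚ_ (ℚP.*-identityˡ (ℤ.+ 1 / suc d)) (*-unit (suc d))
  (*-monoʳ (unit-nonNeg (suc d)) (fromℕ-mono {1} {suc d} (ℕ.s≤s ℕ.z≤n)))

∣*unit∣≤ : ∀ a b u {δ} → 0ℚ ≤ℚ u → u ≤ℚ 1ℚ → ∣ a - b ∣ ≤ℚ δ → ∣ a * u - b * u ∣ ≤ℚ δ
∣*unit∣≤ a b u {δ} 0≤u u≤1 h = begin
  ∣ a * u - b * u ∣    ≡⟨ cong ∣_∣ (solve 3 (λ a b u → a :* u :- b :* u := (a :- b) :* u) refl a b u) ⟩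
  ∣ (a - b) * u ∣      ≡⟨ trans (ℚP.∣p*q∣≡∣p∣*∣q∣ (a - b) u) (cong (∣ a - b ∣ *_) (ℚP.0≤p⇒∣p∣≡p 0≤u)) ⟩
  ∣ a - b ∣ * u        ≤⟨ *-mono-≤-nonNeg (ℚP.0≤∣p∣ (a - b)) (ℚP.nonNegative⁻¹ 1ℚ) ℚP.≤-refl u≤1 ⟩
  ∣ a - b ∣ * 1ℚ       ≡⟨ ℚP.*-identityʳ ∣ a - b ∣ ⟩
  ∣ a - b ∣            ≤⟨ h ⟩
  δ                    ∎
  where open ℚP.≤-Reasoning

-- Each of the two products is perturbed by at most `δ(B + (B + 1))`: the given numbers are bounded
-- by `B`, and their approximations by `B + 1` because `δ ≤ 1`.
log-concave-approximation : ∀ b₀ b₁ b₂ z₀ z₁ z₂ {B δ ε} →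
  ∣ b₀ ∣ ≤ℚ B → ∣ b₁ ∣ ≤ℚ B → ∣ b₂ ∣ ≤ℚ B →
  ∣ b₀ - z₀ ∣ ≤ℚ δ → ∣ b₁ - z₁ ∣ ≤ℚ δ → ∣ b₂ - z₂ ∣ ≤ℚ δ → δ ≤ℚ 1ℚ →
  δ * ((B + (B + 1ℚ)) + (B + (B + 1ℚ))) ≤ℚ ε → z₀ * z₂ ≤ℚ z₁ * z₁ → b₀ * b₂ ≤ℚ b₁ * b₁ + ε
log-concave-approximation b₀ b₁ b₂ z₀ z₁ z₂ {B} {δ} {ε} hb₀ hb₁ hb₂ h₀ h₁ h₂ δ≤1 small hz = begin
  b₀ * b₂
    ≤⟨ p≤q+∣p-q∣ (b₀ * b₂) (z₀ * z₂) ⟩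
  z₀ * z₂ + ∣ b₀ * b₂ - z₀ * z₂ ∣
    ≤⟨ ℚP.+-mono-≤ hz (∣*-*∣≤ b₀ b₂ z₀ z₂ hb₀ (near b₂ z₂ hb₂ h₂) h₀ h₂) ⟩
  z₁ * z₁ + e
    ≤⟨ ℚP.+-monoˡ-≤ e (ℚP.≤-trans (p≤q+∣p-q∣ (z₁ * z₁) (b₁ * b₁)) (ℚP.+-monoʳ-≤ (b₁ * b₁)
         (subst (_≤ℚ e) (∣p-q∣≡∣q-p∣ (b₁ * b₁) (z₁ * z₁)) (∣*-*∣≤ b₁ b₁ z₁ z₁ hb₁ (near b₁ z₁ hb₁ h₁) h₁ h₁)))) ⟩
  (b₁ * b₁ + e) + e
    ≡⟨ solve 3 (λ x d m → (x :+ d :* m) :+ d :* m := x :+ d :* (m :+ m)) refl (b₁ * b₁) δ (B + (B + 1ℚ)) ⟩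
  b₁ * b₁ + δ * ((B + (B + 1ℚ)) + (B + (B + 1ℚ)))
    ≤⟨ ℚP.+-monoʳ-≤ (b₁ * b₁) small ⟩
  b₁ * b₁ + ε ∎
  where
  open ℚP.≤-Reasoning
  e : ℚ
  e = δ * (B + (B + 1ℚ))
  near : ∀ b z → ∣ b ∣ ≤ℚ B → ∣ b - z ∣ ≤ℚ δ → ∣ z ∣ ≤ℚ B + 1ℚ
  near b z hb h = subst (λ v → ∣ v ∣ ≤ℚ B + 1ℚ) (solve 2 (λ b z → b :+ :- (b :- z) := z) refl b z)
    (ℚP.≤-trans (ℚP.∣p+q∣≤∣p∣+∣q∣ b (- (b - z))) (ℚP.+-mono-≤ hb
      (subst (_≤ℚ 1ℚ) (sym (ℚP.∣-p∣≡∣p∣ (b - z))) (ℚP.≤-trans h δ≤1))))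

-- The graph with weights that are nonnegative at every index

module _ {n : ℕ} (G : WeightedGraph n) where

  open WeightedGraph G

  -- `Hamiltonian` asks for nonnegative weights on every subset, hence the truncation everywhere.
  -- Only on edges is the limit known to be unchanged, and only edges enter the matrices.
  positiveWeights : WeightedGraph n
  positiveWeights = record
    { isEdge        = isEdge
    ; weight        = λ e → positivePart (weight e)
    ; edge-size     = edge-size
    ; weight-nonNeg = λ e _ ε 0<ε → 0 , λ i _ → +-nonNeg (ℚP.p≤q⊔p (seq (weight e) i) 0ℚ) (ℚP.<⇒≤ 0<ε)
    }

  edges-size : All (λ e → ∣ e ∣ˢ ≡ 2) (edges positiveWeights)
  edges-size = All.map (λ {e} → edge-size e) (AllP.all-filter (λ e → T? (isEdge e)) (subsets n))

  degree-≈ : ∀ k S → seq (Token.degree G k S) ≈ seq (Token.degree positiveWeights k S)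
  degree-≈ k S = ≈-resp-≗ (λ i → sym (degree-seq G k S i)) (λ i → sym (degree-seq positiveWeights k S i))
    (≈-sumˢ
      (λ i e → if isEdge e ∧ (∣ S ∩ e ∣ˢ ≡ᵇ 1) then seq (weight e) i else 0ℚ)
      (λ i e → if isEdge e ∧ (∣ S ∩ e ∣ˢ ≡ᵇ 1) then seq (weight e) i ℚ.⊔ 0ℚ else 0ℚ)
      (λ e → ≈-if (isEdge e ∧ (∣ S ∩ e ∣ˢ ≡ᵇ 1)) (seq (weight e)) (λ i → seq (weight e) i ℚ.⊔ 0ℚ)
        (λ eq → weight-≈ e (∧-true (isEdge e) eq))))
    where
    ∧-true : ∀ b {c} → (b ∧ c) ≡ true → b ≡ true
    ∧-true true _ = refl
    weight-≈ : ∀ e → isEdge e ≡ true → seq (weight e) ≈ seq (positivePart (weight e))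
    weight-≈ e e∈E = ≈-sym (seq (positivePart (weight e))) (seq (weight e))
      (positivePart-≈ (weight e) (weight-nonNeg e (subst T (sym e∈E) _)))

module _ {n : ℕ} (G : WeightedGraph n) where

  open WeightedGraph G

  private
    order : ℕ → ℕ
    order k = length (kSubsets n k)

  adjacency-≈ : ∀ k (s o : Fin (order k)) → seq (Token.adjacency G k s o) ≈ seq (Token.adjacency (positiveWeights G) k s o)
  adjacency-≈ k s o = ≈-resp-≗ (λ i → sym (adjacency-seq G k s o i)) (λ i → sym (adjacency-seq (positiveWeights G) k s o i))
    (≈-if (isEdge e) (seq (weight e)) (λ i → seq (weight e) i ℚ.⊔ 0ℚ) (λ e∈E →
      ≈-sym (seq (positivePart (weight e))) (seq (weight e)) (positivePart-≈ (weight e) (weight-nonNeg e (subst T (sym e∈E) _)))))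
    where
    e : Subset n
    e = lookup (kSubsets n k) s ⊕ lookup (kSubsets n k) o

  degreeMatrix-≈ : ∀ k (s o : Fin (order k)) → seq (Token.degreeMatrix G k s o) ≈ seq (Token.degreeMatrix (positiveWeights G) k s o)
  degreeMatrix-≈ k s o = ≈-resp-≗ (λ i → sym (degreeMatrix-seq G k s o i)) (λ i → sym (degreeMatrix-seq (positiveWeights G) k s o i))
    (≈-if (does (s Fin.≟ o)) (seq (Token.degree G k S)) (seq (Token.degree (positiveWeights G) k S)) (λ _ → degree-≈ G k S))
    where
    S : Subset n
    S = lookup (kSubsets n k) s

  H-≈ : ∀ k ϑ ϑ′ t t′ → seq ϑ ≈ seq ϑ′ → seq t ≈ seq t′ → ∀ (s o : Fin (order k)) →
        seq ((t • Token.H G k ϑ) s o) ≈ seq ((t′ • Token.H (positiveWeights G) k ϑ′) s o)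
  H-≈ k ϑ ϑ′ t t′ ϑ≈ t≈ s o = ≈-* t (Token.H G k ϑ s o) t′ (Token.H (positiveWeights G) k ϑ′ s o) t≈
    (≈-+ (seq (Token.adjacency G k s o)) (seq (ϑ *ᴿ D)) (seq (Token.adjacency (positiveWeights G) k s o)) (seq (ϑ′ *ᴿ D′))
      (adjacency-≈ k s o) (≈-* ϑ D ϑ′ D′ ϑ≈ (degreeMatrix-≈ k s o)))
    where
    D D′ : ℝ
    D = Token.degreeMatrix G k s o
    D′ = Token.degreeMatrix (positiveWeights G) k s o

∑∑-expSum-⟶ₛ : ∀ {d} (M : Matrix d) →
  (λ N → seq (∑ λ s → ∑ λ s′ → expSum M N s s′)) ⟶ₛ seq (∑ λ s → ∑ λ s′ → expᴹ M s s′)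
∑∑-expSum-⟶ₛ M = ⟶ₛ-∑ (λ N s → ∑ λ s′ → expSum M N s s′) (λ s → ∑ λ s′ → expᴹ M s s′)
  (λ s → ⟶ₛ-∑ (λ N s′ → expSum M N s s′) (λ s′ → expᴹ M s s′)
    (λ s′ → ⟶⇒⟶ₛ (λ N → expSum M N s s′) (expᴹ M s s′) (expᴹ-converges M s s′)))

∑∑-expSum-≈ : ∀ {d} (M M′ : Matrix d) → (∀ s s′ → seq (M s s′) ≈ seq (M′ s s′)) → ∀ N →
  seq (∑ λ s → ∑ λ s′ → expSum M N s s′) ≈ seq (∑ λ s → ∑ λ s′ → expSum M′ N s s′)
∑∑-expSum-≈ M M′ M≈M′ N = ≈-∑ (λ s → ∑ λ s′ → expSum M N s s′) (λ s → ∑ λ s′ → expSum M′ N s s′)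
  (λ s → ≈-∑ (λ s′ → expSum M N s s′) (λ s′ → expSum M′ N s s′) (≈-expSum M M′ M≈M′ N s))

-- Uniform approximation and the limit

module Approximation {n : ℕ} (G : WeightedGraph n) (t ϑ : ℝ)
                     (0≤t : 0ᴿ ≤ᴿ t) (-1≤ϑ : -ᴿ 1ᴿ ≤ᴿ ϑ) (ϑ≤1 : ϑ ≤ᴿ 1ᴿ) where

  ωᴿ : Subset n → ℝ
  ωᴿ e = positivePart t *ᴿ positivePart (WeightedGraph.weight G e)

  ω-nonNeg : ∀ i e → 0ℚ ≤ℚ seq (ωᴿ e) i
  ω-nonNeg i e = *-nonNeg (ℚP.p≤q⊔p (seq t i) 0ℚ) (ℚP.p≤q⊔p (seq (WeightedGraph.weight G e) i) 0ℚ)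

  truncated : ℕ → ℕ → Field n
  truncated i = Euler.expTruncated (seq (clamp ϑ) i) (clampℚ-lower (seq ϑ i)) (clampℚ-upper (seq ϑ i))
    (λ e → seq (ωᴿ e) i) (ω-nonNeg i) (edges (positiveWeights G))

  -- A Cauchy sequence is bounded over all its indices, so the norm of the Hamiltonian has a bound
  -- independent of `i`. This is what lets the number of sweeps be chosen before `i`.
  κ-bounded : ∃ λ X → 0ℚ ≤ℚ X × (∀ i → Hamiltonian.κ (seq (clamp ϑ) i) (clampℚ-lower (seq ϑ i)) (clampℚ-upper (seq ϑ i))
    (λ e → seq (ωᴿ e) i) (ω-nonNeg i) (edges (positiveWeights G)) ≤ℚ X)
  κ-bounded = X (edges (positiveWeights G)) , X-nonNeg (edges (positiveWeights G)) , λ i → κ≤X i (edges (positiveWeights G))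
    where
    X : List (Subset n) → ℚ
    X = foldr (λ e r → (proj₁ (bound (ωᴿ e)) + proj₁ (bound (ωᴿ e))) + r) 0ℚ
    bound≥0 : ∀ e → 0ℚ ≤ℚ proj₁ (bound (ωᴿ e))
    bound≥0 e = bound-nonNeg (ωᴿ e) (proj₂ (bound (ωᴿ e)))
    X-nonNeg : ∀ es → 0ℚ ≤ℚ X es
    X-nonNeg []       = ℚP.≤-refl
    X-nonNeg (e ∷ es) = +-nonNeg (+-nonNeg (bound≥0 e) (bound≥0 e)) (X-nonNeg es)
    κ≤X : ∀ i es → foldr (λ e r → (seq (ωᴿ e) i + seq (ωᴿ e) i) + r) 0ℚ es ≤ℚ X es
    κ≤X i []       = ℚP.≤-refl
    κ≤X i (e ∷ es) = ℚP.+-mono-≤ (ℚP.+-mono-≤ ω≤ ω≤) (κ≤X i es)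
      where
      ω≤ : seq (ωᴿ e) i ≤ℚ proj₁ (bound (ωᴿ e))
      ω≤ = ℚP.≤-trans (p≤∣p∣ (seq (ωᴿ e) i)) (proj₂ (bound (ωᴿ e)) i)

  a-truncated : ∀ k {δ} → 0ℚ <ℚ δ → ∃ λ N₀ → ∀ N → N₀ ℕ.≤ N → ∃ λ K → ∀ i → K ℕ.≤ i →
                ∣ seq (Token.a G k ϑ t) i - level k (truncated i N) ∣ ≤ℚ δ
  a-truncated k {δ} 0<δ =
    let N₀ , h = ∑∑-expSum-⟶ₛ (t • Token.H G k ϑ) (½ * δ) (½-pos 0<δ)
    in N₀ , λ N N₀≤N →
      let K₁ , h₁ = h N N₀≤N
          K₂ , h₂ = ∑∑-expSum-≈ (t • Token.H G k ϑ) (positivePart t • Token.H (positiveWeights G) k (clamp ϑ))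
            (H-≈ G k ϑ (clamp ϑ) t (positivePart t)
              (≈-sym (seq (clamp ϑ)) (seq ϑ) (clamp-≈ ϑ -1≤ϑ ϑ≤1))
              (≈-sym (seq (positivePart t)) (seq t) (positivePart-≈ t 0≤t))) N (½ * δ) (½-pos 0<δ)
      in K₁ ℕ.⊔ K₂ , λ i K≤i → subst (∣ seq (Token.a G k ϑ t) i - level k (truncated i N) ∣ ≤ℚ_) (halves δ)
        (∣p-r∣≤ (seq (Token.a G k ϑ t) i) (seq (∑ λ s → ∑ λ s′ → expSum (t • Token.H G k ϑ) N s s′) i) (level k (truncated i N))
          (subst (_≤ℚ ½ * δ) (∣p-q∣≡∣q-p∣ (seq (∑ λ s → ∑ λ s′ → expSum (t • Token.H G k ϑ) N s s′) i) (seq (Token.a G k ϑ t) i))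
            (h₁ i (ℕP.m⊔n≤o⇒m≤o K₁ K₂ K≤i)))
          (subst (λ v → ∣ seq (∑ λ s → ∑ λ s′ → expSum (t • Token.H G k ϑ) N s s′) i - v ∣ ≤ℚ ½ * δ)
            (expSum-level (positiveWeights G) (clamp ϑ) (positivePart t) i
              (clampℚ-lower (seq ϑ i)) (clampℚ-upper (seq ϑ i)) (ω-nonNeg i) k N)
            (h₂ i (ℕP.m⊔n≤o⇒n≤o K₁ K₂ K≤i))))

  truncated-approximation : ∀ {δ} → 0ℚ <ℚ δ → ∃ λ N₀ → ∀ N → N₀ ℕ.≤ N → ∀ i →
    ∃ λ (c : Field n) → PositiveLorentz c × (∀ k → ∣ level k (truncated i N) - level k c ∣ ≤ℚ δ)
  truncated-approximation {δ} 0<δ =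
    let X , 0≤X , κ≤X = κ-bounded
        η , 0<η , _ , small = shrink (fromℕ 2 ^ n) 0<δ
        N₀ , h = expTruncated-approximation (edges-size G) 0≤X 0<η
    in N₀ , λ N N₀≤N i →
      let c , PL , close = h N N₀≤N (seq (clamp ϑ) i) (clampℚ-lower (seq ϑ i)) (clampℚ-upper (seq ϑ i))
            (λ e → seq (ωᴿ e) i) (ω-nonNeg i) (κ≤X i)
      in c , PL , λ k → ℚP.≤-trans (level-dominated k (truncated i N) c close)
        (subst (_≤ℚ δ) (ℚP.*-comm η (fromℕ 2 ^ n)) small)

  a-approximation : ∀ k₀ k₁ k₂ {δ} → 0ℚ <ℚ δ → ∃ λ K → ∀ i → K ℕ.≤ i → ∃ λ (c : Field n) → PositiveLorentz c ×
    ∣ seq (Token.a G k₀ ϑ t) i - level k₀ c ∣ ≤ℚ δ ×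
    ∣ seq (Token.a G k₁ ϑ t) i - level k₁ c ∣ ≤ℚ δ ×
    ∣ seq (Token.a G k₂ ϑ t) i - level k₂ c ∣ ≤ℚ δ
  a-approximation k₀ k₁ k₂ {δ} 0<δ =
    let N₀ , h₀ = a-truncated k₀ (½-pos 0<δ)
        N₁ , h₁ = a-truncated k₁ (½-pos 0<δ)
        N₂ , h₂ = a-truncated k₂ (½-pos 0<δ)
        N₃ , h₃ = truncated-approximation (½-pos 0<δ)
        -- `N` must precede the index: the thresholds `K₀`, `K₁`, `K₂` depend on it, whereas
        -- `truncated-approximation` holds at this `N` for every `i`. The field `c` may vary with
        -- `i` but serves all three levels.
        N = (N₀ ℕ.⊔ N₁) ℕ.⊔ (N₂ ℕ.⊔ N₃)
        left = ℕP.m≤m⊔n (N₀ ℕ.⊔ N₁) (N₂ ℕ.⊔ N₃)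
        right = ℕP.m≤n⊔m (N₀ ℕ.⊔ N₁) (N₂ ℕ.⊔ N₃)
        K₀ , g₀ = h₀ N (≤-trans (ℕP.m≤m⊔n N₀ N₁) left)
        K₁ , g₁ = h₁ N (≤-trans (ℕP.m≤n⊔m N₀ N₁) left)
        K₂ , g₂ = h₂ N (≤-trans (ℕP.m≤m⊔n N₂ N₃) right)
        g₃ = h₃ N (≤-trans (ℕP.m≤n⊔m N₂ N₃) right)
    in (K₀ ℕ.⊔ K₁) ℕ.⊔ K₂ , λ i K≤i →
      let c , PL , close = g₃ i
          K₀⊔K₁≤i = ℕP.m⊔n≤o⇒m≤o (K₀ ℕ.⊔ K₁) K₂ K≤i
          combined : ∀ k → ∣ seq (Token.a G k ϑ t) i - level k (truncated i N) ∣ ≤ℚ ½ * δ →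
                     ∣ seq (Token.a G k ϑ t) i - level k c ∣ ≤ℚ δ
          combined k g = subst (∣ seq (Token.a G k ϑ t) i - level k c ∣ ≤ℚ_) (halves δ)
            (∣p-r∣≤ (seq (Token.a G k ϑ t) i) (level k (truncated i N)) (level k c) g (close k))
      in c , PL , combined k₀ (g₀ i (ℕP.m⊔n≤o⇒m≤o K₀ K₁ K₀⊔K₁≤i)) ,
         combined k₁ (g₁ i (ℕP.m⊔n≤o⇒n≤o K₀ K₁ K₀⊔K₁≤i)) ,
         combined k₂ (g₂ i (ℕP.m⊔n≤o⇒n≤o (K₀ ℕ.⊔ K₁) K₂ K≤i))

log-concave-limit : ∀ b₀ b₁ b₂ →
  (∀ {δ} → 0ℚ <ℚ δ → ∃ λ K → ∀ i → K ℕ.≤ i → ∃ λ z₀ → ∃ λ z₁ → ∃ λ z₂ →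
    (∣ seq b₀ i - z₀ ∣ ≤ℚ δ × ∣ seq b₁ i - z₁ ∣ ≤ℚ δ × ∣ seq b₂ i - z₂ ∣ ≤ℚ δ) × z₀ * z₂ ≤ℚ z₁ * z₁) →
  b₁ ² ≥ᴿ b₀ *ᴿ b₂
log-concave-limit b₀ b₁ b₂ approximate ε 0<ε =
  let B₀ , hB₀ = bound b₀
      B₁ , hB₁ = bound b₁
      B₂ , hB₂ = bound b₂
      B = B₀ + (B₁ + B₂)
      0≤B₀ = bound-nonNeg b₀ hB₀
      0≤B₁ = bound-nonNeg b₁ hB₁
      0≤B₂ = bound-nonNeg b₂ hB₂
      δ , 0<δ , δ≤1 , small = shrink ((B + (B + 1ℚ)) + (B + (B + 1ℚ))) 0<ε
      K , h = approximate 0<δ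
  in K , λ i K≤i →
    let z₀ , z₁ , z₂ , (h₀ , h₁ , h₂) , log-concave = h i K≤i
    in log-concave-approximation (seq b₀ i) (seq b₁ i) (seq b₂ i) z₀ z₁ z₂
         (ℚP.≤-trans (hB₀ i) (p≤p+q B₀ (+-nonNeg 0≤B₁ 0≤B₂)))
         (ℚP.≤-trans (hB₁ i) (≤-by-diff {B₁} (B₀ + B₂) (+-nonNeg 0≤B₀ 0≤B₂)
           (solve 3 (λ x y z → x :+ (y :+ z) := y :+ (x :+ z)) refl B₀ B₁ B₂)))
         (ℚP.≤-trans (hB₂ i) (≤-by-diff {B₂} (B₀ + B₁) (+-nonNeg 0≤B₀ 0≤B₁)
           (solve 3 (λ x y z → x :+ (y :+ z) := z :+ (x :+ y)) refl B₀ B₁ B₂)))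
         h₀ h₁ h₂ δ≤1 small log-concave

binomial⁻¹ : ∀ {n k} → k ≤ n → ℚ
binomial⁻¹ {n} {k} k≤n = (ℤ.+ 1 / (n C k)) {{nCk≢0 k≤n}}

-- The reciprocal of a positive binomial coefficient is at most 1, so the normalization does not
-- enlarge the error.
normalized-close : ∀ {n} (G : WeightedGraph n) ϑ t k (k≤n : k ≤ n) i z {δ} → ∣ seq (Token.a G k ϑ t) i - z ∣ ≤ℚ δ →
                   ∣ seq (normalized-a G ϑ t k k≤n) i - z * binomial⁻¹ k≤n ∣ ≤ℚ δ
normalized-close {n} G ϑ t k k≤n i z = ∣*unit∣≤ (seq (Token.a G k ϑ t) i) z (binomial⁻¹ k≤n)
  (unit-nonNeg (n C k) {{nCk≢0 k≤n}}) (unit≤1 (n C k) {{nCk≢0 k≤n}})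

level-log-concave : ∀ {n} {c : Field n} → PositiveLorentz c → ∀ k → 1 ≤ k → (k-1≤n : k ∸ 1 ≤ n) (k≤n : k ≤ n) (k<n : k < n) →
  (level (k ∸ 1) c * binomial⁻¹ k-1≤n) * (level (suc k) c * binomial⁻¹ k<n) ≤ℚ (level k c * binomial⁻¹ k≤n) * (level k c * binomial⁻¹ k≤n)
level-log-concave {n} {c} PL (suc k) _ k-1≤n k≤n k<n = go n≡ c PL
  (*-unit (n C k) {{nCk≢0 k-1≤n}}) (*-unit (n C suc k) {{nCk≢0 k≤n}}) (*-unit (n C (2 ℕ.+ k)) {{nCk≢0 k<n}})
  where
  u₀ u₁ u₂ : ℚ
  u₀ = binomial⁻¹ k-1≤n
  u₁ = binomial⁻¹ k≤n
  u₂ = binomial⁻¹ k<n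
  n≡ : k ℕ.+ (2 ℕ.+ (n ∸ (2 ℕ.+ k))) ≡ n
  n≡ = trans (sym (ℕP.+-assoc k 2 (n ∸ (2 ℕ.+ k)))) (trans (cong (ℕ._+ (n ∸ (2 ℕ.+ k))) (ℕP.+-comm k 2)) (ℕP.m+[n∸m]≡n k<n))
  -- The number of vertices is made a variable again so that the equation can be matched. The
  -- reciprocals stay fixed rationals, known only through the three product equations.
  go : ∀ {m n} → k ℕ.+ (2 ℕ.+ m) ≡ n → (c : Field n) → PositiveLorentz c →
       fromℕ (n C k) * u₀ ≡ 1ℚ → fromℕ (n C suc k) * u₁ ≡ 1ℚ → fromℕ (n C (2 ℕ.+ k)) * u₂ ≡ 1ℚ →
       (level k c * u₀) * (level (2 ℕ.+ k) c * u₂) ≤ℚ (level (1 ℕ.+ k) c * u₁) * (level (1 ℕ.+ k) c * u₁)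
  go {m} refl c (c-pos , L) = newton-normalized {k} {m} {u₀} {u₁} {u₂} c-pos L

theorem1p2 : ∀ (n : ℕ) (G : WeightedGraph n) (t ϑ : ℝ) →
    0ᴿ ≤ᴿ t → -ᴿ 1ᴿ ≤ᴿ ϑ → ϑ ≤ᴿ 1ᴿ →
    ∀ (k : ℕ) → 1 ≤ k → (k<n : k < n) →
    normalized-a G ϑ t k (<⇒≤ k<n) ²
    ≥ᴿ normalized-a G ϑ t (k ∸ 1) (≤-trans (m∸n≤m k 1) (<⇒≤ k<n))
    *ᴿ normalized-a G ϑ t (suc k) k<n
theorem1p2 n G t ϑ 0≤t -1≤ϑ ϑ≤1 k 1≤k k<n = log-concave-limit
  (normalized-a G ϑ t (k ∸ 1) (≤-trans (m∸n≤m k 1) (<⇒≤ k<n))) (normalized-a G ϑ t k (<⇒≤ k<n)) (normalized-a G ϑ t (suc k) k<n)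
  λ 0<δ → let K , h = Approximation.a-approximation G t ϑ 0≤t -1≤ϑ ϑ≤1 (k ∸ 1) k (suc k) 0<δ in
    K , λ i K≤i → let c , PL , h₀ , h₁ , h₂ = h i K≤i in
      level (k ∸ 1) c * binomial⁻¹ k-1≤n , level k c * binomial⁻¹ (<⇒≤ k<n) , level (suc k) c * binomial⁻¹ k<n ,
      (normalized-close G ϑ t (k ∸ 1) k-1≤n i (level (k ∸ 1) c) h₀ ,
       normalized-close G ϑ t k (<⇒≤ k<n) i (level k c) h₁ ,
       normalized-close G ϑ t (suc k) k<n i (level (suc k) c) h₂) ,
      level-log-concave PL k 1≤k k-1≤n (<⇒≤ k<n) k<n
  where
  k-1≤n : k ∸ 1 ≤ n
  k-1≤n = ≤-trans (m∸n≤m k 1) (<⇒≤ k<n)
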